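{- Let $p_1,\dots,p_d$ be distinct primes, $M=p_1^2\cdots p_d^2$, $M_j=M/p_j^2$, and $$B=\Big\{\sum_{j=1}^d c_jM_j:\ c_j\in\{0,1,\dots,p_j-1\}\text{ for } j=1,\dots,d\Big\}\subset\mathbb{Z}_M,$$ and let $A\subset\mathbb{Z}_M$ satisfy $A\oplus B=\mathbb{Z}_M$. For $i\in\{1,\dots,d\}$ let $F_i=\{0,M/p_i,2M/p_i,\dots,(p_i-1)M/p_i\}\subset\mathbb{Z}_M$. (a) If $d\le 6$, then there exist $u\in A$ and $i\in\{1,\dots,d\}$ such that $u+F_i\subset A$; in particular there exists $i$ with $M/p_i\in\mathrm{Div}(A)\cup\mathrm{Div}(B)$. (b) If $d=7$, then there exists $i\in\{1,\dots,d\}$ such that $M/p_i\in\mathrm{Div}(A)\cup\mathrm{Div}(B)$.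
   Context: For $A,B\subset\mathbb{Z}_M$, $A\oplus B=\mathbb{Z}_M$ (a tiling) means every element of $\mathbb{Z}_M$ can be written uniquely as $a+b\bmod M$ with $a\in A$, $b\in B$. For $m,n\in\mathbb{Z}$, $(m,n)$ is their gcd, and $\mathrm{Div}(A)=\{(a-a',M): a,a'\in A\}$ (elements of $\mathbb{Z}_M$ represented by integers). -}

module Defs where

open import Level using (0ℓ)
open import Data.Nat as ℕ using (ℕ; _*_; _<_)
open import Data.Integer as ℤ using (ℤ; +_; _-_)
open import Data.Integer.Divisibility using (_∣_)
open import Data.Integer.GCD using (gcd)
open import Data.Fin using (Fin; toℕ; _≟_) renaming (zero to Fz; suc to Fs)
open import Data.Product using (Σ; ∃; ∃-syntax; _×_)
open import Relation.Nullary using (yes; no)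
open import Relation.Unary using (Pred)
open import Relation.Binary.PropositionalEquality using (_≡_)

∏ : ∀ {d} → (Fin d → ℕ) → ℕ
∏ {ℕ.zero} f = 1
∏ {ℕ.suc d} f = f Fz * ∏ (λ j → f (Fs j))

∑ : ∀ {d} → (Fin d → ℕ) → ℕ
∑ {ℕ.zero} f = 0
∑ {ℕ.suc d} f = f Fz ℕ.+ ∑ (λ j → f (Fs j))

infix 4 _≡ᵐ_[mod_]
_≡ᵐ_[mod_] : ℤ → ℤ → ℕ → Set
x ≡ᵐ y [mod m ] = (+ m) ∣ (x - y)

-- Subsets of ℤ_M (elements represented by 0,…,M-1).
SubsetZ : ℕ → Set₁
SubsetZ M = Pred (Fin M) 0ℓ

Tiling : (M : ℕ) → SubsetZ M → SubsetZ M → Set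
Tiling M A B =
  (∀ (x : Fin M) → ∃[ a ] ∃[ b ] (A a × B b × (+ toℕ a ℤ.+ + toℕ b) ≡ᵐ + toℕ x [mod M ]))
  × (∀ (x a b a' b' : Fin M) → A a → B b → A a' → B b'
       → (+ toℕ a ℤ.+ + toℕ b) ≡ᵐ + toℕ x [mod M ]
       → (+ toℕ a' ℤ.+ + toℕ b') ≡ᵐ + toℕ x [mod M ]
       → a ≡ a' × b ≡ b')

_∈Div_ : ∀ {M} → ℕ → SubsetZ M → Set
_∈Div_ {M} g A = ∃[ a ] ∃[ a' ] (A a × A a' × gcd (+ toℕ a - + toℕ a') (+ M) ≡ + g)

_∈mod_ : ∀ {M} → ℤ → SubsetZ M → Set
_∈mod_ {M} n A = ∃[ x ] (A x × (+ toℕ x ≡ᵐ n [mod M ]))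

module Setup {d : ℕ} (p : Fin d → ℕ) where
  M : ℕ
  M = ∏ (λ k → p k * p k)

  Mj : Fin d → ℕ
  Mj j = ∏ (λ k → sq k)
    where sq : Fin d → ℕ
          sq k with k ≟ j
          ... | yes _ = 1
          ... | no _ = p k * p k

  M/p : Fin d → ℕ
  M/p i = p i * Mj i

  B : SubsetZ M
  B x = ∃ λ (c : Fin d → ℕ) → ((∀ j → c j < p j) × (+ toℕ x ≡ᵐ + ∑ (λ j → c j * Mj j) [mod M ]))

  TranslateFiIn : SubsetZ M → Fin M → Fin d → Set
  TranslateFiIn A u i = ∀ t → t < p i → (+ (toℕ u ℕ.+ t * M/p i)) ∈mod A

{-# OPTIONS --safe #-}

-- By the Chinese remainder theorem A ⊕ B = ℤ_M is a tiling of ∏ ℤ/p_j² by boxes.  Write a residue modulo p_j² as its class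
-- modulo p_j together with a value.  Keller's shift argument shows that for every assignment f of a value to each class in
-- each direction exactly one a ∈ A has, in every direction, the value that f gives to its class.  If A contains no column
-- u + F_i, then at every f one can change the value of the class in direction i so that some other class changes; let
-- i → j mean that the class in direction j does.  This digraph is asymmetric and without sinks, and changing f in
-- direction j transforms it in a controlled way.  For d ≤ 6 no family of digraphs is closed under these transformations,
-- which is verified by reflection; hence a column exists.
-- For d = 7 fix the values in the direction j₀ of the smallest prime.  The other six directions must contain a line of
-- p_i words whose classes agree outside j₀; only p_{j₀} < p_i classes are available there, so two of the words are twins.
module Submission where

open import Defs
open import Data.Nat using (ℕ; _≤_)
open import Data.Nat.Primality using (Prime)
open import Data.Fin using (Fin)
open import Data.Product using (∃-syntax; _×_)
open import Data.Sum using (_⊎_)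
open import Function.Definitions using (Injective)
open import Relation.Binary.PropositionalEquality using (_≡_)
open import Data.Bool using (Bool; true; false; not; _∧_; _xor_; if_then_else_)
open import Data.Bool.ListAction using (all; any)
open import Data.Bool.Properties using (T-≡)
open import Data.Empty using (⊥; ⊥-elim)
open import Data.Fin using (zero; suc; toℕ; fromℕ<; punchIn; punchOut) renaming (_≟_ to _≟ᶠ_)
open import Data.Fin.Properties using (suc-injective; toℕ-fromℕ<; toℕ<n; toℕ-injective; fromℕ<-toℕ; fromℕ<-injective;
  any?; all?; ¬∀⟶∃¬; pigeonhole; punchIn-punchOut; punchOut-punchIn; punchInᵢ≢i)
open import Data.Integer as ℤ using (ℤ; +_; -_; _-_)
import Data.Integer.DivMod as ℤ
import Data.Integer.GCD as ℤ
import Data.Integer.Properties as ℤ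
open import Data.Integer.Divisibility.Signed as Signed using (divides)
open import Data.Integer.Tactic.RingSolver using (solve-∀)
open import Data.List using (List; []; _∷_; _++_; map; concatMap)
open import Data.List.Membership.Propositional using (_∈_)
open import Data.List.Relation.Unary.All using (All; []; _∷_)
import Data.List.Relation.Unary.All.Properties as Allₚ
open import Data.List.Relation.Unary.Any using (Any; here; there)
import Data.List.Relation.Unary.Any.Properties as Anyₚ
open import Data.Maybe using (Maybe; just; nothing)
open import Data.Nat using (zero; suc; _+_; _*_; _∸_; _<_; NonZero; _%_; _/_; _≡ᵇ_; _≟_; _<?_; z<s; z≤n; s≤s;
  >-nonZero; >-nonZero⁻¹; nonTrivial⇒n>1)
import Data.Nat.DivMod as ℕ
import Data.Nat.Properties as ℕ
open import Data.Nat.Coprimality as Coprimality using (Coprime; coprime-divisor; coprime-Bézout)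
open import Data.Nat.Divisibility using (_∣_; _∣?_; _∣0; ∣-trans; ∣-refl; ∣1⇒≡1; ∣⇒≤; 1∣_; m∣m*n; n∣m*n; ∣n⇒∣m*n;
  *-monoʳ-∣; *-cancelˡ-∣; *-cancelʳ-∣) renaming (divides to dividesℕ)
open import Data.Nat.GCD using (gcd[m,n]∣m; gcd[m,n]∣n; gcd-greatest; module Bézout)
open import Data.Nat.Primality using (prime⇒irreducible; prime⇒nonZero; prime⇒nonTrivial)
import Data.Nat.Tactic.RingSolver as ℕSolver
open import Data.Product using (Σ; ∃; _,_; proj₁; proj₂)
open import Data.Sum as Sum using (inj₁; inj₂)
open import Function using (_∘_)
open import Function.Bundles using (Equivalence)
open import Relation.Binary.PropositionalEquality using (_≢_; refl; sym; trans; cong; cong₂; subst; subst₂; _≗_; module ≡-Reasoning)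
open import Relation.Nullary using (¬_; Dec; yes; no; does)
open import Relation.Nullary.Decidable using (_×-dec_; map′; dec-true; dec-false)

-- The digraph records whether a class changes, not to which class. This leaves a gap in the rule
-- for changing direction `j`: if `i → j`, and the moves in directions `i` and `j` both change the
-- class in direction `k`, the two new classes may or may not coincide, so the arc `i → k` at the
-- new point is undetermined. Directions without an arc to `j` may need a new value to move to, so
-- their arcs are lost altogether. The closure conditions are therefore applied to partial
-- knowledge: lists of arcs known to be present or absent, refuted by cases, with impossible
-- patterns collected and reused under relabelling. The patterns culminate in the statement that no
-- vertex has two out-arcs, which a change of direction `j` along `i → j → k` violates. One
-- certificate on six labels serves all `d ≤ 6`, since several labels may name one direction. For
-- `d = 7` the words of a line in the section may still differ in direction `j₀`; the pigeonhole
-- principle aligns only two of them, which gives a divisor but no full translate.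

-- Families of digraphs closed under moves, and refutations of them

Digraph : Set
Digraph = ℕ → ℕ → Bool

-- Labels are nonzero decimal digits, so that arcs and relabellings can be written as numerals. With
-- fewer than six directions, several labels stand for the same one.
vertices : List ℕ
vertices = 1 ∷ 2 ∷ 3 ∷ 4 ∷ 5 ∷ 6 ∷ []

-- On six labels surjectivity makes `τ` a permutation. In this form it is exactly what carries the
-- out-arcs of `serial` through a relabelling.
Onto : (ℕ → ℕ) → Set
Onto τ = ∀ {m} → m ∈ vertices → ∃ λ n → n ∈ vertices × τ n ≡ m

-- H i j says that moving from a point in direction i changes the class in direction j.  Flipped j relates H to the digraph
-- at the point reached by moving in direction j; Slid i j changes the value of the class met in direction j after moving
-- in direction i, which leaves the word at the point itself unchanged.
Flipped : ℕ → Digraph → Digraph → Set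
Flipped j H H′ = (∀ k → H′ j k ≡ H j k)
  × (∀ i k → H i j ≡ true → H i k ∧ H j k ≡ false → H′ i k ≡ H i k xor H j k)

Slid : ℕ → ℕ → Digraph → Digraph → Set
Slid i j H H′ = (∀ m → (∀ k → H′ m k ≡ H m k) ⊎ (H m j ≡ true × H′ m j ≡ true))
  × (∃ λ k → k ∈ vertices × k ≢ j × H′ i k ≡ true)
  × H′ i j ≡ true

-- `𝓢` stands for the digraphs seen at all assignments and all choices of moving values together; no
-- single digraph is contradictory, only the closed family is. `serial` is where the absence of
-- columns enters.
record Game (𝓢 : Digraph → Set) : Set where
  field
    irreflexive : ∀ {H} → 𝓢 H → ∀ i → H i i ≡ false
    asymmetric  : ∀ {H} → 𝓢 H → ∀ i j → H i j ≡ true → H j i ≡ false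
    serial      : ∀ {H} → 𝓢 H → ∀ i → ∃ λ j → j ∈ vertices × H i j ≡ true
    relabel     : ∀ {H} τ → Onto τ → 𝓢 H → 𝓢 (λ i j → H (τ i) (τ j))
    flip        : ∀ {H} j → 𝓢 H → ∃ λ H′ → 𝓢 H′ × Flipped j H H′
    slide       : ∀ {H} i j → 𝓢 H → H i j ≡ true → (∀ {k} → k ∈ vertices → k ≢ j → H i k ≡ false)
                → ∃ λ H′ → 𝓢 H′ × Slid i j H H′

record Literal : Set where
  constructor lit
  field
    source target : ℕ
    value : Bool

_⊨_ : Digraph → Literal → Set
H ⊨ lit i j v = H i j ≡ v

_⊨*_ : Digraph → List Literal → Set
H ⊨* K = All (H ⊨_) K

negate : Literal → Literal
negate (lit i j v) = lit i j (not v)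

-- Asymmetry is built into the lookup: a recorded arc also answers the query for the reverse arc,
-- negatively.
search : List Literal → ℕ → ℕ → Maybe Bool
search [] i j = nothing
search (lit a b v ∷ K) i j =
  if (a ≡ᵇ i) ∧ (b ≡ᵇ j) then just v else
  if v ∧ (a ≡ᵇ j) ∧ (b ≡ᵇ i) then just false else
  search K i j

known : List Literal → ℕ → ℕ → Maybe Bool
known K i j = if i ≡ᵇ j then just false else search K i j

is : Bool → Maybe Bool → Bool
is v nothing = false
is true (just b) = b
is false (just b) = not b

-- The literals form a disjunction. Disjuncts that are already refuted disappear, so a refutation
-- lists only the remaining cases, and an empty list closes the branch.
live : List Literal → List Literal → List Literal
live K [] = []
live K (lit i j v ∷ ls) = if is (not v) (known K i j) then live K ls else lit i j v ∷ live K ls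

recall : ℕ → ℕ → Maybe Bool → List Literal
recall i j nothing = []
recall i j (just v) = lit i j v ∷ []

-- Two classes that both differ from a third may be equal or not, hence nothing is recorded when
-- both arcs are present.
xored : ℕ → ℕ → Maybe Bool → Maybe Bool → List Literal
xored i k (just a) (just b) = if a ∧ b then [] else lit i k (a xor b) ∷ []
xored i k _ _ = []

flipRow : List Literal → ℕ → ℕ → List Literal
flipRow K j i = if is true (known K i j)
  then concatMap (λ k → xored i k (known K i k) (known K j k)) vertices else []

-- Only row `j` and the rows of vertices known to point to `j` survive; elsewhere the flip may
-- choose new moving values.
afterFlip : List Literal → ℕ → List Literal
afterFlip K j = concatMap (λ k → recall j k (known K j k)) vertices ++ concatMap (flipRow K j) vertices

-- A move with an arc to `j` may reach the class whose value is altered, after which only that arc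
-- is certain. A move without it does not notice the alteration, so its whole row stays.
slideRow : List Literal → ℕ → ℕ → List Literal
slideRow K j m with known K m j
... | nothing = []
... | just true = lit m j true ∷ []
... | just false = concatMap (λ k → recall m k (known K m k)) vertices

afterSlide : List Literal → ℕ → List Literal
afterSlide K j = concatMap (slideRow K j) vertices

isThin : List Literal → ℕ → ℕ → Bool
isThin K i j = is true (known K i j) ∧ all (λ k → if k ≡ᵇ j then true else is false (known K i k)) vertices

digit : ℕ → ℕ → ℕ
digit zero c = 0
digit (suc zero) c = c % 10
digit (suc (suc i)) c = digit (suc i) (c / 10)

-- Groups of three decimal digits: 1ij stands for the arc i → j and 2ij for its absence.
literals : ℕ → List Literal
-- The fuel is the number of ordered pairs of labels.
literals = decode 36
  where
  decode : ℕ → ℕ → List Literal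
  decode zero c = []
  decode (suc fuel) zero = []
  decode (suc fuel) c@(suc _) =
    lit (c / 10 % 10) (c % 10) (c / 100 % 10 ≡ᵇ 1) ∷ decode fuel (c / 1000)

isOnto : (ℕ → ℕ) → Bool
isOnto τ = all (λ m → any (λ n → τ n ≡ᵇ m) vertices) vertices

-- A Refutation shows that no digraph of the game satisfies a list of literals: cut and row split cases, nogood n τ applies
-- the n-th entry of the certificate relabelled by τ (whose i-th decimal digit from the right is the image of i), and flip
-- and slide pass to a neighbouring digraph.
data Refutation : Set where
  cut   : (i j : ℕ) → Refutation → Refutation → Refutation
  row   : (i : ℕ) → List Refutation → Refutation
  nogood : (n τ : ℕ) → List Refutation → Refutation
  flip  : (j : ℕ) → Refutation → Refutation
  slide : (i j : ℕ) → List Refutation → Refutation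

use : ℕ → ℕ → Refutation → Refutation
use n τ r = nogood n τ (r ∷ [])

clash : ℕ → ℕ → Refutation
clash n τ = nogood n τ []

sole : ℕ → Refutation → Refutation
sole i r = row i (r ∷ [])

sink : ℕ → Refutation
sink i = row i []

nth : List (List Literal) → ℕ → List Literal
-- A loop is excluded by irreflexivity, so this default is a sound pattern and indices need no
-- bound.
nth [] _ = lit 0 0 true ∷ []
nth (N ∷ Ns) zero = N
nth (N ∷ Ns) (suc n) = nth Ns n

arcsFrom : ℕ → List ℕ → List Literal
arcsFrom i = map (λ j → lit i j true)

others : ℕ → List ℕ
others j = concatMap (λ k → if k ≡ᵇ j then [] else k ∷ []) vertices

rename : (ℕ → ℕ) → Literal → Literal
rename τ (lit i j v) = lit (τ i) (τ j) v

mutual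
  -- An impossible pattern acts as a clause: after relabelling at least one of its literals fails,
  -- which leaves one case for each literal not already known to hold.
  check : List (List Literal) → List Literal → Refutation → Bool
  check Ns K (cut i j r s) = check Ns (lit i j true ∷ K) r ∧ check Ns (lit i j false ∷ K) s
  check Ns K (row i rs) = checks Ns K (live K (arcsFrom i vertices)) rs
  check Ns K (nogood n c rs) = isOnto (λ i → digit i c)
    ∧ checks Ns K (live K (map (λ l → negate (rename (λ i → digit i c) l)) (nth Ns n))) rs
  check Ns K (flip j r) = check Ns (afterFlip K j) r
  -- Before the slide `j` is the only target of `i`. Afterwards `i` keeps it and gains a second
  -- target, which is unknown; hence one case for each other label.
  check Ns K (slide i j rs) = isThin K i j
    ∧ checks Ns (lit i j true ∷ afterSlide K j) (live (lit i j true ∷ afterSlide K j) (arcsFrom i (others j))) rs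

  checks : List (List Literal) → List Literal → List Literal → List Refutation → Bool
  checks Ns K [] [] = true
  checks Ns K (l ∷ ls) (r ∷ rs) = check Ns (l ∷ K) r ∧ checks Ns K ls rs
  checks Ns K _ _ = false

-- Soundness of the checker

∧-true : ∀ {a b} → a ∧ b ≡ true → a ≡ true × b ≡ true
∧-true {true} {true} _ = refl , refl

≡ᵇ-true : ∀ {m n} → (m ≡ᵇ n) ≡ true → m ≡ n
≡ᵇ-true {m} {n} e = ℕ.≡ᵇ⇒≡ m n (Equivalence.from T-≡ e)

all-true : ∀ {A : Set} (p : A → Bool) xs → all p xs ≡ true → ∀ {x} → x ∈ xs → p x ≡ true
all-true p (x ∷ xs) e (here refl) = proj₁ (∧-true e)
all-true p (x ∷ xs) e (there x∈) = all-true p xs (proj₂ (∧-true {p x} e)) x∈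

any-true : ∀ {A : Set} (p : A → Bool) xs → any p xs ≡ true → ∃ λ x → x ∈ xs × p x ≡ true
any-true p (x ∷ xs) e with p x in px
... | true = x , here refl , px
... | false = let y , y∈ , py = any-true p xs e in y , there y∈ , py

isOnto-sound : ∀ τ → isOnto τ ≡ true → Onto τ
isOnto-sound τ e m∈ =
  let n , n∈ , eq = any-true (λ n → τ n ≡ᵇ _) vertices (all-true (λ m → any (λ n → τ n ≡ᵇ m) vertices) vertices e m∈)
  in n , n∈ , ≡ᵇ-true eq

All-concatMap : ∀ {A : Set} {P : Literal → Set} (f : A → List Literal) (xs : List A)
  → (∀ x → All P (f x)) → All P (concatMap f xs)
All-concatMap f [] h = []
All-concatMap f (x ∷ xs) h = Allₚ.++⁺ (h x) (All-concatMap f xs h)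

module Soundness {𝓢 : Digraph → Set} (game : Game 𝓢) where
  open Game game renaming (flip to flipG; slide to slideG)

  search-sound : ∀ {H} → 𝓢 H → ∀ K i j {v} → H ⊨* K → search K i j ≡ just v → H i j ≡ v
  search-sound s (lit a b true ∷ K) i j (h ∷ hs) e with (a ≡ᵇ i) ∧ (b ≡ᵇ j) in e₁
  search-sound s (lit a b true ∷ K) i j (h ∷ hs) refl | true
    with refl ← ≡ᵇ-true {a} (proj₁ (∧-true e₁)) | refl ← ≡ᵇ-true {b} (proj₂ (∧-true {a ≡ᵇ i} e₁)) = h
  ... | false with (a ≡ᵇ j) ∧ (b ≡ᵇ i) in e₂
  search-sound s (lit a b true ∷ K) i j (h ∷ hs) refl | false | true
    with refl ← ≡ᵇ-true {a} (proj₁ (∧-true e₂)) | refl ← ≡ᵇ-true {b} (proj₂ (∧-true {a ≡ᵇ j} e₂)) = asymmetric s a b h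
  ... | false = search-sound s K i j hs e
  search-sound s (lit a b false ∷ K) i j (h ∷ hs) e with (a ≡ᵇ i) ∧ (b ≡ᵇ j) in e₁
  search-sound s (lit a b false ∷ K) i j (h ∷ hs) refl | true
    with refl ← ≡ᵇ-true {a} (proj₁ (∧-true e₁)) | refl ← ≡ᵇ-true {b} (proj₂ (∧-true {a ≡ᵇ i} e₁)) = h
  ... | false = search-sound s K i j hs e

  known-sound : ∀ {H} → 𝓢 H → ∀ {K} → H ⊨* K → ∀ i j {v} → known K i j ≡ just v → H i j ≡ v
  known-sound s {K} h i j e with i ≡ᵇ j in i≡j
  known-sound s {K} h i j refl | true with refl ← ≡ᵇ-true {i} i≡j = irreflexive s i
  ... | false = search-sound s K i j h e

  is-sound : ∀ {H} → 𝓢 H → ∀ {K} → H ⊨* K → ∀ i j v → is v (known K i j) ≡ true → H i j ≡ v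
  is-sound s {K} h i j v e with known K i j in eq
  is-sound s h i j true refl | just true = known-sound s h i j eq
  is-sound s h i j false e | just false = known-sound s h i j eq

  live-sound : ∀ {H} → 𝓢 H → ∀ {K} → H ⊨* K → ∀ ls → Any (H ⊨_) ls → Any (H ⊨_) (live K ls)
  live-sound s {K} h (lit i j v ∷ ls) a with is (not v) (known K i j) in e
  live-sound s {K} h (lit i j v ∷ ls) (here px) | true = ⊥-elim (not-fix v (trans (sym px) (is-sound s h i j (not v) e)))
    where
    not-fix : ∀ v → v ≢ not v
    not-fix true ()
    not-fix false ()
  live-sound s h (lit i j v ∷ ls) (there a) | true = live-sound s h ls a
  live-sound s h (lit i j v ∷ ls) (here px) | false = here px
  live-sound s h (lit i j v ∷ ls) (there a) | false = there (live-sound s h ls a)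

  recall-sound : ∀ {H H′} → 𝓢 H → ∀ {K} → H ⊨* K → ∀ i → (∀ k → H′ i k ≡ H i k)
    → ∀ k → H′ ⊨* recall i k (known K i k)
  recall-sound s {K} h i same k with known K i k in e
  ... | nothing = []
  ... | just v = trans (same k) (known-sound s h i k e) ∷ []

  afterFlip-sound : ∀ {H H′} → 𝓢 H → ∀ {K} → H ⊨* K → ∀ j → Flipped j H H′ → H′ ⊨* afterFlip K j
  afterFlip-sound {H} {H′} s {K} h j (same , xors) = Allₚ.++⁺
    (All-concatMap _ vertices (recall-sound s h j same)) (All-concatMap _ vertices flipRow-sound)
    where
    flipRow-sound : ∀ i → H′ ⊨* flipRow K j i
    flipRow-sound i with is true (known K i j) in e
    ... | false = []
    ... | true = All-concatMap _ vertices entry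
      where
      entry : ∀ k → H′ ⊨* xored i k (known K i k) (known K j k)
      entry k with known K i k in e₁ | known K j k in e₂
      ... | nothing | _ = []
      ... | just a | nothing = []
      ... | just a | just b with a ∧ b in a∧b
      ... | true = []
      ... | false with refl ← known-sound s h i k e₁ | refl ← known-sound s h j k e₂
        = xors i k (is-sound s h i j true e) a∧b ∷ []

  afterSlide-sound : ∀ {H H′} → 𝓢 H → ∀ {K} → H ⊨* K → ∀ i j → Slid i j H H′ → H′ ⊨* afterSlide K j
  afterSlide-sound {H} {H′} s {K} h i j (rows , _) = All-concatMap _ vertices slideRow-sound
    where
    slideRow-sound : ∀ m → H′ ⊨* slideRow K j m
    slideRow-sound m with known K m j in e | rows m
    ... | nothing | _ = []
    ... | just true | inj₁ same = trans (same j) (known-sound s h m j e) ∷ []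
    ... | just true | inj₂ (_ , e′) = e′ ∷ []
    ... | just false | inj₁ same = All-concatMap _ vertices (recall-sound s h m same)
    ... | just false | inj₂ (e′ , _) with () ← trans (sym e′) (known-sound s h m j e)

  isThin-sound : ∀ {H} → 𝓢 H → ∀ {K} → H ⊨* K → ∀ i j → isThin K i j ≡ true
    → H i j ≡ true × (∀ {k} → k ∈ vertices → k ≢ j → H i k ≡ false)
  isThin-sound {H} s {K} h i j e = is-sound s h i j true (proj₁ (∧-true e)) , off
    where
    off : ∀ {k} → k ∈ vertices → k ≢ j → H i k ≡ false
    off {k} k∈ k≢j with k ≡ᵇ j in k≡j | all-true (λ k → if k ≡ᵇ j then true else is false (known K i k)) vertices
                                         (proj₂ (∧-true {is true (known K i j)} e)) k∈
    ... | true | _ = ⊥-elim (k≢j (≡ᵇ-true k≡j))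
    ... | false | e′ = is-sound s h i k false e′

  -- The quantifier over the whole family is essential: `flip` and `slide` replace the digraph in
  -- the middle of a refutation.
  Nogood : List Literal → Set
  Nogood N = ∀ {H} → 𝓢 H → ¬ (H ⊨* N)

  nth-nogood : ∀ {Ns} → All Nogood Ns → ∀ n → Nogood (nth Ns n)
  nth-nogood [] n s (h ∷ []) with () ← trans (sym h) (irreflexive s 0)
  nth-nogood (N ∷ Ns) zero = N
  nth-nogood (N ∷ Ns) (suc n) = nth-nogood Ns n

  some-arc : ∀ {H : Digraph} i {j} js → j ∈ js → H i j ≡ true → Any (H ⊨_) (arcsFrom i js)
  some-arc i (j ∷ js) (here refl) e = here e
  some-arc i (_ ∷ js) (there j∈) e = there (some-arc i js j∈ e)

  some-negated : ∀ {H} τ N → ¬ ((λ i j → H (τ i) (τ j)) ⊨* N)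
    → Any (H ⊨_) (map (λ l → negate (rename τ l)) N)
  some-negated τ [] ¬h = ⊥-elim (¬h [])
  some-negated {H} τ (lit i j v ∷ N) ¬h with H (τ i) (τ j) in e | v
  ... | true | false = here e
  ... | false | true = here e
  ... | true | true = there (some-negated τ N (λ h → ¬h (e ∷ h)))
  ... | false | false = there (some-negated τ N (λ h → ¬h (e ∷ h)))

  ∈-others : ∀ {k} j → k ∈ vertices → k ≢ j → k ∈ others j
  ∈-others {k} j k∈ k≢j = go vertices k∈
    where
    go : ∀ xs → k ∈ xs → k ∈ concatMap (λ k → if k ≡ᵇ j then [] else k ∷ []) xs
    go (x ∷ xs) (here refl) with k ≡ᵇ j in e
    ... | true = ⊥-elim (k≢j (≡ᵇ-true e))
    ... | false = here refl
    go (x ∷ xs) (there k∈) = Anyₚ.++⁺ʳ (if x ≡ᵇ j then [] else x ∷ []) (go xs k∈)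

  mutual
    check-sound : ∀ {Ns} → All Nogood Ns → ∀ K r → check Ns K r ≡ true → Nogood K
    check-sound ns K (cut i j r₁ r₂) e {H} s h with H i j in eq
    ... | true = check-sound ns (lit i j true ∷ K) r₁ (proj₁ (∧-true e)) s (eq ∷ h)
    ... | false = check-sound ns (lit i j false ∷ K) r₂ (proj₂ (∧-true {check _ (lit i j true ∷ K) r₁} e)) s (eq ∷ h)
    check-sound ns K (row i rs) e s h =
      let j , j∈ , eq = serial s i in
      checks-sound ns K _ rs e s h (live-sound s h _ (some-arc i vertices j∈ eq))
    check-sound {Ns} ns K (nogood n c rs) e s h =
      checks-sound ns K _ rs (proj₂ (∧-true {isOnto (λ i → digit i c)} e)) s h
        (live-sound s h _ (some-negated (λ i → digit i c) (nth Ns n)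
          (nth-nogood ns n (relabel _ (isOnto-sound _ (proj₁ (∧-true e))) s))))
    check-sound ns K (flip j r) e s h =
      let H′ , s′ , f = flipG j s in check-sound ns (afterFlip K j) r e s′ (afterFlip-sound s h j f)
    check-sound ns K (slide i j rs) e s h =
      let ij , off = isThin-sound s h i j (proj₁ (∧-true e))
          H′ , s′ , f@(_ , (k , k∈ , k≢j , ik) , ij′) = slideG i j s ij off
          h′ = ij′ ∷ afterSlide-sound s h i j f
      in checks-sound ns _ _ rs (proj₂ (∧-true {isThin K i j} e)) s′ h′
           (live-sound s′ h′ _ (some-arc i (others j) (∈-others j k∈ k≢j) ik))

    checks-sound : ∀ {Ns} → All Nogood Ns → ∀ K ls rs → checks Ns K ls rs ≡ true
      → ∀ {H} → 𝓢 H → H ⊨* K → ¬ Any (H ⊨_) ls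
    checks-sound {Ns} ns K (l ∷ ls) (r ∷ rs) e s h (here px) =
      check-sound ns (l ∷ K) r (proj₁ (∧-true e)) s (px ∷ h)
    checks-sound {Ns} ns K (l ∷ ls) (r ∷ rs) e s h (there a) =
      checks-sound ns K ls rs (proj₂ (∧-true {check Ns (l ∷ K) r} e)) s h a

-- The certificate

Certificate : Set
Certificate = List (List Literal × Refutation)

valid : List (List Literal) → Certificate → Refutation → Bool
valid Ns [] r = check Ns [] r
valid Ns ((K , r) ∷ cs) r₀ = check Ns K r ∧ valid (Ns ++ K ∷ []) cs r₀

valid-sound : ∀ {𝓢} → Game 𝓢 → ∀ cs r → valid [] cs r ≡ true → ∀ {H} → ¬ 𝓢 H
valid-sound {𝓢} game = go []
  where
  open Soundness game
  go : ∀ {Ns} → All Nogood Ns → ∀ cs r → valid Ns cs r ≡ true → ∀ {H} → ¬ 𝓢 H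
  go ns [] r e s = check-sound ns [] r e s []
  go {Ns} ns ((K , r) ∷ cs) r₀ e =
    go (Allₚ.++⁺ ns (check-sound ns K r (proj₁ (∧-true e)) ∷ [])) cs r₀ (proj₂ (∧-true {check Ns K r} e))

-- Patterns of arcs that never occur, each refuted from the earlier ones; found by computer search.
certificate : Certificate
certificate =
  (literals 264161151145234131224121 , cut 1 4 (flip 1 (sink 4)) (sink 1)) ∷
  (literals 163246245141235131226225121 , cut 1 5 (cut 1 6 (flip 1 (sole 5 (sink 6))) (flip 1 (sole 5 (use 0 436215
    (use 0 346215 (use 0 426315 (sole 6 (clash 0 416325)))))))) (cut 1 6 (flip 1 (use 0 425316 (use 0 415326 (use 0
    345216 (sole 6 (use 0 435216 (sink 5))))))) (sink 1))) ∷
  (literals 236235234131226225224121216214 , cut 1 5 (flip 1 (use 1 643215 (use 1 463215 (use 1 642315 (use 1 462315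
    (use 1 643125 (use 1 463125 (row 6 (sole 4 (use 1 623415 (clash 1 364215)) ∷ sole 5 (sole 4 (use 1 246135 (clash 1
    346215))) ∷ []))))))))) (sink 1)) ∷
  (literals 265161245141226225224223115 , cut 2 1 (cut 1 3 (flip 1 (use 1 645123 (sink 5))) (flip 1 (clash 2 634215)))
    (sink 2)) ∷
  (literals 256254253246243141125216212 , cut 5 1 (cut 1 3 (flip 1 (use 2 624513 (clash 3 564213))) (sink 1)) (sink
    5)) ∷
  (literals 165162151145142223121214213 , cut 1 6 (flip 1 (use 3 542316 (clash 4 412356))) (sink 1)) ∷
  (literals 164163162152142141131121116 , cut 1 5 (flip 1 (sole 6 (use 5 312465 (clash 3 241365)))) (flip 1 (clash 4
    412536))) ∷
  (literals 143236235131225224121216215 , cut 1 4 (flip 1 (use 3 352614 (clash 4 513624))) (sink 1)) ∷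
  (literals 164152243142141235234131121216 , cut 1 5 (flip 1 (use 3 342615 (sole 5 (use 4 413625 (use 4 314625 (use 4
    412635 (use 3 342156 (clash 4 364521)))))))) (sink 1)) ∷
  (literals 262161254253151136125121214 , cut 1 3 (flip 1 (use 3 625413 (clash 4 215463))) (sink 1)) ∷
  (literals 165154153152151242141236131126 , cut 1 2 (cut 1 6 (cut 4 6 (clash 6 534216) (flip 1 (sole 6 (use 6 534612
    (clash 9 615342))))) (cut 3 2 (clash 3 563412) (flip 1 (use 3 453612 (clash 4 513642))))) (sole 1 (use 6 534216
    (use 9 342651 (use 7 256431 (use 4 312546 (use 4 534621 (clash 4 243651)))))))) ∷
  (literals 156252151145135226224223121216 , cut 1 4 (cut 1 3 (flip 1 (row 3 (sole 4 (use 3 261534 (use 3 523146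
    (clash 9 432156))) ∷ use 3 261543 (use 9 432156 (use 3 524136 (clash 3 523146))) ∷ []))) (flip 1 (use 3 532614
    (clash 4 312654)))) (cut 1 3 (flip 1 (use 3 542613 (clash 4 412653))) (sink 1))) ∷
  (literals 256151246242141135134131212 , cut 1 6 (flip 1 (use 4 314256 (clash 3 534216))) (sink 1)) ∷
  (literals 265264263262143235131214212 , cut 1 5 (cut 6 1 (flip 1 (use 3 643215 (clash 4 416235))) (sink 6)) (sole 1
    (sink 6))) ∷
  (literals 164152243135226124123121216213 , cut 1 5 (cut 4 1 (cut 4 5 (clash 3 423615) (flip 1 (use 3 462315 (clash
    13 132465)))) (clash 3 321645)) (use 13 156234 (sole 1 (use 9 613524 (use 13 165234 (use 7 365124 (use 7 162435
    (use 7 132465 (clash 13 153624))))))))) ∷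
  (literals 165164262151143236131226121116 , cut 3 2 (cut 3 5 (nogood 3 362451 (nogood 12 652341 (use 8 136254 (use 3
    563421 (clash 11 613254)) ∷ use 8 136254 (use 11 346521 (clash 11 346251)) ∷ []) ∷ use 3 563421 (use 11 615324
    (use 12 625341 (use 8 136254 (clash 11 346521)))) ∷ [])) (cut 1 4 (flip 1 (use 3 351264 (clash 13 625134))) (flip
    1 (use 13 143256 (use 14 541236 (sole 6 (use 7 254136 (use 7 135624 (sole 4 (clash 13 142536)))))))))) (cut 1 4
    (flip 1 (use 3 321564 (clash 13 653124))) (flip 1 (use 13 142356 (sole 6 (use 7 524136 (use 13 145326 (row 4 (use
    7 534216 (use 14 346521 (clash 13 142536)) ∷ use 7 524316 (use 13 143526 (clash 14 246531)) ∷ use 7 324516 (use 14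
    341256 (clash 13 145236)) ∷ []))))))))) ∷
  (literals 256252151246141135226121213 , cut 1 6 (flip 1 (sole 6 (use 7 423156 (use 13 134526 (use 13 132546 (row 3
    (use 7 543216 (use 13 132456 (clash 14 536421)) ∷ use 7 523416 (use 14 536241 (clash 13 134256)) ∷ use 7 423516
    (use 13 135426 (clash 14 236451)) ∷ []))))))) (sink 1)) ∷
  (literals 246245243142141126225223121216 , cut 1 3 (cut 1 5 (flip 1 (use 13 564123 (use 13 364125 (use 6 412536 (use
    13 314526 (clash 13 514326)))))) (flip 1 (use 3 452613 (clash 4 514623)))) (cut 1 5 (flip 1 (use 3 432615 (clash 4
    314625))) (sink 1))) ∷
  (literals 165254253151132226121216214 , cut 1 3 (flip 1 (use 4 615423 (clash 3 562413))) (sink 1)) ∷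
  (literals 163246245242141235234132131212 , cut 1 6 (cut 1 5 (flip 1 (row 5 (row 6 (use 18 463152 (use 6 413652
    (clash 15 461532)) ∷ use 16 264315 (use 18 354162 (use 6 416352 (clash 15 461532))) ∷ []) ∷ sole 6 (use 16 254316
    (use 18 354162 (use 6 413562 (clash 15 461532)))) ∷ []))) (flip 1 (use 3 453216 (clash 4 514236)))) (use 17 264531
    (clash 13 456321))) ∷
  (literals 262151242141232131125216112 , cut 4 5 (cut 4 3 (slide 1 2 (nogood 19 453126 (use 3 524631 (use 3 423651
    (clash 19 435126)) ∷ use 3 423651 (clash 19 435126) ∷ []) ∷ [])) (cut 3 5 (slide 1 2 (use 19 345126 (clash 3
    423651) ∷ [])) (use 16 245631 (use 16 253641 (use 16 234651 (sole 6 (use 16 263541 (clash 16 253461)))))))) (cut 5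
    3 (slide 1 2 (nogood 19 534126 (use 3 523641 (use 19 543126 (clash 3 524631)) ∷ use 19 543126 (clash 3 524631) ∷
    []) ∷ [])) (cut 4 3 (use 16 254631 (use 16 235641 (use 16 243651 (sole 6 (use 16 235461 (clash 16 265341))))))
    (slide 1 2 (use 19 534126 (clash 3 523641) ∷ []))))) ∷
  (literals 264246245241225124123215113 , cut 5 1 (cut 1 4 (sole 4 (use 3 251643 (use 4 542613 (use 4 541623 (use 4
    564123 (clash 3 251436)))))) (cut 5 3 (sole 4 (sole 3 (use 13 465123 (use 18 432516 (use 13 461253 (use 13 465213
    (use 13 325146 (clash 18 241653)))))))) (cut 2 1 (cut 1 6 (cut 2 6 (sole 4 (use 3 251643 (sole 3 (sole 6 (clash 3
    251436))))) (cut 5 4 (sole 4 (use 3 251643 (use 18 541623 (sole 3 (clash 18 432516))))) (cut 5 6 (sole 4 (use 18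
    246513 (use 18 435216 (clash 19 421356)))) (cut 5 2 (use 3 251643 (clash 13 465213)) (flip 1 (nogood 3 541263 (use
    13 625143 (use 3 541236 (use 20 465123 (use 8 342516 (use 13 653214 (use 19 541326 (clash 20 645123)))))) ∷ nogood
    3 541236 (nogood 20 465123 (use 19 516324 (use 3 352164 (clash 13 615324)) ∷ use 8 342516 (use 13 653214 (use 19
    541326 (clash 20 645123))) ∷ []) ∷ nogood 3 352164 (use 13 615324 (use 13 315624 (clash 19 516324)) ∷ use 19 516324
    (use 3 652134 (clash 13 315624)) ∷ []) ∷ []) ∷ []))))))) (sole 4 (use 13 162453 (clash 3 452613)))) (sole 4 (use 3
    251643 (sole 3 (use 7 516243 (use 13 465123 (sole 6 (use 3 251436 (use 7 425136 (clash 13 461253)))))))))))) (sole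
    4 (use 3 251643 (sole 3 (use 4 541623 (nogood 4 431526 (use 13 465213 (use 4 135246 (use 3 462153 (clash 18
    541623))) ∷ use 4 542613 (use 13 621453 (clash 3 251436)) ∷ []))))))) ∷
  (literals 164253142141136134131123116112 , cut 5 1 (cut 5 2 (use 19 541236 (clash 20 645132)) (flip 1 (row 2 (use 19
    531246 (nogood 18 513462 (use 19 534126 (use 19 435162 (use 20 215436 (sink 6))) ∷ use 19 435162 (use 19 534126
    (use 6 615324 (clash 18 315462))) ∷ [])) ∷ use 6 351426 (clash 18 314526) ∷ [])))) (nogood 6 351462 (nogood 15
    316452 (use 3 623154 (use 3 523164 (clash 13 543126)) ∷ nogood 13 543126 (use 6 365142 (use 3 431652 (use 19 415236
    (clash 20 654132))) ∷ use 6 365142 (use 3 623154 (clash 3 523164)) ∷ []) ∷ []) ∷ use 3 431652 (use 6 356142 (use 3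
    623154 (clash 19 635412))) ∷ []))) ∷
  (literals 245243142141132226225216213 , cut 1 5 (cut 2 1 (flip 1 (use 3 432615 (use 18 423615 (clash 21 631542))))
    (sink 2)) (sole 1 (sink 2))) ∷
  (literals 245143141236235232124216215 , cut 3 1 (cut 1 2 (flip 1 (use 3 453612 (clash 23 563412))) (sink 1)) (sink
    3)) ∷
  (literals 142236135234232131226225121215 , cut 1 4 (cut 1 6 (flip 1 (use 23 351246 (use 23 351264 (use 18 362145
    (use 6 213645 (clash 15 261435)))))) (clash 7 564231)) (sole 1 (use 17 562431 (use 4 423651 (use 19 462351 (use 18
    425631 (nogood 4 452631 (nogood 24 534261 (use 4 364152 (clash 4 315246) ∷ use 4 364152 (nogood 18 213456 (use 24
    356412 (clash 17 536142) ∷ use 24 536412 (use 4 365214 (clash 4 315426)) ∷ [])) ∷ []) ∷ row 6 (use 8 564321 (use 4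
    346152 (use 18 543162 (clash 17 534162))) ∷ use 24 534261 (use 4 346152 (use 4 365214 (use 4 325641 (clash 4
    156234)))) ∷ use 4 325641 (nogood 4 263415 (use 24 534261 (use 4 346152 (clash 4 156234)) ∷ use 8 564321 (use 4
    346152 (clash 17 534162)) ∷ [])) ∷ []) ∷ [])))))))) ∷
  (literals 161141136134132226225121113 , cut 1 5 (flip 1 (use 3 261435 (clash 24 621345))) (flip 1 (clash 23
    452613))) ∷
  (literals 165254245141236232131225121115 , cut 1 6 (cut 3 5 (cut 4 2 (sole 5 (use 16 216435 (use 25 264135 (nogood 24
    346512 (use 25 536241 (use 25 462135 (use 15 341562 (use 15 635241 (clash 22 156432)))) ∷ use 15 645231 (clash 26
    453621) ∷ []))))) (flip 1 (nogood 25 234516 (sole 5 (nogood 25 254136 (use 16 316245 (use 16 316425 (nogood 25 342615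
    (use 3 462153 (clash 25 423615) ∷ use 24 241635 (clash 25 423615) ∷ []))) ∷ use 16 316245 (use 20 614235 (use 25
    452136 (use 25 263145 (sole 6 (clash 20 534126))))) ∷ [])) ∷ use 24 321546 (clash 3 321456) ∷ [])))) (flip 1 (use
    3 321456 (clash 24 321546)))) (cut 3 5 (use 23 463215 (use 13 126345 (use 23 623415 (use 23 423615 (use 24 463125
    (nogood 23 416352 (use 24 632451 (use 13 624135 (clash 25 365421)) ∷ use 13 624135 (clash 25 342615) ∷ [])))))))
    (flip 1 (clash 23 463215)))) ∷
  (literals 161151146145141226225124121 , cut 1 3 (cut 2 3 (cut 5 2 (cut 6 2 (cut 6 3 (cut 4 3 (clash 24 462153) (cut
    5 3 (sole 3 (clash 26 625413)) (flip 1 (use 24 452163 (use 26 516432 (sole 3 (use 24 245163 (clash 25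
    543261)))))))) (cut 6 5 (cut 5 3 (use 24 265143 (clash 26 542613)) (flip 1 (clash 10 461523))) (flip 1 (nogood 24
    256143 (use 3 652413 (use 16 324651 (use 26 615432 (clash 27 432651))) ∷ use 26 615432 (use 16 324651 (use 3
    645132 (clash 3 645213))) ∷ []))))) (nogood 22 163254 (use 23 462513 (use 23 452613 (use 23 235461 (clash 25
    423561))) ∷ use 23 462513 (use 23 546213 (use 24 524631 (use 25 324561 (use 23 245613 (clash 27 462153))))) ∷
    []))) (nogood 24 625143 (use 18 452361 (use 23 462513 (use 22 153264 (use 24 524631 (clash 27 462153)))) ∷ use 18
    452361 (use 23 452613 (use 24 624531 (use 27 236541 (use 18 512463 (clash 27 452163))))) ∷ []))) (cut 5 2 (cut 6 2
    (nogood 25 643251 (use 25 345261 (nogood 16 415263 (use 26 615432 (use 16 324651 (use 3 645132 (clash 3 645213))) ∷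
    use 16 324651 (use 26 615432 (clash 27 432651)) ∷ [])) ∷ nogood 3 645132 (use 16 324651 (use 3 645213 (clash 16
    324561)) ∷ use 16 324561 (use 26 516432 (use 27 432561 (clash 25 543261))) ∷ []) ∷ [])) (flip 1 (nogood 23 462513
    (use 22 163254 (use 23 452613 (use 23 235461 (clash 25 423561))) ∷ use 22 163254 (use 23 546213 (use 24 524631
    (use 25 324561 (use 23 245613 (clash 27 462153))))) ∷ [])))) (flip 1 (nogood 18 452361 (use 18 216453 (use 23
    452613 (use 24 624531 (use 27 236541 (use 18 512463 (clash 27 452163))))) ∷ use 18 216453 (use 23 462513 (use 22
    153264 (use 24 524631 (clash 27 462153)))) ∷ []))))) (sink 1)) ∷
  (literals 265161154153246242141131115 , cut 1 2 (flip 1 (use 3 461352 (clash 24 641532))) (flip 1 (clash 23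
    324615))) ∷
  (literals 165164152151142141235232131126 , cut 1 6 (cut 3 6 (clash 29 351246) (cut 1 2 (flip 1 (sole 6 (use 24
    531642 (clash 29 356142)))) (flip 1 (clash 23 423516)))) (clash 3 564312)) ∷
  (literals 152142132216215214213112 , cut 6 2 (sink 2) (cut 6 3 (sole 2 (use 3 563412 (use 3 463512 (use 13 165342
    (use 3 534126 (clash 13 164352)))))) (cut 6 5 (use 13 163542 (sole 2 (use 3 564312 (use 3 563412 (use 3 453126
    (clash 13 164532)))))) (cut 6 4 (sole 2 (use 3 564312 (use 3 463512 (use 13 165432 (use 3 543126 (clash 13
    163452)))))) (slide 1 2 (sole 2 (sole 6 (cut 3 6 (use 18 524136 (use 4 423156 (nogood 13 213456 (nogood 18 543612
    (use 24 435216 (use 3 461352 (use 21 614253 (clash 25 613452))) ∷ nogood 30 135462 (use 3 461352 (use 29 436521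
    (clash 25 613542)) ∷ use 28 543612 (use 28 431652 (use 23 415326 (clash 3 461352))) ∷ []) ∷ []) ∷ use 3 534261
    (use 7 431256 (use 4 451632 (use 28 543612 (clash 28 531642)))) ∷ [])))) (cut 5 6 (cut 1 5 (use 4 425136 (use 4
    325146 (nogood 29 412536 (use 3 461532 (use 3 361542 (clash 25 615432)) ∷ use 13 364152 (clash 28 531642) ∷ []))))
    (nogood 4 325146 (cut 3 5 (nogood 28 543612 (use 28 431652 (use 4 524136 (use 3 361542 (clash 25 651342))) ∷ use 7
    546132 (use 28 415632 (clash 28 431652)) ∷ [])) (use 4 531642 (use 7 456132 (use 4 324156 (use 21 654213 (clash 25
    651432))))) ∷ use 4 531642 (use 7 456132 (use 4 324156 (use 25 651432 (clash 3 361542)))) ∷ []))) (use 20 315462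
    (cut 4 1 (nogood 18 453612 (use 4 431652 (use 7 456132 (use 25 641352 (clash 28 531642))) ∷ nogood 7 546132 (use 28
    531642 (use 7 456132 (clash 28 543612)) ∷ use 28 531642 (use 4 135642 (use 3 361452 (clash 25 641532))) ∷ []) ∷
    [])) (use 7 351246 (use 4 324156 (use 3 561432 (use 3 361452 (clash 25 614532)))))))))) ∷ sole 2 (sole 6 (cut 4 6
    (use 18 523146 (use 24 534216 (nogood 24 345216 (use 28 534612 (use 3 413526 (use 4 531642 (use 28 431652 (use 23
    163452 (clash 3 514326))))) ∷ nogood 4 423156 (nogood 18 534612 (use 4 453612 (use 3 561432 (clash 25 614352)) ∷ use
    3 361452 (use 3 543261 (clash 25 614532)) ∷ []) ∷ use 3 543261 (use 4 351642 (use 28 534612 (clash 28 541632))) ∷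
    []) ∷ [])))) (cut 5 6 (cut 5 1 (cut 4 5 (nogood 28 534612 (use 28 431652 (use 4 523146 (use 23 564132 (clash 25
    651432))) ∷ use 28 315642 (use 7 536142 (clash 28 431652)) ∷ [])) (use 4 541632 (use 7 356142 (use 23 513426 (use
    24 451362 (clash 25 651342)))))) (use 4 425136 (use 4 325146 (nogood 18 524136 (use 3 361542 (use 3 461532 (clash
    25 615342)) ∷ use 4 341652 (use 25 536412 (use 28 541632 (use 23 164532 (clash 3 513426)))) ∷ []))))) (use 20
    514362 (cut 3 1 (nogood 18 354612 (use 3 561342 (use 25 536412 (use 25 631452 (clash 28 541632))) ∷ nogood 28 541632
    (use 3 561342 (use 25 356412 (use 13 561432 (clash 25 631542))) ∷ use 7 536142 (use 7 356142 (clash 28 534612)) ∷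
    []) ∷ [])) (use 4 523146 (use 4 423156 (use 3 561342 (use 13 563412 (clash 25 613542)))))))))) ∷ sole 2 (sole 6
    (cut 5 6 (use 4 425136 (use 23 415326 (nogood 24 453216 (use 28 435612 (use 3 514326 (use 4 341652 (use 28 541632
    (use 3 461532 (clash 3 513426))))) ∷ nogood 24 354216 (use 28 435612 (use 4 431652 (use 28 531642 (use 29 412536
    (clash 3 361542)))) ∷ nogood 23 163542 (use 29 456321 (use 25 615432 (clash 3 461532)) ∷ use 3 461532 (use 28
    435612 (clash 25 615342)) ∷ []) ∷ []) ∷ [])))) (cut 4 6 (cut 4 1 (cut 1 3 (nogood 23 361452 (use 4 523146 (use 3
    561432 (use 25 641352 (clash 28 531642))) ∷ use 28 531642 (use 4 423156 (use 3 561432 (use 24 341562 (clash 25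
    641532)))) ∷ [])) (use 7 436152 (use 7 346152 (clash 28 435612)))) (use 4 524136 (use 4 324156 (nogood 20 524316
    (use 4 453612 (use 13 361542 (clash 25 614352)) ∷ use 4 351642 (use 25 436512 (clash 28 541632)) ∷ []))))) (use 20
    315462 (cut 4 5 (use 3 461352 (use 4 523146 (use 7 346152 (use 25 631542 (clash 28 541632))))) (nogood 18 345612
    (use 24 453216 (use 23 513426 (use 3 561342 (clash 25 613452))) ∷ use 4 423156 (nogood 28 541632 (use 7 436152 (use
    13 463152 (clash 25 631452)) ∷ use 7 436152 (use 7 346152 (clash 28 435612)) ∷ [])) ∷ []))))))) ∷ sink 6 ∷
    [])))))) ∷
  (literals 161146136234232126115114112 , cut 3 1 (flip 1 (row 4 (sole 2 (use 31 563124 (use 29 462135 (use 29 432165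
    (sink 5)))) ∷ row 2 (use 31 563142 (use 29 164235 (sole 5 (clash 29 234165))) ∷ use 29 164235 (sole 5 (clash 29
    134265)) ∷ []) ∷ []))) (use 20 543216 (row 5 (use 29 312456 (use 25 412635 (use 21 513624 (use 29 453216 (use 29
    413256 (use 27 231645 (clash 30 142563)))))) ∷ use 29 413256 (nogood 29 314256 (nogood 30 142563 (use 29 312456 (use
    20 264135 (clash 27 431625)) ∷ use 27 231645 (use 20 462135 (clash 29 312456)) ∷ []) ∷ nogood 29 453216 (use 30
    124563 (use 27 431625 (clash 29 312456)) ∷ use 30 142563 (use 27 431625 (clash 29 312456)) ∷ []) ∷ [])) ∷ use 29
    314256 (use 25 214635 (use 29 413256 (use 21 153642 (use 21 513642 (use 27 431625 (clash 30 124563)))))) ∷ []))))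
    ∷
  (literals 163162161154152151146135114113 , cut 5 6 (clash 22 426531) (cut 2 1 (cut 2 4 (use 20 325164 (use 32 435126
    (use 20 246153 (clash 30 352641)))) (flip 1 (nogood 25 652413 (use 25 536124 (sole 4 (use 20 316254 (use 29 251364
    (sole 3 (clash 20 452163))))) ∷ sole 4 (use 29 564123 (sole 3 (use 31 265134 (clash 27 536124)))) ∷ [])))) (nogood
    29 152463 (use 20 325164 (sole 2 (use 29 652143 (use 29 163524 (use 25 645123 (clash 24 461253))))) ∷ sole 2
    (clash 29 562134) ∷ [])))) ∷
  (literals 161154146242141132224121115113 , cut 2 6 (cut 2 5 (use 33 425361 (nogood 3 432561 (nogood 20 316245 (use 25
    642513 (use 25 621354 (clash 32 546123)) ∷ use 32 154623 (use 25 621354 (use 25 234165 (clash 32 546123))) ∷ []) ∷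
    nogood 25 624315 (use 25 254163 (use 25 126354 (use 20 465123 (clash 20 362145))) ∷ use 32 154623 (use 25 452163
    (clash 25 621354)) ∷ []) ∷ []))) (cut 4 3 (nogood 3 452361 (nogood 20 564123 (use 25 624315 (use 25 641532 (clash 32
    326145)) ∷ use 32 134625 (use 25 641532 (use 25 452163 (clash 32 326145))) ∷ []) ∷ nogood 25 642513 (use 25 432165
    (use 25 641532 (use 25 426315 (clash 20 564123))) ∷ use 32 134625 (use 25 641532 (clash 25 432165)) ∷ []) ∷ []))
    (flip 1 (row 5 (sole 3 (use 31 154263 (clash 31 642135)) ∷ nogood 31 642153 (sole 3 (clash 31 154263) ∷ use 31
    154263 (clash 31 143265) ∷ []) ∷ []))))) (flip 1 (row 5 (use 19 642153 (clash 29 421365) ∷ use 15 456123 (sole 3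
    (use 19 462153 (use 18 452613 (use 15 251346 (clash 18 452136))))) ∷ nogood 19 462153 (use 29 421365 (nogood 18
    234615 (use 15 231546 (use 18 234156 (clash 32 156243)) ∷ use 19 261345 (clash 32 156243) ∷ [])) ∷ row 3 (use 29
    241563 (clash 8 364215) ∷ use 8 364215 (use 18 234615 (use 15 251346 (clash 18 452136))) ∷ use 15 251346 (clash 18
    254136) ∷ []) ∷ []) ∷ [])))) ∷
  (literals 161151146145141134126125112 , cut 1 3 (nogood 29 426531 (nogood 32 326154 (use 29 425631 (use 29 645123
    (clash 29 546123)) ∷ use 29 425631 (use 33 463251 (use 25 524163 (use 25 645312 (clash 32 125643)))) ∷ []) ∷ nogood
    32 326154 (nogood 3 634251 (use 3 534261 (use 25 524163 (use 25 546312 (clash 29 432516))) ∷ use 33 463251 (use 25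
    524163 (use 32 125643 (clash 25 645312))) ∷ []) ∷ nogood 33 453261 (use 3 634251 (use 25 624153 (use 25 645312
    (clash 32 126543))) ∷ use 3 634251 (clash 3 534261) ∷ []) ∷ []) ∷ [])) (flip 1 (use 29 641532 (sole 2 (use 23
    635412 (use 23 536412 (use 32 316254 (sole 3 (clash 31 265413))))))))) ∷
  (literals 161151143136124121214 , cut 1 3 (cut 5 3 (cut 2 5 (use 29 521463 (use 13 162543 (use 13 162453 (use 32
    615342 (use 13 312456 (clash 31 354216)))))) (cut 2 3 (clash 31 654231) (cut 6 5 (cut 2 6 (use 29 561423 (use 27
    264153 (use 27 514236 (use 35 514263 (use 29 453216 (use 29 521463 (use 29 253416 (clash 27 432561)))))))) (cut 5
    4 (flip 1 (use 23 452613 (use 29 263514 (sole 4 (clash 31 365214))))) (use 27 432561 (use 34 165243 (use 34 524613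
    (clash 35 514263)))))) (flip 1 (use 21 451362 (use 31 564231 (use 31 465231 (nogood 24 256143 (use 29 651243 (use
    29 251643 (use 31 364215 (use 24 625431 (clash 25 263451)))) ∷ use 31 365214 (nogood 28 625341 (use 25 362541
    (clash 31 364215) ∷ use 31 364215 (use 25 623541 (use 24 462153 (clash 28 642351))) ∷ [])) ∷ []))))))))) (cut 2 3
    (cut 6 4 (cut 5 4 (flip 1 (use 31 265431 (sole 4 (clash 31 365214)))) (use 29 261453 (use 35 412563 (use 19 235641
    (clash 24 426531))))) (cut 5 6 (nogood 27 564123 (use 23 435261 (use 31 354216 (use 32 362415 (use 31 154263 (use
    21 654321 (clash 25 652413))))) ∷ nogood 31 354216 (use 32 614532 (use 35 412653 (use 23 462513 (clash 32 615342)))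
    ∷ use 27 214536 (use 32 362415 (use 23 462513 (clash 23 514236))) ∷ []) ∷ [])) (cut 2 5 (flip 1 (use 24 465123
    (use 27 241563 (use 31 465231 (nogood 27 245163 (use 31 365214 (nogood 35 516423 (use 24 526143 (clash 34 562134) ∷
    use 34 146253 (clash 24 256143) ∷ [])) ∷ use 24 625143 (use 27 246153 (use 34 146253 (clash 35 516423))) ∷
    [])))))) (cut 5 4 (use 29 251463 (use 23 462513 (use 25 342561 (nogood 32 614325 (use 21 654321 (clash 23 564213) ∷
    use 31 354216 (use 21 654321 (clash 23 514236)) ∷ []))))) (flip 1 (use 3 645213 (use 7 642153 (use 7 542163 (clash
    3 645132))))))))) (flip 1 (clash 31 465231)))) (sink 1)) ∷
  (literals 164163242141131123116112 , flip 1 (row 2 (use 36 531246 (row 5 (use 36 132546 (use 31 543126 (clash 36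
    146532)) ∷ use 36 342516 (use 31 543126 (clash 36 346512)) ∷ use 36 432516 (use 31 543126 (clash 36 436512)) ∷
    [])) ∷ sole 6 (use 31 543162 (use 36 432516 (use 36 342516 (use 36 132546 (sink 5))))) ∷ []))) ∷
  (literals 161253151146136125113112 , cut 1 4 (flip 1 (row 2 (sole 3 (use 36 261453 (sole 4 (clash 36 521463))) ∷ use
    36 461253 (sole 4 (use 35 321654 (sole 3 (clash 27 643152)))) ∷ use 36 641253 (row 4 (use 35 431562 (use 36 251463
    (sole 3 (clash 27 523164))) ∷ use 35 316254 (sole 3 (clash 35 315462)) ∷ [])) ∷ []))) (cut 6 2 (cut 5 4 (cut 5 6
    (use 25 534162 (use 29 456132 (use 29 423516 (use 21 124653 (clash 29 534621))))) (flip 1 (row 3 (use 29 561342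
    (use 23 641532 (sole 2 (use 23 563124 (use 23 613524 (clash 37 152364))))) ∷ nogood 23 641523 (row 4 (use 36 162453
    (use 29 561342 (use 23 613524 (clash 37 152364))) ∷ use 36 652413 (use 29 561342 (use 23 563124 (clash 37
    152364))) ∷ []) ∷ use 29 561342 (use 19 546123 (nogood 34 526341 (use 37 534216 (sole 4 (use 19 451263 (clash 19
    654132))) ∷ use 36 652413 (use 19 541263 (clash 37 512436)) ∷ []))) ∷ []) ∷ [])))) (flip 1 (nogood 3 541632 (use 24
    541362 (use 3 645123 (use 25 645312 (use 20 265143 (use 20 256143 (use 20 216543 (use 25 425163 (clash 3
    561342))))))) ∷ nogood 3 641523 (nogood 36 652413 (nogood 36 613452 (use 25 561234 (use 24 653214 (use 24 613254
    (clash 37 563214))) ∷ nogood 37 163254 (nogood 25 561234 (nogood 37 314256 (use 29 546123 (use 24 513264 (clash 37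
    354216)) ∷ use 24 513264 (clash 37 152364) ∷ []) ∷ use 24 653214 (use 24 513264 (clash 37 152364)) ∷ []) ∷ nogood
    25 561234 (use 37 354216 (use 24 513264 (clash 37 512364)) ∷ use 24 613254 (use 24 513264 (clash 37 512364)) ∷ [])
    ∷ []) ∷ []) ∷ nogood 36 562413 (use 25 561234 (use 24 653214 (use 24 613254 (clash 37 563214))) ∷ sole 4 (use 24
    652314 (use 25 561234 (use 36 162453 (clash 24 653214)))) ∷ []) ∷ []) ∷ nogood 29 561342 (use 25 425163 (nogood 36
    652413 (nogood 25 165234 (use 20 256143 (use 3 561342 (clash 20 216543)) ∷ use 25 465213 (use 24 652314 (clash 36
    562413)) ∷ []) ∷ use 20 265143 (use 20 256143 (use 3 561342 (clash 20 216543))) ∷ [])) ∷ use 25 425163 (use 25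
    645312 (use 25 561234 (use 29 546123 (clash 37 354216)))) ∷ []) ∷ []) ∷ [])))) (flip 1 (row 3 (sole 2 (use 31
    465123 (use 36 563412 (use 36 653412 (sole 4 (clash 36 163452))))) ∷ use 36 461352 (row 4 (use 36 163452 (use 31
    465132 (clash 36 162453)) ∷ use 36 563412 (use 31 465132 (clash 36 562413)) ∷ use 36 653412 (use 36 612453 (clash
    31 465132)) ∷ [])) ∷ []))))) ∷
  (literals 143132131125121116114 , cut 2 4 (cut 5 1 (cut 5 4 (nogood 38 465213 (use 25 532416 (nogood 25 362154 (nogood
    25 325614 (sole 6 (use 35 512634 (clash 38 631542)) ∷ sole 6 (clash 31 352146) ∷ []) ∷ use 38 546213 (use 38
    364512 (sole 6 (clash 31 352146))) ∷ [])) ∷ use 38 125364 (use 35 512634 (use 38 631542 (use 25 362154 (use 38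
    364512 (clash 38 546213))))) ∷ [])) (flip 1 (row 4 (nogood 38 263415 (use 38 463512 (use 24 531624 (use 35 513624
    (use 38 346512 (use 8 623514 (clash 34 125634))))) ∷ use 29 521634 (nogood 38 523641 (use 38 463512 (use 24 531624
    (use 35 513624 (use 8 623514 (clash 38 325641)))) ∷ nogood 8 623514 (use 38 346512 (use 38 264315 (use 24 531624
    (clash 29 654312))) ∷ nogood 38 463512 (use 24 531624 (use 29 625134 (clash 38 264315)) ∷ use 38 264315 (use 29
    625134 (use 29 362541 (clash 38 643152))) ∷ []) ∷ []) ∷ [])) ∷ []) ∷ row 6 (use 38 415326 (use 38 413526 (use 38
    463512 (clash 24 531426))) ∷ use 29 134256 (use 38 415326 (use 38 142536 (use 24 251436 (use 35 513624 (use 34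
    125634 (clash 38 325641)))))) ∷ use 38 153264 (use 38 413526 (use 24 321456 (clash 38 142536))) ∷ []) ∷ []))))
    (use 37 265413 (nogood 21 635421 (use 38 645123 (nogood 20 526134 (use 38 162354 (use 24 431526 (clash 25 342156)) ∷
    sole 6 (use 38 631542 (nogood 20 652134 (use 24 314526 (clash 25 132456) ∷ use 24 431526 (clash 25 342156) ∷ [])))
    ∷ [])) ∷ sole 5 (use 38 152364 (use 24 621534 (clash 25 362154))) ∷ [])))) (cut 2 6 (nogood 37 154623 (nogood 37
    256134 (nogood 38 546213 (use 24 521634 (sole 6 (use 38 162354 (use 21 645123 (use 38 456123 (use 38 451623 (clash
    25 624351)))))) ∷ nogood 24 521634 (use 24 324615 (use 25 231465 (sole 6 (use 21 645123 (clash 38 162354)))) ∷ row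
    5 (use 34 243651 (use 10 436215 (clash 38 532641)) ∷ use 38 152364 (use 24 621534 (clash 25 362154)) ∷ []) ∷ []) ∷
    []) ∷ sole 6 (nogood 24 142635 (use 38 516234 (use 38 546213 (use 38 152364 (use 21 436512 (clash 25 362154)))) ∷
    use 38 532641 (use 10 436215 (use 34 243651 (use 38 546213 (clash 38 264315)))) ∷ [])) ∷ []) ∷ row 6 (use 38
    465123 (nogood 38 532461 (use 38 346512 (use 21 435621 (use 37 625341 (use 21 645123 (use 25 342156 (clash 38
    615234))))) ∷ use 37 245613 (sole 5 (use 21 435621 (use 38 152346 (clash 24 142536)))) ∷ [])) ∷ use 38 615234 (use
    37 256134 (use 38 465123 (use 38 125346 (sole 5 (clash 37 245613))))) ∷ use 38 516234 (use 38 253461 (sole 5 (use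
    38 456123 (use 24 142635 (clash 37 245613))))) ∷ []) ∷ [])) (cut 3 6 (cut 1 5 (flip 1 (row 6 (use 36 351624 (row 4
    (use 38 564123 (use 36 413265 (use 20 542136 (use 24 631425 (use 36 621534 (clash 20 425136))))) ∷ use 38 652413
    (use 20 125436 (sole 5 (use 20 542136 (clash 38 421356)))) ∷ [])) ∷ use 36 261534 (use 36 621534 (clash 24
    621435)) ∷ use 36 521634 (row 5 (use 36 236514 (use 38 614235 (use 24 431625 (clash 38 421356))) ∷ use 36 326514
    (use 38 614235 (use 24 421635 (clash 38 654213))) ∷ [])) ∷ []))) (nogood 38 325461 (row 6 (nogood 38 162354 (use 25
    352614 (use 24 521634 (use 38 615324 (use 38 451623 (use 21 645123 (clash 21 236415))))) ∷ use 38 451623 (use 25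
    362154 (sole 5 (use 10 435261 (use 38 132546 (clash 21 645123))))) ∷ []) ∷ use 10 436215 (nogood 38 542613 (use 25
    413265 (use 34 243651 (use 38 546213 (clash 38 264315))) ∷ use 34 243651 (use 21 325461 (clash 25 413265)) ∷ []))
    ∷ []) ∷ nogood 10 436215 (nogood 21 645123 (use 21 236415 (use 38 643152 (use 25 523614 (use 25 532416 (use 25
    362154 (use 8 423516 (clash 35 513426)))))) ∷ nogood 21 236415 (use 25 342156 (use 38 615324 (use 25 523614 (use 24
    521634 (clash 38 162354)))) ∷ use 35 513426 (use 34 143256 (clash 8 423516)) ∷ []) ∷ []) ∷ row 5 (use 34 243651
    (nogood 21 645123 (use 21 236415 (use 38 643152 (use 25 523614 (use 8 423516 (use 25 362154 (clash 25 532416))))) ∷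
    use 8 423516 (use 34 143256 (use 38 615324 (use 24 521634 (clash 38 162534)))) ∷ [])) ∷ nogood 21 236415 (use 25
    362154 (clash 38 152364) ∷ use 38 643152 (use 25 532416 (use 25 362154 (use 8 423516 (clash 25 523614)))) ∷ []) ∷
    use 8 423516 (use 34 143256 (use 38 162354 (use 38 615324 (clash 24 521634)))) ∷ []) ∷ []) ∷ []))) (flip 1 (row 4
    (use 36 531426 (row 5 (use 36 134526 (use 31 532146 (clash 36 136524)) ∷ use 36 234516 (use 31 532146 (clash 36
    236514)) ∷ use 36 324516 (use 31 532146 (clash 36 326514)) ∷ [])) ∷ sole 6 (use 31 532164 (use 36 324516 (use 36
    234516 (use 36 124536 (sink 5))))) ∷ [])))))) ∷
  (literals 162161152146142115113 , cut 2 1 (cut 2 3 (use 39 534621 (use 39 361542 (row 3 (use 34 634152 (use 39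
    251346 (use 27 136542 (clash 32 356124))) ∷ use 38 654312 (use 37 243165 (use 24 641325 (use 27 136542 (clash 39
    514623)))) ∷ use 38 264531 (use 29 165243 (clash 38 654312)) ∷ [])))) (cut 1 4 (flip 1 (use 39 543621 (use 39
    435621 (row 3 (sole 4 (sole 5 (clash 36 361524)) ∷ sole 5 (clash 36 561324) ∷ []))))) (cut 6 5 (use 39 234615 (use
    36 356142 (use 25 426513 (use 38 624351 (use 13 326145 (use 13 513462 (clash 39 523461))))))) (flip 1 (nogood 39
    456213 (use 23 641253 (use 23 641235 (row 4 (use 38 532614 (use 36 163425 (use 23 615234 (clash 38 536214))) ∷ use
    38 351264 (use 36 263415 (use 23 625134 (clash 38 536214))) ∷ use 36 623415 (clash 39 314625) ∷ []))) ∷ use 23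
    461253 (use 23 641235 (use 39 413625 (use 20 362145 (use 20 326145 (use 20 316245 (sole 4 (use 20 136245 (clash 20
    524163)))))))) ∷ [])))))) (sole 2 (use 36 541362 (use 36 451362 (sole 3 (use 36 651342 (nogood 36 254613 (use 19
    642153 (clash 24 541263) ∷ nogood 39 234615 (use 19 345612 (clash 24 146532) ∷ use 19 435612 (use 19 354612 (use 36
    614352 (use 19 642153 (clash 39 326154)))) ∷ []) ∷ [])))))))) ∷
  (literals 161143141136131 , cut 1 2 (cut 1 5 (cut 6 5 (use 39 562431 (use 39 265431 (nogood 39 542361 (row 5 (nogood
    38 164325 (use 24 341562 (use 24 641532 (clash 37 645132)) ∷ sole 2 (use 24 641532 (clash 37 142563)) ∷ []) ∷
    nogood 37 142563 (use 24 641235 (use 29 236145 (clash 38 324516)) ∷ use 38 324516 (use 29 236145 (use 29 423651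
    (clash 38 254163))) ∷ []) ∷ []) ∷ use 24 431562 (use 24 641235 (use 39 245361 (use 29 236145 (clash 38 324516))))
    ∷ [])))) (flip 1 (use 39 562431 (use 39 265431 (nogood 39 542361 (row 5 (nogood 38 164325 (use 24 641532 (use 24
    431562 (clash 37 645132)) ∷ sole 2 (use 24 641532 (clash 37 142563)) ∷ []) ∷ nogood 37 142563 (use 24 641235 (use
    29 236145 (clash 38 324516)) ∷ use 38 324516 (use 29 236145 (use 29 423651 (clash 38 254163))) ∷ []) ∷ []) ∷ use
    24 341562 (use 24 641235 (use 38 325416 (use 29 236145 (clash 38 324516)))) ∷ [])))))) (cut 6 2 (cut 6 4 (cut 3 5
    (cut 6 5 (cut 4 2 (clash 40 416523) (flip 1 (use 40 623154 (row 2 (use 36 354261 (use 36 345261 (sole 5 (clash 38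
    426513))) ∷ use 36 645231 (use 37 315624 (sole 5 (clash 31 264315))) ∷ []))))) (nogood 23 456312 (use 38 425613
    (nogood 24 643521 (use 38 241563 (clash 36 365241) ∷ use 38 164352 (use 24 456132 (clash 38 615342)) ∷ [])) ∷ use
    36 465231 (use 36 456231 (use 38 256134 (sole 5 (use 38 615342 (clash 38 625314))))) ∷ []))) (cut 4 5 (cut 3 2
    (clash 40 613524) (flip 1 (nogood 24 653142 (use 36 563241 (nogood 38 136452 (use 23 653412 (use 38 253146 (use 38
    314562 (sink 5))) ∷ sole 5 (use 38 625314 (use 38 253146 (clash 23 653412))) ∷ [])) ∷ use 36 653241 (use 36 635241
    (use 38 253146 (sole 5 (use 38 315462 (clash 38 325416))))) ∷ [])))) (nogood 25 562341 (use 24 653142 (use 23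
    653412 (clash 40 643512)) ∷ use 36 154362 (use 23 653412 (nogood 19 254361 (use 23 354612 (use 36 354261 (use 38
    425613 (use 40 436512 (use 24 456132 (sole 5 (clash 36 145362)))))) ∷ use 23 456312 (use 23 354612 (use 19 524361
    (use 19 625431 (sole 5 (clash 25 265341))))) ∷ []))) ∷ [])))) (nogood 40 643512 (use 23 546312 (use 37 356142
    (clash 23 536412)) ∷ use 23 536412 (nogood 40 354216 (use 23 456312 (use 37 346152 (use 37 341652 (use 40 634512
    (use 21 165324 (use 34 154362 (use 25 265341 (clash 38 241653))))))) ∷ use 21 541263 (nogood 23 356412 (use 37
    341652 (use 40 634512 (use 21 165324 (use 34 136542 (use 38 241653 (clash 25 265341))))) ∷ nogood 37 645213 (use 24
    146235 (use 20 136245 (use 39 215436 (use 23 354612 (clash 25 265341)))) ∷ sole 5 (use 20 136245 (use 39 215436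
    (use 25 265341 (use 23 354612 (clash 34 136542))))) ∷ []) ∷ [])) ∷ [])) ∷ []))) (cut 6 4 (cut 3 5 (cut 6 5 (cut 4
    2 (row 2 (use 36 354261 (use 36 345261 (sole 5 (use 37 316524 (clash 38 426513)))) ∷ use 36 234165 (clash 37
    316524) ∷ use 36 645231 (use 37 315624 (sole 5 (clash 31 264315))) ∷ [])) (flip 1 (clash 40 416523))) (flip 1
    (nogood 24 456132 (use 36 546231 (nogood 23 456312 (use 38 241653 (sole 5 (clash 38 164352)) ∷ use 38 613542 (sole 5
    (clash 38 256134)) ∷ [])) ∷ use 36 465231 (use 36 456231 (use 38 256134 (sole 5 (use 38 615342 (clash 38
    625314))))) ∷ [])))) (cut 3 2 (cut 4 5 (nogood 24 653142 (use 36 563241 (nogood 23 653412 (use 38 136452 (sole 5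
    (clash 38 625314)) ∷ use 38 253146 (sole 5 (clash 38 314562)) ∷ [])) ∷ use 36 653241 (use 36 635241 (use 38 253146
    (sole 5 (use 38 325416 (clash 38 315462))))) ∷ [])) (flip 1 (row 2 (use 19 254361 (use 38 425613 (use 36 354261
    (use 36 154362 (use 40 436512 (use 24 456132 (sole 5 (clash 36 145362))))))) ∷ use 25 562341 (use 24 653142 (clash
    40 643512)) ∷ use 36 546231 (use 40 643512 (use 23 653412 (nogood 19 254361 (use 23 354612 (clash 40 436512) ∷ use
    23 456312 (use 23 354612 (use 19 524361 (sole 5 (clash 25 265341)))) ∷ [])))) ∷ [])))) (flip 1 (use 23 653412 (use
    24 653142 (clash 40 643512)))))) (flip 1 (nogood 40 643512 (use 24 546132 (use 23 546312 (clash 37 356142)) ∷ use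
    23 536412 (nogood 40 354216 (use 23 456312 (use 37 346152 (use 37 341652 (use 40 634512 (use 21 165324 (use 34
    136542 (use 38 241653 (clash 25 265341))))))) ∷ use 21 541263 (nogood 40 634512 (use 23 456312 (use 24 146235 (use
    20 136245 (use 39 215436 (use 23 354612 (clash 25 265341))))) ∷ nogood 23 456312 (use 37 341652 (use 21 165324 (use
    34 136542 (use 25 265341 (clash 38 241653)))) ∷ nogood 21 165324 (use 24 146235 (use 20 136245 (use 23 354612
    (clash 25 265341))) ∷ use 20 136245 (use 25 265341 (use 23 354612 (clash 34 136542))) ∷ []) ∷ []) ∷ [])) ∷ [])) ∷
    [])))))) (cut 1 5 (cut 6 5 (cut 6 4 (cut 3 2 (cut 6 2 (cut 4 5 (clash 40 416253) (flip 1 (use 40 653124 (row 5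
    (use 36 342561 (use 36 324561 (sole 2 (clash 38 456213))) ∷ use 36 642531 (use 37 312654 (sole 2 (clash 31
    564312))) ∷ []))))) (nogood 23 426315 (use 38 452613 (nogood 24 643251 (use 36 124365 (clash 36 462531) ∷ use 38
    164325 (use 38 612345 (clash 24 426135)) ∷ [])) ∷ use 36 462531 (use 36 426531 (use 38 526134 (sole 2 (use 38
    652314 (clash 38 612345))))) ∷ []))) (cut 4 2 (cut 3 5 (clash 40 613254) (flip 1 (nogood 23 623415 (use 38 561324
    (nogood 38 312465 (use 24 623145 (use 38 136425 (clash 24 364251)) ∷ use 24 364251 (use 36 216435 (clash 36
    632541)) ∷ [])) ∷ use 36 632541 (use 36 623541 (use 38 523146 (sole 2 (use 38 312465 (clash 38 352416))))) ∷
    [])))) (row 5 (use 40 643215 (use 23 623415 (use 36 246531 (nogood 19 524361 (use 23 324615 (clash 40 436215) ∷ use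
    23 426315 (use 23 324615 (use 19 254361 (sole 2 (clash 25 562341)))) ∷ [])))) ∷ use 19 524361 (use 38 452613 (use
    36 324561 (use 36 124365 (use 40 436215 (use 24 426135 (use 36 142365 (sink 2))))))) ∷ use 40 643215 (use 24
    623145 (clash 25 265341)) ∷ [])))) (nogood 40 643215 (use 23 246315 (use 23 236415 (clash 37 326145)) ∷ use 23
    236415 (nogood 40 324516 (use 23 426315 (use 37 346125 (use 37 341625 (use 40 634215 (use 21 162354 (use 34 124365
    (use 25 562341 (clash 38 541623))))))) ∷ use 21 241563 (nogood 23 426315 (use 37 341625 (use 40 634215 (use 21
    162354 (use 34 136245 (use 25 562341 (clash 38 541623))))) ∷ nogood 24 146532 (use 20 136542 (use 39 512436 (use 25
    562341 (use 34 124365 (clash 23 324615)))) ∷ use 37 642513 (sole 2 (use 20 136542 (use 39 512436 (use 25 562341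
    (clash 34 136245))))) ∷ []) ∷ [])) ∷ [])) ∷ []))) (cut 6 4 (cut 4 5 (cut 6 2 (cut 3 5 (clash 40 314256) (cut 3 2
    (row 5 (use 37 316254 (clash 36 534162) ∷ use 36 342561 (use 36 324561 (sole 2 (use 37 316254 (clash 38 456213))))
    ∷ use 36 642531 (use 37 312654 (sole 2 (clash 31 564312))) ∷ [])) (flip 1 (use 23 623415 (use 36 426531 (use 36
    432561 (use 37 612453 (sole 2 (use 36 312465 (clash 40 643215)))))))))) (cut 3 2 (flip 1 (nogood 24 426135 (use 36
    246531 (nogood 23 426315 (use 38 541623 (sole 2 (clash 38 164325)) ∷ use 38 526134 (sole 2 (clash 38 613245)) ∷
    [])) ∷ use 36 462531 (use 36 426531 (use 38 526134 (sole 2 (use 38 612345 (clash 38 652314))))) ∷ []))) (use 25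
    245631 (use 36 123645 (nogood 19 523641 (use 23 623415 (use 36 623541 (use 38 352416 (use 40 364215 (use 24 324165
    (sole 2 (clash 36 132645)))))) ∷ use 23 623415 (use 19 253641 (use 23 324615 (use 19 452361 (use 25 542631 (sink
    2))))) ∷ [])))))) (cut 6 2 (cut 4 2 (nogood 36 563142 (use 16 536241 (use 37 614253 (use 38 354216 (use 16 413625
    (sole 5 (clash 37 612453))))) ∷ row 5 (use 16 536241 (use 36 362541 (sole 2 (clash 16 526431))) ∷ use 36 432561
    (nogood 16 523641 (use 37 612453 (sole 2 (clash 31 564312)) ∷ sole 2 (use 16 536241 (clash 37 612453)) ∷ [])) ∷ use
    36 632541 (use 38 354216 (sole 2 (clash 31 564312))) ∷ []) ∷ [])) (flip 1 (use 23 324615 (use 36 342561 (use 36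
    324561 (use 38 452613 (sole 2 (clash 38 524163)))))))) (flip 1 (use 23 426315 (use 24 426135 (clash 40
    436215)))))) (flip 1 (nogood 23 236415 (use 37 326145 (use 23 246315 (clash 40 643215)) ∷ use 40 643215 (nogood 40
    324516 (use 23 426315 (use 40 634215 (use 38 164235 (use 37 341625 (use 21 162354 (use 34 136245 (use 38 541623
    (clash 25 562341))))))) ∷ use 21 241563 (nogood 23 326415 (use 38 164325 (use 40 634215 (use 21 162354 (use 34
    136245 (use 25 562341 (clash 38 541623))))) ∷ row 2 (use 37 642513 (use 24 146532 (use 38 561432 (use 39 512436
    (clash 25 562341)))) ∷ use 20 136542 (use 39 512436 (use 25 562341 (use 23 324615 (clash 34 136245)))) ∷ []) ∷
    [])) ∷ [])) ∷ []))))) (sink 1))) ∷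
  (literals 163161143142115112 , cut 1 3 (use 41 546123 (use 41 456123 (use 41 154623 (use 41 256143 (row 3 (use 41
    364152 (nogood 38 254316 (use 23 364152 (use 25 631452 (sole 5 (nogood 23 654123 (use 34 354612 (use 41 261345
    (clash 23 654132)) ∷ use 34 354612 (use 23 564132 (use 25 156342 (clash 34 126543))) ∷ [])))) ∷ sole 2 (use 23
    364125 (use 23 654132 (clash 41 261345))) ∷ [])) ∷ row 2 (use 41 261345 (use 23 261435 (use 23 241635 (clash 38
    231465))) ∷ use 38 254136 (use 23 361452 (use 25 461235 (nogood 23 241635 (use 25 631452 (clash 41 564132) ∷ use 23
    463152 (use 34 126543 (use 25 156342 (clash 41 364152))) ∷ [])))) ∷ []) ∷ [])))))) (cut 3 1 (cut 3 5 (use 41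
    164352 (use 41 164325 (use 41 263145 (nogood 25 426135 (use 41 546132 (use 41 461532 (nogood 24 461532 (use 38
    254136 (use 24 431562 (clash 37 345162)) ∷ use 38 254136 (sole 2 (clash 38 364251)) ∷ []))) ∷ use 39 452631 (sole
    2 (use 41 256413 (use 37 164253 (use 38 362451 (sole 5 (clash 37 162453)))))) ∷ []))))) (cut 6 2 (cut 4 1 (flip 1
    (use 41 356421 (use 41 164325 (use 41 354621 (use 41 146325 (use 41 263145 (row 5 (use 41 563142 (use 41 564132
    (use 27 523641 (use 38 346251 (use 27 154263 (use 37 365142 (use 27 156243 (clash 38 364251))))))) ∷ use 37 623145
    (use 34 326541 (nogood 38 346251 (sole 2 (clash 37 162534) ∷ sole 2 (clash 27 156243) ∷ []))) ∷ use 34 356241 (use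
    37 623145 (nogood 37 142536 (sole 2 (clash 27 154263) ∷ use 27 154263 (clash 38 364251) ∷ []))) ∷ [])))))))) (use
    41 154632 (use 23 514623 (use 41 456132 (row 5 (use 38 216435 (use 38 214635 (use 23 631425 (clash 41 564213))) ∷
    use 38 216435 (use 38 123645 (use 23 341625 (clash 25 436215))) ∷ use 38 214635 (use 25 436215 (use 23 361425
    (clash 38 123645))) ∷ [])))))) (flip 1 (use 41 546132 (use 41 156342 (use 41 263145 (nogood 25 426135 (use 41
    456321 (nogood 41 154632 (use 24 123564 (use 24 123465 (use 38 452316 (sole 2 (clash 38 625413)))) ∷ use 24 123465
    (sole 2 (use 24 163524 (use 35 416532 (clash 38 261453)))) ∷ [])) ∷ use 41 463125 (use 41 456132 (row 2 (nogood 41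
    254613 (sole 4 (use 38 624513 (clash 24 231564)) ∷ sole 4 (use 24 261534 (use 35 426513 (clash 38 362451))) ∷ [])
    ∷ use 41 263154 (nogood 24 531264 (use 41 456213 (use 24 561234 (use 38 521364 (sole 5 (clash 38 543126)))) ∷ use
    41 456213 (sole 4 (use 24 231564 (clash 38 635421))) ∷ [])) ∷ []))) ∷ [])))))))) (cut 1 4 (cut 6 4 (use 41 256413
    (use 39 352614 (sole 2 (use 41 361452 (sole 3 (use 41 536124 (sole 5 (clash 32 543216)))))))) (cut 6 5 (use 40
    136254 (sole 3 (clash 41 361452))) (flip 1 (use 41 436125 (use 41 536124 (use 41 256134 (use 41 246135 (row 5
    (nogood 41 246513 (use 24 431562 (use 36 365214 (nogood 24 461532 (use 41 452613 (sole 4 (clash 27 634512)) ∷ sole 3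
    (use 36 364215 (sole 4 (clash 36 241563))) ∷ []))) ∷ use 24 531462 (sole 2 (use 24 431562 (use 24 415362 (clash 35
    546213)))) ∷ []) ∷ nogood 41 542613 (sole 2 (use 24 531462 (use 35 546213 (sole 3 (use 24 514362 (clash 27
    124563))))) ∷ sole 2 (use 31 165432 (sole 4 (use 24 561432 (clash 36 251463)))) ∷ []) ∷ []))))))))) (row 2 (sole 3
    (use 25 624135 (clash 36 241563)) ∷ use 36 541263 (row 3 (row 5 (use 38 213465 (nogood 34 354612 (use 24 631245
    (use 24 614352 (clash 24 613245)) ∷ use 24 631245 (clash 25 364215) ∷ [])) ∷ use 38 213465 (use 24 431265 (clash
    38 254316)) ∷ []) ∷ use 25 624135 (nogood 38 254136 (use 24 613245 (clash 25 164235) ∷ use 24 163245 (use 24 431265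
    (clash 34 243615)) ∷ [])) ∷ [])) ∷ nogood 38 254136 (sole 3 (use 25 654132 (use 36 541263 (use 38 254316 (use 25
    364215 (sole 5 (clash 34 354612)))))) ∷ row 5 (use 36 241563 (use 20 315462 (nogood 36 314652 (use 24 431562 (clash
    25 436512) ∷ sole 3 (use 24 431562 (clash 25 346512)) ∷ []))) ∷ sole 3 (use 25 654132 (clash 36 541263)) ∷ use 36
    421563 (row 3 (nogood 25 456132 (use 25 364215 (clash 34 354612) ∷ use 25 164235 (use 20 534162 (clash 39 215463))
    ∷ []) ∷ use 25 346512 (use 25 164235 (use 25 624135 (use 20 534162 (clash 39 215463)))) ∷ [])) ∷ []) ∷ []) ∷
    []))))) ∷
  (literals 161115114113112 , cut 6 3 (cut 6 2 (use 41 356142 (use 41 546132 (use 41 456132 (use 41 456123 (use 41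
    546123 (use 41 256143 (nogood 21 562413 (use 21 463512 (sole 2 (use 21 563412 (row 5 (sole 4 (use 21 362415 (clash
    38 543126)) ∷ use 38 543126 (sole 4 (clash 21 263514)) ∷ [])))) ∷ use 21 463512 (nogood 38 541236 (sole 4 (use 41
    461235 (clash 21 362514)) ∷ sole 5 (use 41 561324 (clash 21 263415)) ∷ [])) ∷ [])))))))) (cut 6 5 (use 41 546123
    (use 41 256143 (use 41 456123 (use 41 246135 (use 41 436125 (use 41 346125 (nogood 21 465213 (use 21 263415 (sole 3
    (sole 5 (nogood 38 423156 (sole 2 (clash 21 563412) ∷ sole 4 (clash 21 365214) ∷ [])))) ∷ use 21 263415 (nogood 38
    421536 (sole 2 (use 41 261534 (clash 21 365412)) ∷ sole 4 (use 41 461352 (clash 21 563214)) ∷ [])) ∷ []))))))))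
    (flip 1 (use 41 356142 (use 41 546132 (use 41 456132 (use 41 436125 (use 41 346125 (use 41 246135 (nogood 21 462315
    (sole 5 (use 21 365412 (sole 2 (nogood 38 431526 (sole 3 (clash 21 265413) ∷ use 21 562314 (sink 4) ∷ [])))) ∷ use
    21 365412 (nogood 38 341526 (sole 4 (use 21 265314 (clash 41 461523)) ∷ sole 3 (use 41 361524 (use 21 465312 (clash
    21 562413))) ∷ [])) ∷ []))))))))))) (cut 6 4 (cut 6 5 (use 41 536124 (use 41 436125 (use 41 356124 (use 41 256134
    (use 41 346125 (use 41 246135 (nogood 21 265314 (sole 4 (use 21 365214 (use 21 364215 (nogood 38 231456 (sole 3
    (clash 21 564213) ∷ sole 2 (clash 21 465312) ∷ [])))) ∷ use 21 364215 (nogood 38 321456 (sole 2 (use 41 261453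
    (clash 21 564312)) ∷ sole 3 (use 21 465213 (clash 41 361542)) ∷ [])) ∷ [])))))))) (flip 1 (use 41 546123 (use 41
    456123 (use 41 256143 (use 41 436125 (use 41 246135 (use 41 346125 (nogood 21 463215 (use 21 265413 (sole 3 (sole 5
    (nogood 38 421536 (sole 2 (clash 21 365412) ∷ sole 4 (clash 21 563214) ∷ [])))) ∷ use 21 265413 (nogood 38 423156
    (sole 2 (use 21 563412 (clash 41 261354)) ∷ sole 4 (use 21 365214 (clash 41 461532)) ∷ [])) ∷ [])))))))))) (flip 1
    (use 41 256143 (use 41 546123 (use 41 456123 (use 41 536124 (use 41 356124 (use 41 256134 (nogood 21 264513 (sole 3
    (use 21 564213 (use 21 563214 (nogood 38 521436 (sole 2 (clash 21 364512) ∷ sole 5 (clash 21 463215) ∷ [])))) ∷ use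
    21 563214 (nogood 38 523146 (sole 2 (use 21 463512 (clash 41 261345)) ∷ sole 5 (use 41 561342 (use 21 263514 (clash
    21 364215))) ∷ [])) ∷ []))))))))))) ∷
  (literals 154152141131116115 , cut 3 5 (use 39 462315 (use 39 264315 (use 41 643125 (nogood 41 165432 (nogood 19
    324156 (use 41 563142 (nogood 38 435261 (use 24 531642 (use 24 531246 (use 24 635214 (clash 24 532614))) ∷ use 24
    531246 (use 42 135246 (clash 24 541236)) ∷ [])) ∷ nogood 41 241536 (nogood 24 365214 (use 37 534261 (nogood 19 342156
    (use 37 532461 (sole 6 (nogood 43 654213 (use 19 423165 (clash 34 463521) ∷ use 19 423165 (clash 34 263541) ∷ [])))
    ∷ use 41 463251 (use 34 452631 (sole 6 (clash 19 316524))) ∷ [])) ∷ nogood 19 135264 (use 19 432156 (use 24 541236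
    (use 42 135246 (clash 19 316524))) ∷ use 19 432156 (use 41 635214 (sole 6 (use 42 341562 (use 19 423165 (clash 41
    263514))))) ∷ []) ∷ []) ∷ use 24 635214 (use 37 534261 (use 37 532461 (sole 6 (nogood 34 463521 (use 34 263541
    (clash 43 654213) ∷ use 34 263541 (use 38 132465 (clash 19 423165)) ∷ []))))) ∷ []) ∷ []) ∷ nogood 19 324156 (nogood
    24 635214 (use 37 534261 (nogood 19 432156 (use 37 532461 (sole 6 (nogood 43 654213 (use 34 463521 (use 38 134265
    (clash 19 423165)) ∷ use 34 263541 (use 19 423165 (clash 38 134265)) ∷ []))) ∷ use 41 463251 (use 34 452631 (use
    24 235614 (sole 6 (clash 19 316524)))) ∷ [])) ∷ use 19 432156 (use 41 241536 (use 41 635214 (sole 6 (use 41 263514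
    (use 42 341562 (clash 19 423165)))))) ∷ []) ∷ use 42 364125 (use 19 432156 (sole 2 (use 41 263451 (use 41 463512
    (use 37 532461 (use 19 423165 (sole 6 (clash 19 316542)))))))) ∷ []) ∷ []))))) (cut 4 6 (cut 3 6 (clash 40 143265)
    (flip 1 (use 41 163425 (use 41 643125 (use 41 164325 (use 41 543126 (sole 5 (use 42 423561 (nogood 13 623145 (use
    19 324165 (use 42 463251 (use 8 624315 (use 13 536412 (use 41 152346 (clash 13 243156))))) ∷ nogood 13 513642 (use
    19 324165 (use 42 253164 (use 38 651342 (clash 13 643512))) ∷ use 38 564312 (use 13 531642 (clash 38 651342)) ∷
    []) ∷ [])))))))))) (flip 1 (use 41 634125 (use 41 534126 (sole 5 (use 41 164325 (use 41 163425 (use 42 324561 (row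
    6 (nogood 38 563412 (use 13 541632 (use 19 423165 (use 38 561342 (clash 13 634512))) ∷ use 13 514632 (use 19 423165
    (use 13 634512 (clash 38 654312))) ∷ []) ∷ use 19 423165 (use 42 354261 (use 8 623415 (use 13 546312 (use 19
    432156 (clash 38 531462))))) ∷ []))))))))))) ∷
  (literals 161141131 , cut 3 4 (cut 1 2 (cut 3 2 (cut 6 4 (cut 4 2 (clash 41 163452) (flip 1 (use 41 456321 (use 41
    453621 (row 2 (use 37 654132 (use 44 123654 (use 23 534612 (use 34 456231 (use 42 623451 (use 38 436521 (use 24
    641532 (clash 37 165243))))))) ∷ use 44 126354 (use 44 123654 (nogood 23 354612 (nogood 44 253641 (use 23 631425
    (use 44 256431 (clash 23 361425)) ∷ use 24 631245 (use 44 256341 (clash 23 361425)) ∷ []) ∷ use 41 563421 (use 24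
    164235 (use 44 364215 (clash 24 134265))) ∷ []))) ∷ use 37 654132 (use 44 126354 (use 24 534162 (use 42 326451
    (use 34 426531 (use 41 564132 (use 38 463521 (sole 5 (clash 37 135246)))))))) ∷ [])))))) (use 41 456321 (use 41
    653421 (use 41 163452 (cut 5 1 (use 31 265314 (clash 41 563421)) (cut 5 2 (use 41 165342 (use 41 563142 (use 7
    534162 (use 4 364251 (use 4 346251 (use 7 634152 (use 7 436152 (use 44 461352 (clash 7 532641))))))))) (cut 4 5
    (use 19 634125 (use 42 356214 (use 4 364251 (sole 5 (use 13 623451 (use 43 564213 (use 8 523641 (use 13 165342
    (clash 7 143265))))))))) (cut 2 6 (use 18 345261 (use 19 436125 (use 3 653241 (use 13 513246 (clash 38 463521)))))
    (cut 3 6 (use 41 153642 (use 13 423651 (use 19 436125 (use 3 653241 (use 41 263145 (use 13 253461 (use 7 631254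
    (sole 5 (clash 38 643521))))))))) (cut 2 5 (cut 1 5 (use 41 246135 (use 3 653241 (clash 41 263145))) (row 5 (use
    23 453612 (use 42 346152 (use 3 653412 (clash 4 546231))) ∷ use 41 563214 (use 4 346251 (use 4 613542 (use 23
    356412 (clash 4 326415)))) ∷ use 4 546231 (use 4 416532 (clash 38 163452)) ∷ []))) (sole 2 (nogood 8 543612 (use 7
    532461 (use 19 436125 (use 38 463251 (use 3 653241 (clash 4 652134)))) ∷ use 7 631254 (use 13 546132 (nogood 18
    563241 (use 38 463251 (clash 19 436152) ∷ use 19 436152 (clash 4 516432) ∷ []))) ∷ []))))))))))))) (cut 3 6 (flip
    1 (use 41 653421 (use 41 453621 (use 41 153642 (use 41 163452 (use 43 564213 (nogood 41 563142 (use 13 623451 (use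
    13 423651 (use 13 523641 (use 13 164532 (use 13 146532 (clash 38 153642))))) ∷ nogood 13 523641 (use 13 423651 (use
    38 643251 (use 44 256341 (use 13 513264 (clash 13 246135)))) ∷ use 13 623451 (use 38 463251 (use 44 256341 (use 13
    264135 (clash 13 513246)))) ∷ []) ∷ [])))))))) (cut 1 5 (flip 1 (use 41 456321 (use 41 653421 (use 41 563142 (use
    41 163452 (use 19 634125 (use 42 653421 (row 5 (use 3 653241 (use 19 436125 (use 8 543612 (clash 29 631245))) ∷
    use 42 163245 (use 44 254631 (use 7 631524 (use 13 243165 (use 19 436125 (clash 38 463521))))) ∷ use 3 653241 (use
    41 263145 (use 19 346152 (use 44 254361 (use 38 463251 (clash 4 425136))))) ∷ []))))))))) (cut 6 4 (use 41 456321
    (cut 2 4 (use 23 523641 (use 8 526341 (use 19 623451 (use 41 563421 (sole 5 (clash 36 465231)))))) (cut 6 2 (use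
    41 156432 (use 23 523641 (use 19 623451 (use 4 415362 (use 41 563421 (sole 5 (use 4 516342 (clash 20
    143265)))))))) (cut 4 2 (nogood 18 615342 (use 36 534261 (use 40 463512 (use 40 436512 (use 4 614532 (use 4 624315
    (use 13 263415 (clash 44 634215)))))) ∷ use 40 463512 (use 7 536142 (clash 37 654132)) ∷ [])) (use 3 623541 (use
    19 623451 (use 19 326451 (use 23 423651 (use 18 314652 (clash 36 365241)))))))))) (flip 1 (use 41 456321 (use 41
    653421 (use 41 163452 (nogood 13 623451 (nogood 42 356214 (use 25 253641 (use 23 546312 (use 13 426531 (use 42
    653142 (use 23 453612 (clash 23 146325))))) ∷ use 25 253641 (use 41 563421 (nogood 13 164532 (use 8 523641 (use 13
    546132 (clash 42 253416)) ∷ sole 5 (use 8 523641 (use 13 165342 (clash 25 413625))) ∷ []))) ∷ []) ∷ use 23 546312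
    (use 42 653142 (use 23 456312 (use 23 453612 (use 23 146325 (use 42 613245 (clash 13 523461)))))) ∷ []))))))))))
    (cut 1 5 (cut 4 5 (cut 3 5 (clash 41 163425) (cut 6 4 (nogood 24 234165 (use 37 624135 (use 23 234615 (clash 44
    153624)) ∷ use 44 156324 (use 44 153624 (use 23 624315 (use 41 256431 (use 24 164532 (use 44 634512 (clash 24
    134562)))))) ∷ [])) (flip 1 (use 41 653421 (use 41 456321 (use 41 163425 (nogood 13 653421 (nogood 25 523641 (use 41
    263451 (use 42 326514 (nogood 13 253461 (use 43 265413 (use 8 253641 (use 13 162345 (clash 25 413652))) ∷ use 13
    164235 (use 13 146235 (clash 42 523416)) ∷ []))) ∷ use 23 246315 (use 41 143625 (use 42 326514 (use 42 623145 (use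
    13 456231 (use 23 146352 (clash 23 423615)))))) ∷ []) ∷ use 23 246315 (use 41 143625 (use 42 326514 (use 42 623145
    (use 23 426315 (use 13 456231 (use 23 146352 (clash 23 423615))))))) ∷ [])))))))) (cut 6 4 (flip 1 (nogood 23
    234615 (use 37 624135 (use 23 264315 (clash 44 156324)) ∷ use 44 153624 (use 44 156324 (use 23 624315 (use 41
    263451 (use 24 134562 (use 24 164532 (clash 44 634512)))))) ∷ []))) (use 41 456321 (use 41 653421 (cut 2 1 (use 31
    563214 (clash 41 263451)) (cut 5 6 (use 7 235641 (use 42 523416 (use 18 342561 (use 36 632541 (use 24 436251 (use
    20 264351 (use 7 143562 (use 4 213645 (clash 43 265413))))))))) (cut 6 5 (nogood 7 234165 (use 44 231645 (use 7
    243165 (use 37 326145 (use 7 265341 (clash 44 431625)))) ∷ use 42 623145 (use 44 231645 (use 4 416235 (use 4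
    456312 (use 4 356412 (use 13 452361 (clash 44 435612)))))) ∷ [])) (use 13 653421 (use 25 523641 (nogood 36 432561
    (use 4 621345 (use 3 634152 (clash 38 256413)) ∷ sole 2 (use 20 236451 (use 3 634152 (use 8 253641 (use 43 265413
    (clash 20 246351))))) ∷ []))))))))))) (sink 1))) (cut 4 3 (cut 1 5 (cut 6 5 (cut 3 5 (use 41 654321 (use 41 356421
    (use 42 426153 (use 29 643125 (sole 5 (use 23 623415 (nogood 44 641532 (use 23 461352 (use 44 523461 (clash 23
    431652)) ∷ use 23 641352 (use 23 431652 (clash 44 524631)) ∷ [])))))))) (cut 4 5 (cut 6 3 (flip 1 (use 41 356421
    (use 41 354621 (row 5 (use 44 156423 (use 44 154623 (nogood 23 423615 (nogood 38 156432 (use 23 641352 (use 23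
    461352 (clash 44 526341)) ∷ use 24 341562 (use 44 526431 (clash 24 641532)) ∷ []) ∷ use 41 256341 (use 24 163542
    (use 44 643512 (clash 24 143562))) ∷ []))) ∷ use 37 623145 (use 44 154623 (use 23 243615 (use 34 354261 (use 42
    654321 (use 38 346251 (use 24 361245 (clash 37 162534))))))) ∷ use 37 623145 (use 44 156423 (use 24 243165 (use 34
    356241 (use 42 456321 (use 38 364251 (use 24 431265 (clash 37 142536))))))) ∷ []))))) (use 41 654321 (use 41
    356421 (use 41 134625 (use 42 426513 (use 31 564213 (nogood 42 624135 (nogood 4 416235 (use 23 136452 (use 18 613245
    (clash 3 641352)) ∷ use 21 345261 (use 3 624531 (clash 21 365241)) ∷ []) ∷ use 4 453261 (use 7 243165 (use 8
    234615 (use 4 452163 (use 19 436125 (clash 3 631425))))) ∷ [])))))))) (flip 1 (clash 41 164325)))) (cut 4 5 (use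
    41 654321 (use 41 356421 (use 41 164325 (cut 2 1 (use 31 564213 (clash 41 264351)) (cut 2 3 (use 4 436521 (use 44
    523641 (use 44 523461 (use 7 641253 (use 4 651342 (use 38 634521 (use 20 314265 (use 38 364251 (use 19 436152
    (clash 42 456321)))))))))) (cut 1 2 (use 41 264135 (use 19 643152 (use 42 624351 (use 19 436152 (use 3 624531
    (sole 2 (use 7 341256 (use 4 351642 (clash 38 364521))))))))) (row 2 (use 43 265314 (use 8 254631 (use 7 326145
    (use 4 614235 (clash 38 143625)))) ∷ use 41 162435 (use 4 412365 (use 7 245631 (use 7 346125 (clash 36 342561))))
    ∷ use 13 352641 (clash 19 456321) ∷ [])))))))) (cut 6 3 (use 41 356421 (use 41 354621 (cut 2 1 (use 41 256341 (use
    3 654231 (use 36 243561 (use 24 263145 (clash 36 623541))))) (cut 1 2 (use 42 654321 (use 42 456321 (nogood 41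
    263145 (use 3 654231 (use 19 643152 (use 27 253641 (use 44 125463 (use 27 126543 (clash 29 654321))))) ∷ row 2
    (use 3 654231 (use 38 346251 (use 44 526431 (clash 27 154263))) ∷ use 34 356241 (use 44 523641 (use 38 346521 (use
    44 526341 (use 13 546132 (use 37 165234 (use 21 253146 (clash 37 162534))))))) ∷ use 44 523461 (use 34 326541 (use
    38 364521 (use 44 526341 (use 13 564132 (use 37 145236 (use 3 654231 (clash 37 142536))))))) ∷ []) ∷ [])))) (cut 3
    5 (nogood 24 263145 (use 37 421365 (use 7 246135 (clash 40 364215)) ∷ use 40 364215 (use 40 346215 (use 4 613245
    (use 24 143562 (use 44 643512 (clash 4 653412))))) ∷ [])) (use 23 254631 (use 19 654321 (use 19 456321 (use 36
    361542 (use 36 431562 (clash 4 421635))))))))))) (flip 1 (use 41 654321 (use 41 356421 (use 41 134625 (use 41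
    164325 (use 42 426513 (use 31 564213 (nogood 42 624135 (sole 5 (nogood 4 416235 (use 4 456312 (use 23 324615 (clash
    3 641352)) ∷ use 41 546132 (use 21 365241 (clash 3 624531)) ∷ [])) ∷ use 7 243165 (use 8 234615 (use 4 452163 (use
    4 426315 (clash 19 436125)))) ∷ [])))))))))))) (cut 1 2 (cut 6 2 (cut 6 3 (cut 3 2 (clash 41 156342) (flip 1
    (nogood 24 563142 (use 37 653142 (use 23 563412 (clash 44 126453)) ∷ use 44 126453 (use 44 124653 (use 23 653412
    (use 41 546321 (use 24 163245 (use 24 143265 (clash 44 643215)))))) ∷ [])))) (use 41 654321 (use 41 356421 (nogood
    23 546312 (use 42 654132 (use 23 536412 (use 44 431652 (use 24 654321 (clash 44 341652)))) ∷ use 42 654132 (use 44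
    541632 (use 23 356412 (nogood 4 326415 (use 41 564321 (use 23 453612 (clash 4 635241)) ∷ use 23 453612 (use 4
    635241 (use 4 426315 (use 23 624531 (clash 44 342615)))) ∷ [])))) ∷ []))))) (cut 6 3 (use 41 356421 (use 41 354621
    (cut 5 1 (use 41 546321 (use 41 365421 (use 7 542361 (use 21 243165 (use 36 563241 (use 24 543162 (clash 36
    453261))))))) (cut 2 3 (use 7 542361 (use 8 524631 (use 19 426351 (use 4 456231 (clash 36 345261))))) (cut 4 2
    (use 21 561243 (use 23 526431 (use 19 426351 (use 4 451632 (use 13 246315 (use 44 561432 (clash 4 514632)))))))
    (cut 3 2 (nogood 7 546132 (use 40 346512 (use 7 564132 (clash 37 653142)) ∷ use 40 364512 (use 40 346512 (use 23
    653412 (use 13 246315 (use 4 423615 (clash 44 643215))))) ∷ [])) (use 23 524631 (use 19 624351 (use 19 426351 (use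
    36 631245 (clash 4 651432))))))))))) (flip 1 (use 41 654321 (use 41 356421 (nogood 42 654132 (use 23 546312 (use 44
    541632 (use 4 416532 (nogood 4 426315 (use 41 564321 (use 4 635241 (clash 4 613542)) ∷ use 41 436521 (use 4 623415
    (use 23 453612 (use 4 326415 (use 23 624531 (clash 44 342615))))) ∷ [])))) ∷ use 23 546312 (use 23 536412 (use 44
    431652 (use 24 654321 (clash 44 341652)))) ∷ []))))))) (sink 1))) (cut 1 5 (cut 6 5 (cut 3 5 (use 41 146325 (use
    41 143625 (cut 4 5 (sole 5 (use 31 264351 (use 36 641235 (use 18 613452 (clash 36 361245))))) (cut 5 2 (cut 3 2
    (use 41 563142 (use 42 643125 (use 4 316245 (use 4 653412 (clash 7 635241))))) (nogood 23 623415 (use 44 241365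
    (use 38 136425 (use 7 635421 (use 7 631524 (use 24 365214 (use 19 631542 (clash 3 623415)))))) ∷ use 41 564132
    (use 41 546132 (use 3 623541 (use 27 526431 (use 44 241365 (use 38 513642 (use 37 645132 (clash 4 451632))))))) ∷
    []))) (sole 5 (use 7 264135 (use 8 246315 (use 19 643125 (use 36 162435 (clash 3 341625)))))))))) (cut 4 5 (use 41
    136425 (use 41 134625 (cut 5 2 (cut 1 2 (use 41 564132 (use 41 546132 (use 27 526341 (use 37 435162 (use 18 413652
    (clash 29 423651)))))) (nogood 42 634125 (use 4 614235 (use 24 346125 (use 4 654312 (clash 7 645231))) ∷ use 3
    624315 (use 23 324615 (clash 42 436125)) ∷ []))) (use 7 263145 (use 19 364125 (use 36 162345 (use 23 431625 (use
    21 632541 (clash 8 236415))))))))) (cut 4 6 (cut 3 6 (row 5 (use 36 246531 (use 40 643215 (use 40 634215 (nogood 23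
    326415 (use 41 546132 (use 41 564132 (use 27 526341 (use 44 524361 (clash 27 153246)))) ∷ use 24 146532 (use 4
    356412 (clash 44 436512)) ∷ [])))) ∷ use 37 326145 (use 40 634215 (use 7 243615 (use 7 243165 (use 34 624531 (use
    37 645213 (clash 3 631425)))))) ∷ use 37 426135 (use 40 643215 (use 7 234615 (use 7 234165 (use 34 654231 (use 37
    135264 (clash 3 641325)))))) ∷ [])) (flip 1 (use 41 354621 (use 41 134625 (use 42 423516 (use 31 543216 (nogood 42
    324165 (sole 5 (nogood 21 526143 (use 23 163452 (use 44 645312 (clash 4 653412)) ∷ use 4 453612 (use 41 564132
    (clash 4 613245)) ∷ [])) ∷ use 7 246135 (use 8 264315 (use 4 452136 (use 24 341265 (clash 19 643125)))) ∷
    [])))))))) (flip 1 (cut 6 5 (use 31 264351 (use 36 631245 (use 24 461532 (clash 36 461235)))) (cut 5 2 (cut 5 6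
    (use 44 261435 (use 44 261345 (use 42 423165 (use 3 463215 (use 25 314652 (use 41 563142 (use 3 423561 (clash 41
    564132)))))))) (nogood 23 623415 (nogood 23 631452 (use 37 461532 (use 44 526341 (clash 4 651432)) ∷ use 44 526431
    (use 13 563142 (clash 37 435162)) ∷ []) ∷ use 21 645231 (use 4 614235 (use 4 354612 (use 42 654123 (clash 7
    435261)))) ∷ []))) (use 7 236145 (use 8 263415 (use 19 634125 (use 24 341265 (clash 36 132645))))))))))) (cut 3 5
    (cut 4 5 (cut 1 2 (use 41 264135 (row 2 (use 40 134652 (use 44 524631 (use 7 643152 (use 19 463125 (use 8 263415
    (clash 42 423651))))) ∷ use 44 524631 (use 44 524361 (use 18 316452 (use 19 634125 (use 8 264315 (clash 42
    423651))))) ∷ use 40 143652 (use 40 134652 (use 4 451632 (use 37 142536 (use 7 431526 (clash 37 132546))))) ∷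
    []))) (cut 3 6 (cut 4 6 (flip 1 (nogood 23 246315 (use 37 421635 (use 23 236415 (clash 44 153426)) ∷ use 44 154326
    (use 44 153426 (use 23 426315 (use 41 254631 (use 24 146532 (use 24 136542 (clash 44 436512)))))) ∷ []))) (use 7
    236145 (use 42 423165 (use 4 614235 (use 23 623415 (use 4 354612 (clash 7 435261))))))) (use 7 246135 (nogood 23
    624315 (use 42 324165 (clash 3 463215) ∷ use 42 623154 (use 42 364125 (use 23 623415 (use 23 163452 (clash 7
    345261)))) ∷ []))))) (flip 1 (use 41 136425 (use 41 134625 (cut 5 2 (cut 2 4 (use 38 146325 (use 4 614235 (use 38
    516432 (use 38 153462 (clash 4 351462))))) (nogood 31 264351 (use 7 346152 (use 38 514632 (use 4 651342 (use 44
    236415 (clash 7 641523)))) ∷ cut 6 2 (use 42 436125 (use 4 451362 (use 4 423561 (use 23 324615 (use 42 436512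
    (clash 4 654312)))))) (nogood 23 326415 (use 29 436125 (use 7 645321 (use 42 426135 (use 21 231546 (use 25 436512
    (clash 7 641523))))) ∷ use 7 346152 (use 38 514632 (use 23 431652 (use 44 236415 (clash 7 641523)))) ∷ [])) ∷
    []))) (use 7 263145 (use 8 236415 (use 19 634125 (use 23 631425 (clash 36 162345)))))))))) (flip 1 (use 41 143625
    (use 41 146325 (cut 5 2 (cut 5 4 (use 44 246315 (use 38 136425 (use 7 635421 (use 24 365214 (use 42 326145 (clash
    38 163425)))))) (nogood 41 563142 (use 4 613245 (use 4 316245 (use 23 143652 (use 41 463251 (clash 31 564312)))) ∷
    use 4 613245 (nogood 44 524361 (use 24 461532 (use 40 136452 (clash 4 651432)) ∷ use 4 451632 (use 38 154362 (clash
    4 451362)) ∷ [])) ∷ []))) (use 23 243615 (use 8 246315 (use 19 463125 (use 24 361245 (clash 36 162435)))))))))))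
    (cut 1 2 (cut 6 3 (cut 4 2 (use 41 354621 (nogood 23 564312 (use 42 456132 (use 23 534612 (use 44 631452 (use 44
    361452 (clash 24 456321)))) ∷ use 42 456132 (use 44 561432 (use 4 614532 (nogood 4 423615 (use 41 546321 (use 23
    453612 (clash 4 435261)) ∷ use 4 613542 (use 4 435261 (use 4 624315 (use 4 324615 (use 23 426531 (clash 44
    362415))))) ∷ [])))) ∷ []))) (flip 1 (use 41 354621 (nogood 7 536142 (use 42 456132 (use 7 563142 (use 44 361452
    (use 7 542631 (clash 37 654132)))) ∷ use 42 456132 (use 44 561432 (use 4 614532 (nogood 4 324615 (use 36 543261
    (use 4 435261 (clash 41 546321)) ∷ use 4 613542 (use 4 435261 (use 4 624315 (use 23 426531 (clash 44 362415)))) ∷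
    [])))) ∷ []))))) (cut 6 4 (cut 6 2 (use 41 453621 (use 41 156432 (nogood 13 326451 (nogood 25 256341 (use 41 536421
    (use 42 653214 (nogood 13 134562 (use 8 526341 (use 13 546132 (clash 42 256413)) ∷ sole 5 (use 8 526341 (use 13
    135642 (clash 25 416325))) ∷ []))) ∷ use 23 543612 (use 42 653214 (use 42 356142 (use 13 423561 (use 23 456312
    (clash 23 143625))))) ∷ []) ∷ use 23 543612 (use 42 356142 (use 23 456312 (use 23 653412 (use 23 624351 (use 23
    143625 (clash 13 426531)))))) ∷ [])))) (flip 1 (use 41 453621 (use 41 156432 (nogood 13 326451 (nogood 25 256341
    (use 41 536421 (use 42 653214 (nogood 13 534162 (use 8 526341 (use 13 543162 (clash 42 256413)) ∷ use 8 526341 (use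
    13 135642 (clash 25 416325)) ∷ []))) ∷ use 23 543612 (use 42 356142 (use 42 613254 (use 13 423561 (use 23 456312
    (clash 23 143625))))) ∷ []) ∷ use 23 543612 (use 42 356142 (use 23 456312 (use 23 653412 (use 13 526431 (use 23
    143625 (clash 13 426531)))))) ∷ [])))))) (cut 3 6 (cut 6 2 (cut 4 2 (use 42 354126 (use 23 456312 (use 23 536412
    (clash 44 536412)))) (cut 4 6 (nogood 23 546312 (use 37 456132 (use 23 536412 (clash 44 123456)) ∷ use 44 124356
    (use 44 123456 (use 23 456312 (use 41 543621 (use 24 146235 (use 44 346215 (clash 24 136245)))))) ∷ [])) (flip 1
    (nogood 44 531462 (use 7 536142 (use 42 453162 (use 4 614532 (nogood 4 324615 (use 36 546231 (use 7 432561 (clash 27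
    426351)) ∷ use 3 634125 (use 4 316542 (use 4 413562 (clash 13 625341))) ∷ [])))) ∷ use 7 563142 (use 7 536142 (use
    7 542361 (clash 44 631452))) ∷ []))))) (cut 4 6 (flip 1 (nogood 44 124356 (use 23 546312 (use 23 536412 (clash 37
    456132)) ∷ use 23 536412 (use 44 123456 (use 23 456312 (use 41 543621 (use 24 146235 (use 24 136245 (clash 44
    436215)))))) ∷ []))) (cut 5 6 (use 4 463251 (use 4 364251 (use 31 254316 (use 42 513624 (use 7 341256 (use 4
    614532 (use 4 413562 (clash 4 324615)))))))) (cut 2 4 (use 18 365241 (use 7 532461 (use 36 435261 (use 13 523641
    (use 41 543621 (use 7 542361 (use 20 164235 (use 8 523461 (use 4 513462 (clash 20 546321)))))))))) (cut 5 1 (use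
    31 254316 (clash 41 543621)) (cut 2 3 (use 24 543621 (use 25 452631 (use 36 361245 (use 19 324651 (use 41 642315
    (use 4 514362 (clash 44 631452))))))) (nogood 13 423651 (use 13 564132 (use 4 624315 (use 8 523461 (use 7 536142
    (clash 42 453162)))) ∷ use 7 536142 (use 42 453162 (use 4 614532 (clash 4 624315))) ∷ [])))))))) (cut 3 2 (nogood 7
    546132 (use 3 643512 (use 4 364251 (use 7 532461 (use 44 641352 (use 7 564132 (use 3 624351 (clash 38 136452))))))
    ∷ cut 5 3 (use 38 136452 (use 38 134652 (clash 4 613542))) (cut 2 4 (use 3 643512 (use 4 364251 (use 7 532461
    (clash 3 624351)))) (row 5 (use 7 432651 (use 4 413562 (use 41 643521 (use 7 632541 (use 24 634152 (clash 31
    264315))))) ∷ nogood 41 436521 (use 21 541236 (use 25 413625 (use 13 625431 (use 3 453612 (use 4 314562 (clash 42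
    463152))))) ∷ use 4 416532 (use 13 625431 (use 4 314562 (use 42 354162 (clash 3 463512)))) ∷ []) ∷ use 18 314562
    (use 4 364251 (use 24 435621 (use 7 431256 (use 4 613542 (use 4 314562 (clash 4 423615)))))) ∷ []))) ∷ [])) (flip
    1 (nogood 7 546132 (use 3 643512 (use 4 364251 (use 7 532461 (use 3 543612 (use 44 641352 (use 3 624351 (use 4
    513462 (clash 38 136452))))))) ∷ cut 6 2 (use 3 643512 (use 24 346152 (use 21 541236 (use 31 564321 (use 18 416532
    (clash 7 632541)))))) (nogood 31 254316 (use 42 346152 (use 25 413625 (use 41 436521 (use 31 264315 (clash 19
    246531)))) ∷ row 5 (use 38 136452 (use 4 613542 (clash 38 134652)) ∷ use 7 532461 (use 25 413625 (use 13 625431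
    (use 3 453612 (use 4 314562 (clash 42 463152))))) ∷ use 4 364251 (use 21 561243 (use 41 534216 (use 23 453612 (use
    24 634152 (clash 4 423615))))) ∷ []) ∷ [])) ∷ []))))))) (sink 1))))) ∷
  (literals 164161156113112 , cut 1 4 (use 43 654321 (use 44 412536 (use 44 413526 (use 45 652134 (use 45 653124 (use
    13 356142 (use 13 256143 (use 44 613245 (use 45 635124 (use 13 361245 (clash 13 261345))))))))))) (cut 4 1 (cut 4
    3 (use 44 413526 (use 44 412536 (row 2 (sole 3 (nogood 44 643215 (nogood 13 361245 (use 44 613425 (use 25 526143
    (use 13 256413 (clash 44 351462))) ∷ nogood 13 256413 (use 44 512634 (use 13 256143 (use 13 364125 (clash 44
    356421))) ∷ use 44 312654 (clash 25 546213) ∷ []) ∷ []) ∷ nogood 13 256143 (use 44 312654 (use 13 256413 (use 13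
    364125 (clash 44 356421))) ∷ use 44 524631 (clash 25 546213) ∷ []) ∷ [])) ∷ use 44 324651 (use 44 312654 (use 13
    346152 (use 25 654312 (use 25 526143 (clash 44 512634))))) ∷ use 44 324651 (nogood 13 354162 (use 44 361245 (use 44
    315624 (use 13 364125 (clash 13 264135))) ∷ use 44 643215 (nogood 44 251463 (use 13 361245 (use 44 163245 (use 25
    342651 (clash 44 162345))) ∷ use 13 264315 (clash 13 361245) ∷ [])) ∷ [])) ∷ [])))) (cut 6 3 (cut 6 2 (clash 43
    543216) (flip 1 (use 45 635421 (use 45 654132 (use 45 645132 (use 45 653142 (use 45 564123 (use 45 462153 (nogood
    25 526143 (sole 5 (use 44 413526 (sole 3 (use 44 512634 (sole 2 (clash 45 463215))))) ∷ use 44 315624 (sole 5 (use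
    44 312654 (sole 2 (use 44 243516 (sole 3 (clash 45 362145)))))) ∷ [])))))))))) (flip 1 (clash 45 654123)))) (cut 6
    3 (use 45 652143 (use 44 412536 (use 45 654123 (use 45 645123 (row 4 (sole 2 (nogood 25 536142 (use 23 364125
    (clash 44 164235) ∷ use 44 461235 (clash 18 423615) ∷ [])) ∷ nogood 18 123645 (use 44 613425 (use 44 164235 (use 23
    541632 (sole 2 (clash 45 653214)))) ∷ sole 2 (use 45 653214 (use 23 541632 (use 44 264315 (use 25 126345 (use 44
    613425 (clash 18 241635)))))) ∷ []) ∷ [])))))) (cut 6 2 (use 45 653142 (use 45 654132 (use 44 413526 (use 45
    645132 (row 3 (use 45 653214 (sole 4 (nogood 45 463215 (sole 2 (use 23 541623 (use 44 164325 (clash 18 231645))) ∷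
    use 23 541623 (use 44 364215 (use 25 136245 (use 18 341625 (clash 44 612435)))) ∷ []))) ∷ nogood 44 164325 (use 18
    132645 (sole 4 (use 25 526143 (use 18 432615 (clash 44 461325)))) ∷ sole 4 (use 25 526143 (use 18 432615 (clash 44
    461325))) ∷ []) ∷ [])))))) (flip 1 (use 43 543216 (use 45 654132 (use 45 653142 (use 45 645132 (use 45 654123 (use
    45 652143 (use 45 645123 (row 3 (use 13 516324 (use 45 635421 (sole 4 (use 13 216435 (clash 45 653214)))) ∷ use 13
    416325 (use 45 635421 (use 13 516324 (use 13 516234 (clash 13 246315)))) ∷ [])))))))))))))) ∷
  (literals 162152151131 , cut 3 6 (use 45 635412 (use 42 345126 (use 45 564321 (use 45 645132 (use 45 645321 (use 45
    563241 (use 45 645312 (row 4 (use 46 346215 (use 46 341526 (use 13 124356 (nogood 38 245613 (use 25 215346 (use 42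
    423615 (use 25 512346 (sole 2 (use 45 564213 (use 25 413562 (clash 45 524316)))))) ∷ sole 2 (use 38 125364 (use 13
    235164 (clash 38 216534))) ∷ [])))) ∷ use 42 423615 (use 46 542613 (use 25 413562 (use 13 634512 (use 45 543126
    (use 46 425613 (clash 13 156234)))))) ∷ use 42 423615 (use 45 524316 (use 45 453126 (sole 1 (nogood 25 314562 (use
    45 563124 (use 25 215346 (use 13 163524 (clash 46 346215))) ∷ use 46 642315 (use 13 425316 (use 25 512346 (sole 2
    (clash 45 564213)))) ∷ []))))) ∷ []))))))))) (cut 1 2 (clash 45 645132) (cut 1 6 (cut 5 3 (flip 1 (use 45 564321
    (use 45 563241 (use 45 453126 (use 45 352146 (use 46 542613 (row 4 (sole 2 (use 45 635412 (use 45 564213 (nogood 46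
    614325 (use 23 521364 (use 23 243516 (clash 24 153624)) ∷ use 24 423156 (use 25 245136 (sole 6 (clash 46 562413)))
    ∷ [])))) ∷ use 45 564213 (sole 2 (use 25 365124 (nogood 46 341526 (use 23 243516 (use 24 243156 (clash 46 634215))
    ∷ use 23 243516 (use 23 136524 (use 23 423516 (clash 24 153642))) ∷ [])))) ∷ [])))))))) (cut 1 4 (use 45 563241
    (use 45 645312 (use 45 635412 (use 46 532641 (use 46 154326 (use 46 134526 (nogood 19 523164 (use 45 534126 (use 19
    436512 (use 13 425136 (use 19 152463 (sole 2 (clash 19 251436))))) ∷ nogood 13 423156 (use 19 463521 (use 46 413625
    (use 19 531624 (use 13 634512 (use 19 231456 (use 13 253164 (clash 42 531642)))))) ∷ nogood 19 463521 (use 45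
    534126 (use 46 413625 (use 13 416253 (clash 13 235164))) ∷ nogood 13 235164 (use 19 152463 (use 19 251436 (sink 2))
    ∷ use 13 416253 (clash 19 152463) ∷ []) ∷ []) ∷ []) ∷ [])))))))) (flip 1 (use 45 564321 (use 45 563241 (use 45
    543126 (use 45 453126 (use 45 352146 (row 6 (use 42 345126 (use 25 413562 (use 13 431652 (use 46 341526 (use 13
    124356 (clash 45 645312))))) ∷ use 42 345126 (use 46 634215 (nogood 13 142356 (use 45 653214 (use 45 625314 (sole 2
    (use 43 265413 (use 13 652314 (clash 25 613542))))) ∷ sole 2 (use 13 635214 (use 13 253614 (clash 38 621354))) ∷
    []))) ∷ use 46 634215 (nogood 13 436512 (use 25 413562 (use 38 643125 (use 13 264531 (use 13 152346 (clash 45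
    624315)))) ∷ use 46 346215 (use 13 154326 (clash 46 341526)) ∷ [])) ∷ [])))))))))) (cut 3 4 (use 45 635412 (sole 1
    (use 45 563241 (use 45 645321 (use 45 653124 (use 45 563124 (use 45 362154 (sole 2 (nogood 18 236514 (use 46 321654
    (use 23 263514 (use 18 461352 (clash 46 642513))) ∷ use 46 364215 (use 19 346512 (clash 46 324615)) ∷ []))))))))))
    (cut 1 4 (flip 1 (use 45 645321 (use 45 563241 (use 45 653124 (use 45 563124 (use 45 362154 (row 4 (use 42 365124
    (use 45 564312 (use 45 635412 (nogood 13 126354 (use 46 361524 (sole 6 (use 25 613542 (clash 46 562413))) ∷ sole 6
    (use 25 613542 (clash 46 562413)) ∷ [])))) ∷ use 46 436215 (row 6 (sole 2 (use 42 645213 (use 45 635412 (use 13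
    152364 (use 13 634512 (clash 45 624315))))) ∷ use 46 364215 (use 46 361524 (clash 13 156324)) ∷ use 38 463125
    (sole 2 (use 45 624315 (use 13 152364 (use 25 613542 (clash 46 562413))))) ∷ [])) ∷ use 42 365124 (use 46 436215
    (use 13 162354 (use 13 263154 (use 13 231456 (use 38 421356 (clash 13 253416)))))) ∷ [])))))))) (sink 1)))))) ∷
  (literals 115114113 , cut 6 5 (cut 2 1 (cut 2 4 (clash 47 613254) (cut 2 3 (clash 47 614253) (flip 1 (use 47 316254
    (use 47 613254 (use 47 416253 (use 46 263541 (use 47 215643 (use 47 625143 (sole 6 (use 47 425631 (use 47 325641
    (sole 3 (sole 4 (clash 18 245136))))))))))))))) (use 47 612453 (use 45 643125 (use 45 634125 (use 47 612354 (use
    45 642135 (use 47 614253 (use 47 613254 (sole 2 (use 46 625431 (nogood 13 251436 (sole 3 (use 13 361542 (use 13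
    461352 (use 13 524613 (clash 47 512643)))) ∷ sole 4 (use 13 461532 (use 13 361452 (use 13 251346 (use 47 612543
    (clash 13 523614))))) ∷ [])))))))))))) (cut 6 1 (cut 6 4 (cut 6 3 (use 47 412653 (use 47 165243 (use 46 624531
    (use 47 265143 (use 47 213654 (sole 2 (use 47 465231 (sole 4 (use 47 365241 (use 18 645132 (sole 3 (clash 47
    312654)))))))))))) (flip 1 (use 47 215643 (use 46 625431 (use 47 512643 (use 47 214653 (use 47 614253 (sole 2 (use
    47 564231 (use 47 364251 (sole 5 (use 18 654132 (sole 3 (clash 47 612354)))))))))))))) (flip 1 (use 47 614253 (use
    46 625431 (use 47 163254 (use 47 612543 (use 47 612453 (use 47 263154 (sole 2 (use 47 563241 (sole 5 (use 47
    463251 (sole 4 (clash 18 653142)))))))))))))) (cut 2 1 (cut 2 4 (use 45 652134 (use 46 264531 (sole 6 (clash 47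
    215643)))) (cut 2 3 (use 45 652143 (use 47 615243 (sole 6 (clash 46 263541)))) (flip 1 (use 46 264531 (use 47
    416253 (use 47 614253 (use 47 625143 (use 47 125643 (use 47 316254 (sole 6 (use 47 425631 (use 47 325641 (sole 3
    (sole 4 (clash 18 245136))))))))))))))) (row 6 (nogood 47 416253 (row 2 (use 45 362154 (use 45 652134 (use 45
    562134 (use 47 216543 (use 47 215643 (use 13 641532 (sole 5 (use 13 521436 (use 47 316254 (use 13 321546 (use 13
    641352 (use 13 463215 (clash 47 216453)))))))))))) ∷ use 45 462135 (use 45 362145 (use 47 216453 (use 47 214653
    (use 47 216354 (use 47 213654 (use 13 651432 (sole 4 (use 13 421536 (use 13 321456 (use 13 651342 (use 13 563214
    (clash 47 216543)))))))))))) ∷ []) ∷ row 4 (use 47 145632 (use 47 165432 (nogood 47 213654 (use 13 631452 (use 13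
    651432 (use 45 362145 (use 45 562143 (use 47 516243 (sole 5 (use 13 321546 (clash 47 216354))))))) ∷ sole 2 (use
    13 631452 (clash 47 615243)) ∷ []))) ∷ use 45 462153 (use 45 654123 (use 45 564123 (use 47 216453 (sole 2 (use 45
    652134 (use 13 641352 (use 45 562134 (use 47 316254 (sole 3 (use 13 641532 (clash 13 524316))))))))))) ∷ nogood 47
    516243 (nogood 47 216354 (row 2 (use 47 216543 (use 47 316254 (use 13 321456 (use 45 645312 (use 45 562134 (use 13
    521436 (clash 47 215643)))))) ∷ use 45 362145 (use 47 216453 (use 47 214653 (use 13 651432 (use 13 421536 (use 13
    321456 (use 13 651342 (use 13 563214 (clash 47 216543)))))))) ∷ []) ∷ sole 2 (use 45 562134 (use 47 216543 (use 47
    215643 (use 13 641532 (clash 13 521436))))) ∷ []) ∷ row 2 (use 45 562143 (use 45 652143 (use 45 462153 (nogood 45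
    635412 (use 13 521436 (use 13 421356 (use 13 631542 (use 45 362154 (sole 3 (clash 47 316254))))) ∷ sole 5 (use 13
    521436 (use 13 631452 (use 45 524316 (use 13 364215 (clash 47 216354))))) ∷ [])))) ∷ use 45 362154 (use 47 216543
    (use 47 215643 (use 13 521436 (use 13 641532 (use 13 321456 (clash 47 316254)))))) ∷ use 45 362145 (use 47 214653
    (use 47 216354 (nogood 13 354612 (use 13 521436 (clash 47 216543) ∷ use 45 524316 (sole 5 (use 45 562143 (use 13
    651432 (use 13 321456 (use 13 651342 (clash 47 216543)))))) ∷ [])))) ∷ []) ∷ []) ∷ []) ∷ []) ∷ use 45 654123 (use
    47 512643 (use 47 214653 (use 45 645123 (use 45 652143 (use 47 215643 (sole 2 (use 13 231456 (use 47 412653 (sole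
    4 (use 13 561432 (use 13 461352 (use 13 231546 (use 13 325614 (clash 47 312654)))))))))))))) ∷ use 45 652134 (use
    45 653124 (use 47 615243 (use 45 635124 (use 47 213654 (sole 2 (use 13 241356 (use 47 312654 (sole 3 (use 13
    361452 (use 47 612543 (use 13 561342 (use 13 241536 (use 13 425613 (clash 47 412653)))))))))))))) ∷ []))))) ∷
  (literals 164161151112 , cut 5 2 (use 45 645321 (use 47 453621 (use 45 635421 (use 45 563142 (use 48 642135 (use 47
    362541 (use 47 263541 (use 47 613542 (use 48 462135 (use 48 632145 (nogood 46 253416 (sole 2 (use 23 435612 (use 18
    524613 (use 18 614523 (clash 46 325416)))) ∷ sole 2 (use 18 453612 (sole 4 (use 38 235146 (sole 3 (use 47 416532
    (clash 18 354612)))))) ∷ [])))))))))))) (cut 1 4 (use 48 643251 (use 48 543126 (use 48 354126 (use 48 542136 (use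
    19 536124 (nogood 46 162534 (nogood 46 164532 (nogood 46 462315 (nogood 19 631452 (nogood 37 634152 (use 23 351642 (use
    37 132465 (clash 24 634215)) ∷ use 46 631524 (nogood 37 132465 (use 19 134265 (clash 24 634215) ∷ use 19 134265
    (use 46 536421 (use 46 134652 (use 46 432615 (use 46 235416 (sink 3))))) ∷ [])) ∷ []) ∷ use 23 351642 (use 24
    531462 (clash 37 634152)) ∷ []) ∷ use 24 631452 (use 24 531462 (clash 37 634152)) ∷ []) ∷ use 19 631452 (use 23
    531642 (use 24 531462 (clash 46 154632))) ∷ []) ∷ row 2 (use 46 164532 (use 46 154632 (use 23 531642 (nogood 23
    564123 (use 37 152463 (use 24 654213 (clash 46 462513)) ∷ use 46 462513 (use 23 654123 (clash 46 412653)) ∷ []))))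
    ∷ use 37 634152 (use 46 164532 (use 19 651432 (clash 23 351642))) ∷ use 46 154632 (use 19 651432 (use 37 634152
    (clash 24 531462))) ∷ []) ∷ []))))))) (flip 1 (use 47 362541 (use 45 645321 (use 45 635421 (use 45 564132 (use 45
    563142 (use 48 632145 (use 47 263541 (use 47 653142 (use 48 462135 (nogood 18 453612 (use 46 253416 (use 23 435612
    (use 18 524613 (use 18 614523 (clash 46 325416)))) ∷ sole 4 (use 47 416532 (use 23 435612 (use 46 253416 (use 18
    354612 (sole 3 (clash 38 235146)))))) ∷ [])))))))))))))) ∷
  (literals 154143126225216215214213112 , cut 4 2 (clash 49 413562) (cut 5 2 (clash 49 514362) (cut 6 5 (slide 1 2
    (use 49 142653 (use 49 142563 (use 49 256134 (sole 3 (use 49 123456 (use 23 561432 (clash 49 134562)))))) ∷ clash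
    49 152634 ∷ clash 49 162345 ∷ use 46 453621 (use 49 256134 (use 49 213456 (use 48 465231 (use 49 123456 (use 49
    132456 (row 3 (use 49 645213 (use 13 253146 (clash 46 132546)) ∷ use 49 645123 (use 23 451326 (use 49 561234 (use
    46 132546 (use 13 531624 (clash 13 426513))))) ∷ use 49 315462 (use 46 534621 (use 46 345621 (use 13 342615 (use
    13 532614 (clash 48 254316))))) ∷ []))))))) ∷ [])) (cut 3 5 (cut 3 2 (clash 49 315462) (slide 1 2 (clash 49 142653
    ∷ clash 49 152634 ∷ clash 49 132645 ∷ use 46 453621 (use 46 345621 (use 18 261543 (sole 6 (clash 18 261354)))) ∷
    []))) (use 49 256134 (row 3 (use 49 534621 (nogood 13 164352 (nogood 49 321546 (use 13 624351 (use 13 325461 (use 13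
    615423 (clash 23 526431))) ∷ use 13 325461 (nogood 49 651234 (use 13 624351 (use 13 615423 (clash 23 526431)) ∷ use
    13 615423 (use 13 412653 (nogood 48 264315 (use 13 532614 (clash 23 135264) ∷ use 13 532614 (clash 23 215643) ∷
    []))) ∷ [])) ∷ []) ∷ use 48 562143 (use 13 624351 (clash 49 321546)) ∷ [])) ∷ use 13 164352 (use 48 562143 (use 13
    214356 (use 23 543126 (clash 49 651234)))) ∷ row 6 (use 49 651234 (nogood 13 214356 (use 13 624351 (clash 48
    562143) ∷ use 13 624351 (clash 23 512436) ∷ [])) ∷ use 49 651234 (use 49 321546 (use 13 341256 (clash 23 543126)))
    ∷ []) ∷ []))))))) ∷
  (literals 115112 , cut 4 1 (cut 4 5 (use 45 463125 (use 45 634125 (use 49 465321 (use 49 435621 (use 49 142635 (use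
    49 142365 (sole 5 (use 45 563142 (use 45 645132 (row 6 (sole 3 (use 50 415236 (use 45 653214 (use 46 623514 (use
    50 364125 (sink 2))))) ∷ row 2 (use 50 364125 (clash 46 145632) ∷ use 45 653214 (sole 3 (clash 50 415263)) ∷ use
    46 145632 (use 50 634125 (sole 3 (clash 50 415263))) ∷ []) ∷ []))))))))))) (flip 1 (use 49 142365 (use 45 634125
    (use 45 463125 (use 49 142635 (sole 5 (use 45 645132 (use 49 435621 (use 45 563142 (use 49 465321 (row 3 (row 2
    (use 46 145632 (use 50 364125 (sole 6 (clash 50 415236))) ∷ use 45 653214 (sole 6 (clash 50 415236)) ∷ use 46
    145632 (clash 50 634125) ∷ []) ∷ sole 6 (use 50 415263 (use 49 326154 (use 46 326514 (sole 2 (clash 50 634125)))))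
    ∷ []))))))))))))) (cut 3 1 (cut 3 5 (use 49 132645 (use 45 463125 (use 45 643125 (use 49 132465 (sole 5 (use 45
    564132 (use 45 645132 (use 49 365421 (row 4 (row 2 (use 45 654213 (sole 6 (clash 50 315246)) ∷ use 46 135642 (use
    50 463125 (sole 6 (clash 50 315246))) ∷ use 46 135642 (clash 50 643125) ∷ []) ∷ sole 6 (use 50 315264 (use 45
    654213 (use 46 426513 (sole 2 (clash 50 643125))))) ∷ [])))))))))) (flip 1 (use 45 643125 (use 45 463125 (use 49
    132645 (use 49 132465 (sole 5 (use 45 564132 (use 45 645132 (use 49 365421 (use 49 345621 (row 6 (row 2 (use 45
    654213 (use 50 315264 (sink 4)) ∷ use 46 135642 (clash 50 463125) ∷ use 46 135642 (use 50 643125 (sole 4 (clash 50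
    315264))) ∷ []) ∷ sole 4 (use 50 315246 (use 45 654213 (use 46 624513 (sole 2 (clash 50 463125))))) ∷
    []))))))))))))) (cut 6 5 (use 45 643125 (use 45 634125 (use 49 162435 (use 49 162345 (sole 5 (use 45 645132 (use
    45 564132 (use 45 563142 (use 49 164325 (use 49 163425 (row 4 (sole 3 (use 49 132456 (use 50 615234 (use 49 423156
    (use 23 431652 (use 13 352416 (clash 46 423516)))))) ∷ use 49 142356 (nogood 49 243156 (use 23 341652 (use 23
    431652 (use 13 365214 (use 46 165432 (use 23 153246 (clash 13 352416))))) ∷ use 23 341652 (use 45 453216 (sole 3
    (clash 50 615243))) ∷ [])) ∷ [])))))))))))) (cut 6 2 (use 45 654132 (use 49 165342 (use 49 165432 (sole 2 (use 49
    163452 (use 45 653142 (use 49 164352 (use 45 462135 (use 45 362145 (row 4 (sole 3 (use 49 135426 (use 50 612534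
    (use 45 524316 (use 23 431625 (use 13 325416 (clash 46 453216)))))) ∷ use 49 145326 (nogood 13 354612 (use 45
    524316 (use 23 431625 (use 23 341625 (use 46 162435 (use 23 124536 (clash 13 425316))))) ∷ use 50 612543 (use 45
    524316 (use 23 431625 (use 23 341625 (use 23 123546 (clash 46 162435))))) ∷ [])) ∷ []))))))))))) (cut 3 2 (use 45
    463152 (use 49 135462 (use 49 135642 (sole 2 (use 45 462135 (use 45 362145 (use 49 316452 (use 49 136452 (use 49
    314652 (use 49 134652 (row 4 (use 49 145623 (nogood 49 546123 (use 23 641325 (use 23 461325 (use 50 215634 (use 13
    625413 (clash 49 453216)))) ∷ use 23 641325 (use 13 421563 (clash 49 456123)) ∷ [])) ∷ use 50 546123 (sole 6 (use
    49 165423 (use 13 621543 (use 50 215436 (clash 23 461325))))) ∷ [])))))))))))) (cut 4 2 (use 49 145632 (use 49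
    145362 (sole 2 (use 45 362145 (use 49 413652 (use 45 462135 (use 49 416352 (use 49 146352 (use 49 143652 (row 3
    (use 49 135624 (nogood 49 356124 (use 23 631425 (use 23 361425 (use 50 215643 (use 13 625314 (clash 49 354216)))) ∷
    use 50 215643 (use 13 321564 (clash 23 631425)) ∷ [])) ∷ use 50 536124 (sole 6 (use 13 621534 (use 49 165324 (use
    23 631425 (use 50 412563 (clash 23 123564)))))) ∷ []))))))))))) (cut 3 5 (use 45 463125 (use 49 132645 (use 49
    132465 (sole 5 (use 49 316425 (use 49 314625 (use 49 134625 (row 6 (use 50 246153 (sole 4 (clash 50 561234)) ∷ use
    49 162453 (nogood 23 641352 (use 13 451263 (use 13 651243 (clash 46 643521)) ∷ use 13 452613 (use 46 643521 (use 50
    315264 (clash 23 154263))) ∷ [])) ∷ sole 4 (use 50 512634 (use 13 256413 (use 13 451263 (use 49 621534 (use 13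
    635214 (clash 23 156243)))))) ∷ []))))))))) (cut 4 5 (use 49 142365 (use 49 142635 (sole 5 (use 49 143625 (use 49
    416325 (use 49 146325 (use 49 413625 (row 6 (use 50 236154 (sole 3 (clash 50 561243)) ∷ sole 3 (use 13 351264 (use
    49 132654 (use 23 631452 (clash 50 512643)))) ∷ use 49 162354 (nogood 13 326415 (use 45 653214 (use 23 631452 (use
    13 352614 (use 23 361452 (use 13 652314 (clash 46 634521))))) ∷ use 46 634521 (use 50 512346 (use 13 651234 (clash
    23 361452))) ∷ [])) ∷ []))))))))) (cut 6 3 (sole 3 (sole 4 (use 46 643521 (use 50 315264 (use 50 412536 (nogood 45
    645213 (use 13 431256 (use 13 361254 (sink 2)) ∷ use 13 431526 (sole 5 (clash 13 361524)) ∷ []))))))) (cut 6 4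
    (sole 4 (sole 3 (use 46 634521 (use 50 612534 (use 50 315246 (nogood 13 461523 (use 13 631524 (sole 5 (clash 13
    341526)) ∷ use 13 341526 (use 13 631524 (use 45 564213 (use 13 235614 (clash 45 543216)))) ∷ []))))))) (sole 6
    (cut 4 6 (cut 5 3 (use 23 214536 (use 13 415326 (sole 3 (use 49 543216 (use 13 361524 (use 50 461235 (clash 50
    615243))))))) (row 5 (row 2 (use 23 514236 (clash 50 152364) ∷ use 13 312456 (use 13 415236 (use 13 365214 (clash
    23 513246))) ∷ use 13 415236 (clash 13 315246) ∷ []) ∷ use 13 315426 (use 23 215346 (use 13 361524 (clash 23
    213546))) ∷ use 45 534216 (use 45 524316 (sole 3 (use 13 412536 (use 13 361254 (sole 2 (clash 50 456132)))))) ∷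
    []))) (sole 4 (sole 3 (use 50 615234 (use 50 612534 (nogood 45 543216 (use 13 461253 (sole 2 (clash 50 361542)) ∷
    use 13 461523 (sole 5 (clash 50 361245)) ∷ [])))))))))))))))))) ∷
  []

-- The last pattern, number 51, forbids two out-arcs at a vertex. Given `1 → j → k`, it makes the
-- arc `1 → k` absent; flipping at `j` keeps `1 → j` and creates `1 → k` by the xor rule, so that 51
-- applies against the new digraph.
lastStep : Refutation
lastStep =
  row 1 (row 2 (use 51 635421 (flip 2 (clash 51 635421)) ∷ use 51 645321 (flip 2 (clash 51 645321)) ∷ use 51 654321
    (flip 2 (clash 51 654321)) ∷ use 51 564321 (flip 2 (clash 51 564321)) ∷ []) ∷ row 3 (use 51 625431 (flip 3 (clash
    51 625431)) ∷ use 51 645231 (flip 3 (clash 51 645231)) ∷ use 51 654231 (flip 3 (clash 51 654231)) ∷ use 51 564231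
    (flip 3 (clash 51 564231)) ∷ []) ∷ row 4 (use 51 625341 (flip 4 (clash 51 625341)) ∷ use 51 635241 (flip 4 (clash
    51 635241)) ∷ use 51 653241 (flip 4 (clash 51 653241)) ∷ use 51 563241 (flip 4 (clash 51 563241)) ∷ []) ∷ row 5
    (use 51 624351 (flip 5 (clash 51 624351)) ∷ use 51 634251 (flip 5 (clash 51 634251)) ∷ use 51 643251 (flip 5
    (clash 51 643251)) ∷ use 51 463251 (flip 5 (clash 51 463251)) ∷ []) ∷ row 6 (use 51 524361 (flip 6 (clash 51
    524361)) ∷ use 51 534261 (flip 6 (clash 51 534261)) ∷ use 51 543261 (flip 6 (clash 51 543261)) ∷ use 51 453261
    (flip 6 (clash 51 453261)) ∷ []) ∷ [])

certificate-valid : valid [] certificate lastStep ≡ true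
certificate-valid = refl

-- Cover systems and the digraphs they realise

-- In the application `f j c` selects the residue `c + p j * f j c` modulo `p j * p j` inside the
-- class `c`. Values are arbitrary naturals, although only their residues modulo `p j` matter there.
Assignment : ℕ → Set
Assignment n = Fin n → ℕ → ℕ

_≈_ : ∀ {n} → Assignment n → Assignment n → Set
f ≈ g = ∀ j c → f j c ≡ g j c

update : ∀ {n} → Assignment n → Fin n → ℕ → ℕ → Assignment n
update f i c v j c′ with i ≟ᶠ j | c ≟ c′
... | yes _ | yes _ = v
... | _ | _ = f j c′

update-here : ∀ {n} (f : Assignment n) i c v → update f i c v i c ≡ v
update-here f i c v with i ≟ᶠ i | c ≟ c
... | yes _ | yes _ = refl
... | yes _ | no c≢ = ⊥-elim (c≢ refl)
... | no i≢ | _ = ⊥-elim (i≢ refl)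

update-there : ∀ {n} (f : Assignment n) i c v j c′ → (i ≡ j → c ≢ c′) → update f i c v j c′ ≡ f j c′
update-there f i c v j c′ ≢ with i ≟ᶠ j | c ≟ c′
... | yes i≡j | yes c≡c′ = ⊥-elim (≢ i≡j c≡c′)
... | yes _ | no _ = refl
... | no _ | _ = refl

update-comm : ∀ {n} (f : Assignment n) i c v j c′ v′ → (i ≡ j → c ≢ c′)
  → update (update f i c v) j c′ v′ ≈ update (update f j c′ v′) i c v
update-comm f i c v j c′ v′ ≢ k e with j ≟ᶠ k | c′ ≟ e
... | yes refl | yes refl = sym (trans (update-there _ i c v j c′ ≢) (update-here f j c′ v′))
... | yes refl | no c′≢ = tail
  where
  tail : update f i c v j e ≡ update (update f j c′ v′) i c v j e
  tail with i ≟ᶠ j | c ≟ e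
  ... | yes _ | yes _ = refl
  ... | yes _ | no _ = sym (update-there f j c′ v′ j e (λ _ → c′≢))
  ... | no _ | _ = sym (update-there f j c′ v′ j e (λ _ → c′≢))
... | no j≢ | _ = tail
  where
  tail : update f i c v k e ≡ update (update f j c′ v′) i c v k e
  tail with i ≟ᶠ k | c ≟ e
  ... | yes _ | yes _ = refl
  ... | yes _ | no _ = sym (update-there f j c′ v′ k e (λ j≡ → ⊥-elim (j≢ j≡)))
  ... | no _ | _ = sym (update-there f j c′ v′ k e (λ j≡ → ⊥-elim (j≢ j≡)))

-- The values of an assignment decide which word covers it: classes f j is the residue class modulo p j of that word,
-- certified says that the word depends on f only through its own coordinates, and mobile that no word lies in a column.
record CoverSystem (n : ℕ) : Set where
  field
    classes : Assignment n → Fin n → ℕ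
    certified : ∀ f g → (∀ j → g j (classes f j) ≡ f j (classes f j)) → classes g ≗ classes f
    mobile : ∀ f i → ∃ λ v → ∃ λ j → classes (update f i (classes f i) v) j ≢ classes f j

abstract
  differ : ℕ → ℕ → Bool
  differ a b = not (does (a ≟ b))

  differ-≢ : ∀ {a b} → a ≢ b → differ a b ≡ true
  differ-≢ {a} {b} a≢b = cong not (dec-false (a ≟ b) a≢b)

  differ-≡ : ∀ {a b} → a ≡ b → differ a b ≡ false
  differ-≡ {a} {b} a≡b = cong not (dec-true (a ≟ b) a≡b)

  differ-true : ∀ {a b} → differ a b ≡ true → a ≢ b
  differ-true {a} {b} e a≡b with () ← trans (sym e) (differ-≡ a≡b)

  differ-false : ∀ {a b} → differ a b ≡ false → a ≡ b
  differ-false {a} {b} e with a ≡ᵇ b in a≡b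
  ... | true = ≡ᵇ-true {a} a≡b

  differ-sym : ∀ a b → differ a b ≡ differ b a
  differ-sym a b with a ≟ b
  ... | yes refl = refl
  ... | no a≢b = trans (differ-≢ a≢b) (sym (differ-≢ (λ b≡a → a≢b (sym b≡a))))

  -- The hypothesis says that `b` or `c` equals `a`, and that one can be replaced by `a`.
  differ-xor : ∀ a b c → differ a b ∧ differ a c ≡ false → differ c b ≡ differ a b xor differ a c
  differ-xor a b c e with differ a b in p | differ a c in q
  ... | true | false = trans (cong (λ z → differ z b) (sym (differ-false {a} {c} q))) p
  ... | false | true = trans (cong (differ c) (sym (differ-false {a} {b} p))) (trans (differ-sym c a) q)
  ... | false | false = differ-≡ (trans (sym (differ-false {a} {c} q)) (differ-false {a} {b} p))

module _ {n} (system : CoverSystem n) where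
  open CoverSystem system renaming (classes to π)

  π-cong : ∀ {f g} → f ≈ g → π f ≗ π g
  π-cong {f} {g} f≈g = certified g f (λ j → f≈g j (π g j))

  shift : Assignment n → Fin n → ℕ → Assignment n
  shift f i v = update f i (π f i) v

  -- The altered value is not one of those that certify the word.
  π-inactive : ∀ f i c v → π f i ≢ c → π (update f i c v) ≗ π f
  π-inactive f i c v π≢c = certified f _ (λ j → update-there f i c v j (π f j) (λ { refl c≡ → π≢c (sym c≡) }))

  -- If the class in direction `i` did change, the new word would not use the altered value and
  -- would be certified at `f` as well, so it would have the old classes after all.
  π-shift : ∀ f i v → π (shift f i v) i ≡ π f i
  π-shift f i v with π (shift f i v) i ≟ π f i
  ... | yes e = e
  ... | no ≢ = sym (certified (shift f i v) f
    (λ j → sym (update-there f i (π f i) v j _ (λ { refl e → ≢ (sym e) }))) i)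

  shift-back : ∀ f i v → shift (shift f i v) i (f i (π f i)) ≈ f
  shift-back f i v j c with i ≟ᶠ j | π (shift f i v) i ≟ c
  ... | yes refl | yes refl = cong (f i) (sym (π-shift f i v))
  ... | yes refl | no ≢ = update-there f i (π f i) v i c (λ _ e → ≢ (trans (π-shift f i v) e))
  ... | no ≢ | _ = update-there f i (π f i) v j c (λ e → ⊥-elim (≢ e))

  Moves : Assignment n → (Fin n → ℕ) → Set
  Moves f y = ∀ i → ∃ λ j → π (shift f i (y i)) j ≢ π f j

  changes : Assignment n → (Fin n → ℕ) → Fin n → Fin n → Bool
  changes f y i j = differ (π f j) (π (shift f i (y i)) j)

  changes-irrefl : ∀ f y i → changes f y i i ≡ false
  changes-irrefl f y i = differ-≡ (sym (π-shift f i (y i)))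

  shift-comm : ∀ f i v j v′ → i ≢ j
    → update (shift f i v) j (π f j) v′ ≈ update (shift f j v′) i (π f i) v
  shift-comm f i v j v′ i≢j = update-comm f i (π f i) v j (π f j) v′ (λ i≡j → ⊥-elim (i≢j i≡j))

  -- Let `g` and `h` arise from `f` by the moves in directions `i` and `j`. If both arcs were
  -- present, making both changes would be invisible from `g` and from `h`, so `g` and `h` would
  -- have the same classes. But the class in direction `j` is that of `f` at `h`, by `π-shift`, and
  -- a different one at `g`.
  changes-asym : ∀ f y i j → changes f y i j ≡ true → changes f y j i ≡ false
  changes-asym f y i j ij with changes f y j i in ji
  ... | false = refl
  ... | true = ⊥-elim (differ-true ij (sym (trans (sym (π-inactive g j (π f j) (y j) (λ e → differ-true ij (sym e)) j))
      (trans (π-cong (shift-comm f i (y i) j (y j) i≢j) j)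
      (trans (π-inactive h i (π f i) (y i) (λ e → differ-true ji (sym e)) j) (π-shift f j (y j)))))))
    where
    g = shift f i (y i)
    h = shift f j (y j)
    i≢j : i ≢ j
    i≢j refl with () ← trans (sym ij) (changes-irrefl f y i)

  -- By asymmetry the move in direction `j` does not affect the class in direction `i`, so the later
  -- move in direction `i` alters the same value as before. The word it reaches has left the class
  -- `π f j` and does not see what happened there.
  π-shift-shift : ∀ f y i j → changes f y i j ≡ true
    → π (shift (shift f j (y j)) i (y i)) ≗ π (shift f i (y i))
  π-shift-shift f y i j ij k = trans (π-cong same k) (π-inactive (shift f i (y i)) j (π f j) (y j) (λ e → differ-true ij (sym e)) k)
    where
    i≢j : i ≢ j
    i≢j refl with () ← trans (sym ij) (changes-irrefl f y i)
    same : shift (shift f j (y j)) i (y i) ≈ update (shift f i (y i)) j (π f j) (y j)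
    same l c = trans
      (cong (λ a → update (shift f j (y j)) i a (y i) l c) (sym (differ-false (changes-asym f y i j ij))))
      (sym (shift-comm f i (y i) j (y j) i≢j l c))

  -- The moving values `y` are part of the data, since the arcs depend on them. `σ` need not be
  -- injective: labels of one direction share all their arcs.
  record Realised (H : Digraph) : Set where
    field
      f : Assignment n
      y : Fin n → ℕ
      moves : Moves f y
      σ : ℕ → Fin n
      σ-onto : ∀ k → ∃ λ m → m ∈ vertices × σ m ≡ k
      arcs : ∀ i j → H i j ≡ changes f y (σ i) (σ j)

  module _ (f : Assignment n) (y : Fin n → ℕ) (moves : Moves f y) (j : Fin n) where
    flip-target : Assignment n
    flip-target = shift f j (y j)

    -- Direction `j` moves back to `f`. A direction with an arc to `j` keeps its value, because it
    -- still reaches the same word. Any other direction may have become stuck and takes a fresh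
    -- value from `mobile`.
    flip-values : Fin n → ℕ
    flip-values i = if does (i ≟ᶠ j) then f j (π f j) else
      (if changes f y i j then y i else proj₁ (mobile flip-target i))

    flip-values-j : flip-values j ≡ f j (π f j)
    flip-values-j rewrite dec-true (j ≟ᶠ j) refl = refl

    flip-values-in : ∀ i → changes f y i j ≡ true → flip-values i ≡ y i
    flip-values-in i ij with i ≟ᶠ j
    ... | yes refl with () ← trans (sym ij) (changes-irrefl f y i)
    ... | no _ rewrite ij = refl

    flip-j : π (shift flip-target j (flip-values j)) ≗ π f
    flip-j rewrite flip-values-j = π-cong (shift-back f j (y j))

    flip-in : ∀ i → changes f y i j ≡ true → π (shift flip-target i (flip-values i)) ≗ π (shift f i (y i))
    flip-in i ij rewrite flip-values-in i ij = π-shift-shift f y i j ij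

    flip-moves : Moves flip-target flip-values
    flip-moves i with i ≟ᶠ j in i≟j | changes f y i j in ij
    ... | yes refl | _ = let k , ≢ = moves j in
      k , λ e → ≢ (trans (sym e) (trans (cong (λ v → π (shift flip-target j v) k) (sym flip-values-j)) (flip-j k)))
    -- The arc to `j` itself survives: the word reached is the old one, and the flip has not changed
    -- the class in direction `j` at the starting point.
    ... | no _ | true = j , λ e → differ-true ij (sym (trans (sym (trans (cong (λ v → π (shift flip-target i v) j)
      (sym (flip-values-in i ij))) (flip-in i ij j))) (trans e (π-shift f j (y j)))))
    ... | no _ | false = proj₂ (mobile flip-target i)

    flipped-same : ∀ k → changes flip-target flip-values j k ≡ changes f y j k
    flipped-same k rewrite flip-j k = differ-sym (π flip-target k) (π f k)

    flipped-xor : ∀ i k → changes f y i j ≡ true → changes f y i k ∧ changes f y j k ≡ false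
      → changes flip-target flip-values i k ≡ changes f y i k xor changes f y j k
    flipped-xor i k ij e rewrite flip-in i ij k = differ-xor (π f k) (π (shift f i (y i)) k) (π flip-target k) e

  module _ (f : Assignment n) (y : Fin n → ℕ) (moves : Moves f y) (i j : Fin n) (ij : changes f y i j ≡ true) where
    private
      u = shift f i (y i)
      b = π u j
      -- `b` is the class in direction `j` reached by the move in direction `i`; `v` is a value for
      -- it that forces the word at `u` to change a class.
      v = proj₁ (mobile u j)

    b≢ : π f j ≢ b
    b≢ = differ-true ij

    slide-target : Assignment n
    slide-target = update f j b v

    π-slide : π slide-target ≗ π f
    π-slide = π-inactive f j b v b≢

    slide-shift : ∀ m → shift slide-target m (y m) ≈ update (shift f m (y m)) j b v
    slide-shift m k c = trans (cong (λ a → update slide-target m a (y m) k c) (π-slide m))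
      (sym (update-comm f m (π f m) (y m) j b v (λ { refl e → b≢ e }) k c))

    -- A move that does not reach the class `b` in direction `j` never sees the new value. A move
    -- that does reach it has an arc to `j`, and keeps it because altering the value of `b` leaves
    -- the class in direction `j` at `b`.
    slide-row : ∀ m → (∀ k → changes slide-target y m k ≡ changes f y m k)
      ⊎ (changes f y m j ≡ true × changes slide-target y m j ≡ true)
    slide-row m with π (shift f m (y m)) j ≟ b
    ... | no ≢b = inj₁ (λ k → cong₂ differ (π-slide k) (trans (π-cong (slide-shift m) k) (π-inactive _ j b v ≢b k)))
    ... | yes ≡b = inj₂ (differ-≢ (λ e → b≢ (trans e ≡b)) , differ-≢ (λ e → b≢ (trans (sym (π-slide j)) (trans e here′))))
      where
      here′ : π (shift slide-target m (y m)) j ≡ b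
      here′ = trans (π-cong (slide-shift m) j)
        (trans (cong (λ c → π (update (shift f m (y m)) j c v) j) (sym ≡b)) (trans (π-shift (shift f m (y m)) j v) ≡b))

    slide-moves : Moves slide-target y
    slide-moves m with slide-row m
    ... | inj₁ same = let k , ≢ = moves m in
      k , λ e → ≢ (sym (differ-false (trans (sym (same k)) (differ-≡ (sym e)))))
    ... | inj₂ (_ , mj) = j , λ e → differ-true mj (sym e)

    -- After the slide, the move in direction `i` leads to the word at `shift u j v`, which differs
    -- from the word at `u` in some direction `k`. By `π-shift` this is not `j`. If `i` had no arc
    -- to `k`, the word at `u` had the class of `f` there, so the difference is a new arc.
    slide-escapes : ∃ λ k → k ≢ j × (changes f y i k ≡ false → changes slide-target y i k ≡ true)
    slide-escapes = let k , ≢ = proj₂ (mobile u j) in k , (λ e → ≢ (subst (λ l → π (shift u j v) l ≡ π u l) (sym e) (π-shift u j v))) ,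
      λ ik → differ-≢ (λ e → ≢ (trans (sym (π-cong (slide-shift i) k)) (trans (sym e) (trans (π-slide k) (differ-false ik)))))

    slide-keeps : changes slide-target y i j ≡ true
    slide-keeps with slide-row i
    ... | inj₁ same = trans (same j) ij
    ... | inj₂ (_ , e) = e

  realised-game : Game Realised
  realised-game = record
    { irreflexive = λ s i → let open Realised s in trans (arcs i i) (changes-irrefl f y (σ i))
    ; asymmetric = λ s i j e → let open Realised s in
        trans (arcs j i) (changes-asym f y (σ i) (σ j) (trans (sym (arcs i j)) e))
    ; serial = λ s i → let open Realised s; k , ≢ = moves (σ i); m , m∈ , e = σ-onto k in
        m , m∈ , trans (arcs i m) (trans (cong (changes f y (σ i)) e) (differ-≢ (λ e → ≢ (sym e))))
    ; relabel = λ τ onto s → let open Realised s in record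
        { f = f ; y = y ; moves = moves ; σ = λ i → σ (τ i)
        ; σ-onto = λ k → let m , m∈ , e = σ-onto k; l , l∈ , e′ = onto m∈ in l , l∈ , trans (cong σ e′) e
        ; arcs = λ i j → arcs (τ i) (τ j) }
    ; flip = λ j s → let open Realised s in _ , record
        { f = flip-target f y moves (σ j) ; y = flip-values f y moves (σ j) ; moves = flip-moves f y moves (σ j)
        ; σ = σ ; σ-onto = σ-onto ; arcs = λ _ _ → refl } ,
        (λ k → trans (flipped-same f y moves (σ j) (σ k)) (sym (arcs j k))) ,
        (λ i k ij e → trans (flipped-xor f y moves (σ j) (σ i) (σ k) (trans (sym (arcs i j)) ij)
          (trans (sym (cong₂ _∧_ (arcs i k) (arcs j k))) e)) (sym (cong₂ _xor_ (arcs i k) (arcs j k))))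
    ; slide = λ i j s ij thin → let open Realised s
                                    ij′ = trans (sym (arcs i j)) ij
                                    κ , κ≢ , escapes = slide-escapes f y moves (σ i) (σ j) ij′
                                    k , k∈ , σk≡κ = σ-onto κ
                                    k≢j = λ e → κ≢ (trans (sym σk≡κ) (cong σ e))
                                in _ , record
        { f = slide-target f y moves (σ i) (σ j) ij′ ; y = y
        ; moves = slide-moves f y moves (σ i) (σ j) ij′
        ; σ = σ ; σ-onto = σ-onto ; arcs = λ _ _ → refl } ,
        (λ m → Sum.map
          (λ same l → trans (same (σ l)) (sym (arcs m l)))
          (λ (mj , mj′) → trans (arcs m j) mj , mj′) (slide-row f y moves (σ i) (σ j) ij′ (σ m))) ,
        (k , k∈ , k≢j , trans (cong (changes (slide-target f y moves (σ i) (σ j) ij′) y (σ i)) σk≡κ)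
          (escapes (trans (cong (changes f y (σ i)) (sym σk≡κ)) (trans (sym (arcs i k)) (thin k∈ k≢j))))) ,
        slide-keeps f y moves (σ i) (σ j) ij′
    }

  -- Any assignment realises a digraph, so the zero assignment serves as a starting point.
  no-game⇒no-system : (∀ {H} → ¬ Realised H) → (σ : ℕ → Fin n)
    → (∀ k → ∃ λ m → m ∈ vertices × σ m ≡ k) → ⊥
  no-game⇒no-system none σ onto = none {λ i j → changes f₀ y₀ (σ i) (σ j)} record
    { f = f₀ ; y = y₀ ; moves = λ i → proj₂ (mobile f₀ i) ; σ = σ ; σ-onto = onto ; arcs = λ _ _ → refl }
    where
    f₀ : Assignment n
    f₀ _ _ = 0
    y₀ : Fin n → ℕ
    y₀ i = proj₁ (mobile f₀ i)

-- Congruences of integers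

infix 4 _≋_[_]
-- The relation `≡ᵐ` unfolds to divisibility of an absolute value, from which `x` and `y` cannot be
-- inferred. The record keeps them visible, and signed divisibility leaves ring identities to the
-- solver.
record _≋_[_] (x y : ℤ) (n : ℕ) : Set where
  constructor congruent
  field difference : + n Signed.∣ x - y

≋⇒≡ᵐ : ∀ {x y n} → x ≋ y [ n ] → x ≡ᵐ y [mod n ]
≋⇒≡ᵐ (congruent h) = Signed.∣⇒∣ᵤ h

≡ᵐ⇒≋ : ∀ {x y n} → x ≡ᵐ y [mod n ] → x ≋ y [ n ]
≡ᵐ⇒≋ h = congruent (Signed.∣ᵤ⇒∣ h)

≋-reflexive : ∀ {n x y} → x ≡ y → x ≋ y [ n ]
≋-reflexive {n} {x} refl = congruent (divides (+ 0) (ℤ.+-inverseʳ x))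

≋-sym : ∀ {n x y} → x ≋ y [ n ] → y ≋ x [ n ]
≋-sym {n} {x} {y} (congruent h) = congruent (subst (+ n Signed.∣_) (lemma x y) (Signed.∣m⇒∣-m h))
  where
  lemma : ∀ x y → - (x - y) ≡ y - x
  lemma = solve-∀

≋-trans : ∀ {n x y z} → x ≋ y [ n ] → y ≋ z [ n ] → x ≋ z [ n ]
≋-trans {n} {x} {y} {z} (congruent h) (congruent k) = congruent (subst (+ n Signed.∣_) (lemma x y z) (Signed.∣m∣n⇒∣m+n h k))
  where
  lemma : ∀ x y z → (x - y) ℤ.+ (y - z) ≡ x - z
  lemma = solve-∀

≋-+ : ∀ {n x y x′ y′} → x ≋ y [ n ] → x′ ≋ y′ [ n ] → x ℤ.+ x′ ≋ y ℤ.+ y′ [ n ]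
≋-+ {n} {x} {y} {x′} {y′} (congruent h) (congruent k) = congruent (subst (+ n Signed.∣_) (lemma x y x′ y′) (Signed.∣m∣n⇒∣m+n h k))
  where
  lemma : ∀ x y x′ y′ → (x - y) ℤ.+ (x′ - y′) ≡ x ℤ.+ x′ - (y ℤ.+ y′)
  lemma = solve-∀

≋-*ˡ : ∀ {n x y} k → x ≋ y [ n ] → k ℤ.* x ≋ k ℤ.* y [ n ]
≋-*ˡ {n} {x} {y} k (congruent h) = congruent (subst (+ n Signed.∣_) (lemma k x y) (Signed.∣n⇒∣m*n k h))
  where
  lemma : ∀ k x y → k ℤ.* (x - y) ≡ k ℤ.* x - k ℤ.* y
  lemma = solve-∀

≋-scale : ∀ {n x y} k → x ≋ y [ n ] → + k ℤ.* x ≋ + k ℤ.* y [ k * n ]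
≋-scale {n} {x} {y} k (congruent (divides q e)) = congruent (divides q (trans (lemma (+ k) x y)
  (trans (cong (+ k ℤ.*_) e) (trans (swap (+ k) q (+ n)) (cong (q ℤ.*_) (sym (ℤ.pos-* k n)))))))
  where
  lemma : ∀ k x y → k ℤ.* x - k ℤ.* y ≡ k ℤ.* (x - y)
  lemma = solve-∀
  swap : ∀ k q n → k ℤ.* (q ℤ.* n) ≡ q ℤ.* (k ℤ.* n)
  swap = solve-∀

≋-weaken : ∀ {m n x y} → m ∣ n → x ≋ y [ n ] → x ≋ y [ m ]
≋-weaken m∣n (congruent h) = congruent (Signed.∣-trans (Signed.∣ᵤ⇒∣ m∣n) h)

≋-0 : ∀ {n k} → n ∣ k → + k ≋ + 0 [ n ]
≋-0 {n} {k} n∣k = congruent (subst (+ n Signed.∣_) (sym (ℤ.+-identityʳ (+ k))) (Signed.∣ᵤ⇒∣ n∣k))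

≋-% : ∀ {n} .{{_ : NonZero n}} x → + (x % n) ≋ + x [ n ]
≋-% {n} x = ≋-sym (congruent (divides (+ (x / n)) (trans (cong (λ z → + z - + (x % n)) (ℕ.m≡m%n+[m/n]*n x n))
  (trans (cong (_- + (x % n)) (ℤ.pos-+ (x % n) (x / n * n)))
  (trans (lemma (+ (x % n)) (+ (x / n * n))) (ℤ.pos-* (x / n) n))))))
  where
  lemma : ∀ a b → a ℤ.+ b - a ≡ b
  lemma = solve-∀

≋-%ℕ : ∀ {n} .{{_ : NonZero n}} x → + (x ℤ.%ℕ n) ≋ x [ n ]
≋-%ℕ {n} x = ≋-sym (congruent (divides (x ℤ./ℕ n) (trans (cong (_- + (x ℤ.%ℕ n)) (ℤ.a≡a%ℕn+[a/ℕn]*n x n))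
  (lemma (+ (x ℤ.%ℕ n)) (x ℤ./ℕ n ℤ.* + n)))))
  where
  lemma : ∀ a b → a ℤ.+ b - a ≡ b
  lemma = solve-∀

≋⇒%≡-≥ : ∀ {n} .{{_ : NonZero n}} {x y} → y ≤ x → + x ≋ + y [ n ] → x % n ≡ y % n
≋⇒%≡-≥ {n} {x} {y} y≤x (congruent h)
  with dividesℕ q e ← subst (n ∣_) (cong ℤ.∣_∣ (trans (ℤ.m-n≡m⊖n x y) (ℤ.⊖-≥ y≤x))) (Signed.∣⇒∣ᵤ h) =
  trans (cong (_% n) (trans (sym (ℕ.m+[n∸m]≡n y≤x)) (cong (_+_ y) e))) (ℕ.[m+kn]%n≡m%n y q n)

≋⇒%≡ : ∀ {n} .{{_ : NonZero n}} {x y} → + x ≋ + y [ n ] → x % n ≡ y % n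
≋⇒%≡ {x = x} {y} h with ℕ.≤-total x y
... | inj₂ y≤x = ≋⇒%≡-≥ y≤x h
... | inj₁ x≤y = sym (≋⇒%≡-≥ x≤y (≋-sym h))

≋-*ʳ : ∀ {n x y} k → x ≋ y [ n ] → x ℤ.* k ≋ y ℤ.* k [ n ]
≋-*ʳ {n} {x} {y} k h = ≋-trans (≋-reflexive (ℤ.*-comm x k)) (≋-trans (≋-*ˡ k h) (≋-reflexive (ℤ.*-comm k y)))

abstract
  -- Bézout supplies `x` or `- x` as an inverse of `m`, according to the sign of its identity. The
  -- multiplier is made a natural number because it will count steps along progressions.
  invert : ∀ {m n} .{{_ : NonZero n}} → Coprime m n → ∀ s → ∃ λ k → + k ℤ.* + m ≋ s [ n ]
  invert {m} {n} c s with coprime-Bézout c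
  ... | Bézout.+- x y e = (s ℤ.* + x) ℤ.%ℕ n , ≋-trans (≋-*ʳ (+ m) (≋-%ℕ (s ℤ.* + x))) (congruent (divides (s ℤ.* + y) (trans
      (lemma s (+ x) (+ m)) (trans (cong (λ z → s ℤ.* (z - + 1)) (trans (sym (ℤ.pos-* x m)) (trans (cong +_ (sym e))
        (trans (ℤ.pos-+ 1 (y * n)) (cong (ℤ._+_ (+ 1)) (ℤ.pos-* y n)))))) (lemma′ s (+ y) (+ n))))))
    where
    lemma : ∀ s x m → s ℤ.* x ℤ.* m - s ≡ s ℤ.* (x ℤ.* m - + 1)
    lemma = solve-∀
    lemma′ : ∀ s y n → s ℤ.* (+ 1 ℤ.+ y ℤ.* n - + 1) ≡ s ℤ.* y ℤ.* n
    lemma′ = solve-∀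
  ... | Bézout.-+ x y e = (- s ℤ.* + x) ℤ.%ℕ n , ≋-trans (≋-*ʳ (+ m) (≋-%ℕ (- s ℤ.* + x))) (congruent (divides (- s ℤ.* + y) (trans
      (lemma s (+ x) (+ m)) (trans (cong (λ z → - s ℤ.* z) (trans (cong (ℤ._+_ (+ 1)) (sym (ℤ.pos-* x m)))
        (trans (sym (ℤ.pos-+ 1 (x * m))) (trans (cong +_ e) (ℤ.pos-* y n))))) (lemma′ s (+ y) (+ n))))))
    where
    lemma : ∀ s x m → - s ℤ.* x ℤ.* m - s ≡ - s ℤ.* (+ 1 ℤ.+ x ℤ.* m)
    lemma = solve-∀
    lemma′ : ∀ s y n → - s ℤ.* (y ℤ.* n) ≡ - s ℤ.* y ℤ.* n
    lemma′ = solve-∀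

≋-cancelʳ : ∀ {n} x y z → + (x + z) ≋ + (y + z) [ n ] → + x ≋ + y [ n ]
≋-cancelʳ {n} x y z (congruent h) = congruent (subst (+ n Signed.∣_) (lemma (+ x) (+ y) (+ z)) h)
  where
  lemma : ∀ x y z → (x ℤ.+ z) - (y ℤ.+ z) ≡ x - y
  lemma = solve-∀

≋-0⁻¹ : ∀ {n k} → + k ≋ + 0 [ n ] → n ∣ k
≋-0⁻¹ {n} {k} (congruent h) = subst (n ∣_) (cong ℤ.∣_∣ (ℤ.+-identityʳ (+ k))) (Signed.∣⇒∣ᵤ h)

-- Coprime factors, products and sums

coprime-* : ∀ {a b c} → Coprime a b → Coprime a c → Coprime a (b * c)
coprime-* ab ac (d∣a , d∣bc) = ac (d∣a , coprime-divisor (λ (e∣d , e∣b) → ab (∣-trans e∣d d∣a , e∣b)) d∣bc)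

coprime-∏ : ∀ {d a} (f : Fin d → ℕ) → (∀ k → Coprime a (f k)) → Coprime a (∏ f)
coprime-∏ {zero} f h (_ , e∣1) = ∣1⇒≡1 e∣1
coprime-∏ {suc d} f h = coprime-* (h zero) (coprime-∏ (f ∘ suc) (h ∘ suc))

factor∣∏ : ∀ {d} (f : Fin d → ℕ) k → f k ∣ ∏ f
factor∣∏ f zero = m∣m*n _
factor∣∏ f (suc k) = ∣n⇒∣m*n (f zero) (factor∣∏ (f ∘ suc) k)

coprime-*-∣ : ∀ {a b n} → Coprime a b → a ∣ n → b ∣ n → a * b ∣ n
coprime-*-∣ {a} {b} c (dividesℕ q refl) b∣ =
  subst (a * b ∣_) (ℕ.*-comm a q)
    (*-monoʳ-∣ a (coprime-divisor (Coprimality.sym c) (subst (b ∣_) (ℕ.*-comm q a) b∣)))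

-- This is the uniqueness half of the Chinese remainder theorem; existence is obtained from explicit
-- sums of multiples of the `Mj`.
∏∣ : ∀ {d n} (f : Fin d → ℕ) → (∀ j k → j ≢ k → Coprime (f j) (f k)) → (∀ k → f k ∣ n) → ∏ f ∣ n
∏∣ {zero} f c h = 1∣ _
∏∣ {suc d} f c h = coprime-*-∣ (coprime-∏ (f ∘ suc) (λ k → c zero (suc k) (λ ())))
  (h zero) (∏∣ (f ∘ suc) (λ j k j≢k → c (suc j) (suc k) (j≢k ∘ suc-injective)) (h ∘ suc))

∏-cong : ∀ {d} {f g : Fin d → ℕ} → (∀ k → f k ≡ g k) → ∏ f ≡ ∏ g
∏-cong {zero} h = refl
∏-cong {suc d} h = cong₂ _*_ (h zero) (∏-cong (h ∘ suc))

-- Adapted to `Mj`, in which the missing factor is replaced by 1 instead of being removed from the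
-- index set.
∏-remove : ∀ {d} (f g : Fin d → ℕ) j → f j ≡ 1 → (∀ k → k ≢ j → f k ≡ g k) → ∏ g ≡ g j * ∏ f
∏-remove f g zero fj h = cong (g zero *_)
  (trans (∏-cong (λ k → sym (h (suc k) (λ ())))) (sym (trans (cong (_* ∏ (f ∘ suc)) fj) (ℕ.*-identityˡ _))))
∏-remove f g (suc j) fj h = begin
  g zero * ∏ (g ∘ suc)                ≡⟨ cong₂ _*_ (sym (h zero (λ ()))) (∏-remove (f ∘ suc) (g ∘ suc) j fj (λ k k≢j → h (suc k) (k≢j ∘ suc-injective))) ⟩
  f zero * (g (suc j) * ∏ (f ∘ suc)) ≡⟨ sym (ℕ.*-assoc (f zero) (g (suc j)) _) ⟩
  f zero * g (suc j) * ∏ (f ∘ suc)   ≡⟨ cong (_* ∏ (f ∘ suc)) (ℕ.*-comm (f zero) (g (suc j))) ⟩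
  g (suc j) * f zero * ∏ (f ∘ suc)   ≡⟨ ℕ.*-assoc (g (suc j)) (f zero) _ ⟩
  g (suc j) * (f zero * ∏ (f ∘ suc)) ∎
  where open ≡-Reasoning

∣∑ : ∀ {d n} (f : Fin d → ℕ) → (∀ k → n ∣ f k) → + ∑ f ≋ + 0 [ n ]
∣∑ {zero} f h = ≋-reflexive refl
∣∑ {suc d} f h = ≋-+ {x = + f zero} {y = + 0} (≋-0 (h zero)) (∣∑ (f ∘ suc) (h ∘ suc))

-- Modulo `p j * p j` an element of `B` reduces to its single term `c j * Mj j`.
∑-≋ : ∀ {d n} (f : Fin d → ℕ) j → (∀ k → k ≢ j → n ∣ f k) → + ∑ f ≋ + f j [ n ]
∑-≋ {n = n} f zero h = subst (λ z → + ∑ f ≋ z [ n ]) (ℤ.+-identityʳ _)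
  (≋-+ {x = + f zero} (≋-reflexive refl) (∣∑ (f ∘ suc) (λ k → h (suc k) (λ ()))))
∑-≋ f (suc j) h = ≋-+ {x = + f zero} {y = + 0} (≋-0 (h zero (λ ()))) (∑-≋ (f ∘ suc) j (λ k k≢j → h (suc k) (k≢j ∘ suc-injective)))

primes-coprime : ∀ {p q} → Prime p → Prime q → p ≢ q → Coprime p q
primes-coprime {p} {q} p-prime q-prime p≢q {d} (d∣p , d∣q)
  with prime⇒irreducible p-prime d∣p | prime⇒irreducible q-prime d∣q
... | inj₁ e | _ = e
... | inj₂ _ | inj₁ e = e
... | inj₂ d≡p | inj₂ d≡q = ⊥-elim (p≢q (trans (sym d≡p) d≡q))

coprime-squares : ∀ {a b} → Coprime a b → Coprime (a * a) (b * b)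
coprime-squares c = coprime-* c′ c′
  where c′ = Coprimality.sym (coprime-* (Coprimality.sym c) (Coprimality.sym c))

∏≢0 : ∀ {d} (f : Fin d → ℕ) → (∀ k → NonZero (f k)) → NonZero (∏ f)
∏≢0 {zero} f h = _
∏≢0 {suc d} f h = ℕ.m*n≢0 (f zero) _ {{h zero}} {{∏≢0 (f ∘ suc) (h ∘ suc)}}

-- Keller's shift argument: from the tiling to words

module Moduli {d} (p : Fin d → ℕ) (prime : ∀ j → Prime (p j)) (p-injective : ∀ {i j} → p i ≡ p j → i ≡ j) where
  open Setup p

  P : Fin d → ℕ
  P j = p j * p j

  instance
    p≢0 : ∀ {j} → NonZero (p j)
    p≢0 {j} = prime⇒nonZero (prime j)

    P≢0 : ∀ {j} → NonZero (P j)
    P≢0 {j} = ℕ.m*n≢0 (p j) (p j)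

    M≢0 : NonZero M
    M≢0 = ∏≢0 P (λ k → P≢0 {k})

  -- The sequence multiplied in `Mj` is a local definition that cannot be named here; unification
  -- recovers it from `refl`.
  factors : ∀ j → Σ (Fin d → ℕ) λ s → Mj j ≡ ∏ s
  factors j = _ , refl

  factor : Fin d → Fin d → ℕ
  factor j = proj₁ (factors j)

  factor-self : ∀ j → factor j j ≡ 1
  factor-self j with j ≟ᶠ j
  ... | yes _ = refl
  ... | no j≢j = ⊥-elim (j≢j refl)

  factor-other : ∀ j k → k ≢ j → factor j k ≡ P k
  factor-other j k k≢j with k ≟ᶠ j
  ... | yes k≡j = ⊥-elim (k≢j k≡j)
  ... | no _ = refl

  p-coprime : ∀ j k → j ≢ k → Coprime (p j) (p k)
  p-coprime j k j≢k = primes-coprime (prime j) (prime k) (j≢k ∘ p-injective)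

  P-coprime : ∀ j k → j ≢ k → Coprime (P j) (P k)
  P-coprime j k j≢k = coprime-squares (p-coprime j k j≢k)

  factor-coprime : ∀ i j k → j ≢ k → Coprime (factor i j) (factor i k)
  factor-coprime i j k j≢k with j ≟ᶠ i | k ≟ᶠ i
  ... | yes _ | _ = Coprimality.1-coprimeTo _
  ... | no _ | yes _ = Coprimality.sym (Coprimality.1-coprimeTo _)
  ... | no _ | no _ = P-coprime j k j≢k

  M≡P*Mj : ∀ j → M ≡ P j * Mj j
  M≡P*Mj j = ∏-remove (factor j) P j (factor-self j) (factor-other j)

  M≡p*M/p : ∀ j → M ≡ p j * M/p j
  M≡p*M/p j = trans (M≡P*Mj j) (ℕ.*-assoc (p j) (p j) (Mj j))

  P∣M : ∀ j → P j ∣ M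
  P∣M = factor∣∏ P

  P∣Mj : ∀ j k → k ≢ j → P k ∣ Mj j
  P∣Mj j k k≢j = subst (_∣ Mj j) (factor-other j k k≢j) (factor∣∏ (factor j) k)

  p-coprime-Mj : ∀ j → Coprime (p j) (Mj j)
  p-coprime-Mj j = coprime-∏ (factor j) each
    where
    each : ∀ k → Coprime (p j) (factor j k)
    each k with k ≟ᶠ j
    ... | yes _ = Coprimality.sym (Coprimality.1-coprimeTo _)
    ... | no k≢j = coprime-* (p-coprime j k (k≢j ∘ sym)) (p-coprime j k (k≢j ∘ sym))

  Mj-coprime-P : ∀ j → Coprime (Mj j) (P j)
  Mj-coprime-P j = coprime-* (Coprimality.sym (p-coprime-Mj j)) (Coprimality.sym (p-coprime-Mj j))

  ≋-M : ∀ {x y} → (∀ j → x ≋ y [ P j ]) → x ≋ y [ M ]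
  ≋-M h = congruent (Signed.∣ᵤ⇒∣ (∏∣ P P-coprime (λ k → Signed.∣⇒∣ᵤ (_≋_[_].difference (h k)))))

  abstract
    reduce : ℕ → Fin M
    reduce x = fromℕ< (ℕ.m%n<n x M)

    reduce-≋ : ∀ x → + toℕ (reduce x) ≋ + x [ M ]
    reduce-≋ x = subst (λ z → + z ≋ + x [ M ]) (sym (toℕ-fromℕ< (ℕ.m%n<n x M))) (≋-% x)

  class : Fin d → Fin M → ℕ
  class j a = toℕ a % p j

  -- One coordinate of the statement that `x` lies in `a + B`: modulo the prime squares, `B` is a
  -- product of progressions.
  Covers : ℕ → Fin d → Fin M → Set
  Covers x j a = ∃ λ b → b < p j × + (toℕ a + b * Mj j) ≋ + x [ P j ]

  -- Modulo the prime square, `a` is the lift of its own class that `f` prescribes.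
  Meets : (Fin d → ℕ → ℕ) → Fin d → Fin M → Set
  Meets f j a = + toℕ a ≋ + (class j a + p j * f j (class j a)) [ P j ]

  -- Keller's shift argument in one coordinate: if the translates of the progression 0, m, …, (p-1)m by the
  -- elements of X tile ℤ/p², the translations run through one coset of pℤ/p².
  line : ∀ (X : Fin M → Set) j
    → (∀ x → ∃ λ a → (X a × Covers x j a) × (∀ a′ → X a′ → Covers x j a′ → a′ ≡ a))
    → ∀ f → ∃ λ a → (X a × Meets f j a) × (∀ a′ → X a′ → Meets f j a′ → a′ ≡ a)
  line X j tiles f = aₖ , (Xaₖ , meets) , λ a′ Xa′ meets′ → same Xa′ (covers-by-0 (target a′ Xa′ meets′)) Xaₖ self
    where
    q = p j
    m = Mj j

    same : ∀ {x a a′} → X a → Covers x j a → X a′ → Covers x j a′ → a ≡ a′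
    same {x} Xa c Xa′ c′ = let _ , _ , unique = tiles x in trans (unique _ Xa c) (sym (unique _ Xa′ c′))

    covers-by-0 : ∀ {x a} → + toℕ a ≋ + x [ P j ] → Covers x j a
    covers-by-0 {x} {a} h = 0 , >-nonZero⁻¹ q , subst (λ z → + z ≋ + x [ P j ]) (sym (ℕ.+-identityʳ (toℕ a))) h

    self : ∀ {a} → Covers (toℕ a) j a
    self = covers-by-0 (≋-reflexive refl)

    a₀ = proj₁ (tiles 0)
    Xa₀ = proj₁ (proj₁ (proj₂ (tiles 0)))
    s = toℕ a₀

    -- The end `a + q * m` of the progression starting at `a` must be the beginning of the next one,
    -- so `X` is closed under adding `q * m`.
    chain : ∀ k → ∃ λ a → X a × + toℕ a ≋ + (s + k * (q * m)) [ P j ]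
    chain zero = a₀ , Xa₀ , ≋-reflexive (cong +_ (sym (ℕ.+-identityʳ s)))
    chain (suc k) with chain k
    ... | a , Xa , e with tiles (toℕ a + q * m)
    ... | a′ , (Xa′ , zero , _ , e′) , _ = a′ , Xa′ , ≋-trans (subst (λ z → + z ≋ _ [ P j ]) (ℕ.+-identityʳ (toℕ a′)) e′)
      (≋-trans (≋-+ e (≋-reflexive {x = + (q * m)} refl)) (≋-reflexive (cong +_ (shuffle s (k * (q * m)) (q * m)))))
      where
      shuffle : ∀ a b c → a + b + c ≡ a + (c + b)
      shuffle = ℕSolver.solve-∀
    -- Were that point reached from `a′` in `suc b` steps, `a′` would lie `c = q - suc b` steps
    -- after `a`, inside the progression of `a`. Uniqueness gives `a ≡ a′`, hence `q` divides `c`,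
    -- although `0 < c < q`.
    ... | a′ , (Xa′ , suc b , b< , e′) , _ = ⊥-elim (ℕ.<⇒≱ c<q (∣⇒≤ {{>-nonZero (ℕ.m<n⇒0<n∸m b<)}}
        (coprime-divisor (p-coprime-Mj j) (subst (q ∣_) (ℕ.*-comm c m) (∣-trans (m∣m*n q) (≋-0⁻¹ c*m≋0))))))
      where
      c = q ∸ suc b
      c<q : c < q
      c<q = ℕ.∸-monoʳ-< z<s (ℕ.<⇒≤ b<)
      a+cm≋a′ : + (toℕ a + c * m) ≋ + toℕ a′ [ P j ]
      a+cm≋a′ = ≋-cancelʳ _ _ (suc b * m) (≋-trans (≋-reflexive (cong +_ (trans (ℕ.+-assoc (toℕ a) _ _)
        (cong (_+_ (toℕ a)) (trans (sym (ℕ.*-distribʳ-+ m c (suc b))) (cong (_* m) (ℕ.m∸n+n≡m (ℕ.<⇒≤ b<)))))))) (≋-sym e′))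
      a≡a′ : a ≡ a′
      a≡a′ = same Xa (c , c<q , a+cm≋a′) Xa′ self
      c*m≋0 : + (c * m) ≋ + 0 [ P j ]
      c*m≋0 = ≋-cancelʳ (c * m) 0 (toℕ a) (≋-trans (≋-reflexive (cong +_ (ℕ.+-comm (c * m) (toℕ a))))
        (subst (λ z → + (toℕ a + c * m) ≋ + toℕ z [ P j ]) (sym a≡a′) a+cm≋a′))

    r = s % q

    chain-class : ∀ k → class j (proj₁ (chain k)) ≡ r
    chain-class k = let _ , _ , e = chain k in ≋⇒%≡ (≋-trans (≋-weaken (m∣m*n q) e)
      (≋-trans (≋-+ (≋-reflexive {x = + s} refl) (≋-0 (∣n⇒∣m*n k (m∣m*n m)))) (≋-reflexive (ℤ.+-identityʳ (+ s)))))

    -- Since `s = r + q * (s / q)`, the element `s + k * (q * m)` of the chain is `r + q * f j r`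
    -- modulo `q * q` as soon as `k * m` is `f j r - s / q` modulo `q`.
    solution = invert (Coprimality.sym (p-coprime-Mj j)) (+ f j r - + (s / q))
    k = proj₁ solution
    aₖ = proj₁ (chain k)
    Xaₖ = proj₁ (proj₂ (chain k))

    hits : + (s + k * (q * m)) ≋ + (r + q * f j r) [ P j ]
    hits = ≋-trans (≋-reflexive left) (≋-trans (≋-+ (≋-reflexive {x = + s} refl) (≋-scale q (proj₂ solution))) (≋-reflexive right))
      where
      assoc : ∀ q k m → k ℤ.* (q ℤ.* m) ≡ q ℤ.* (k ℤ.* m)
      assoc = solve-∀
      left : + (s + k * (q * m)) ≡ + s ℤ.+ + q ℤ.* (+ k ℤ.* + m)
      left = cong (ℤ._+_ (+ s)) (trans (ℤ.pos-* k (q * m)) (trans (cong (ℤ._*_ (+ k)) (ℤ.pos-* q m)) (assoc (+ q) (+ k) (+ m))))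
      cancel : ∀ r q t g → (r ℤ.+ t ℤ.* q) ℤ.+ q ℤ.* (g - t) ≡ r ℤ.+ q ℤ.* g
      cancel = solve-∀
      right : + s ℤ.+ + q ℤ.* (+ f j r - + (s / q)) ≡ + (r + q * f j r)
      right = trans (cong (λ z → z ℤ.+ + q ℤ.* (+ f j r - + (s / q)))
          (trans (cong +_ (ℕ.m≡m%n+[m/n]*n s q)) (cong (ℤ._+_ (+ r)) (ℤ.pos-* (s / q) q))))
        (trans (cancel (+ r) (+ q) (+ (s / q)) (+ f j r)) (cong (ℤ._+_ (+ r)) (sym (ℤ.pos-* q (f j r)))))

    meets : Meets f j aₖ
    meets = subst (λ c → + toℕ aₖ ≋ + (c + q * f j c) [ P j ]) (sym (chain-class k)) (≋-trans (proj₂ (proj₂ (chain k))) hits)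

    -- The chain exhausts `X`: write `a - s` as `n * m` modulo `q * q`. Then the chain element
    -- number `n / q` covers `a` with `n % q` further steps, and `a` also covers itself, so the two
    -- coincide.
    all-classes : ∀ a → X a → class j a ≡ r
    all-classes a Xa = trans (cong (class j) (same Xa self (proj₁ (proj₂ (chain n/q))) reaches)) (chain-class n/q)
      where
      index = invert (Mj-coprime-P j) (+ toℕ a - + s)
      n = proj₁ index
      n/q = n / q
      aₙ = proj₁ (chain n/q)
      regroup : s + n/q * (q * m) + n % q * m ≡ s + n * m
      regroup = trans (expand s n/q q m (n % q)) (cong (λ z → s + z * m) (sym (ℕ.m≡m%n+[m/n]*n n q)))
        where
        expand : ∀ s k q m b → s + k * (q * m) + b * m ≡ s + (b + k * q) * m
        expand = ℕSolver.solve-∀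
      cancel : ∀ s a → s ℤ.+ (a - s) ≡ a
      cancel = solve-∀
      reaches : Covers (toℕ a) j aₙ
      reaches = n % q , ℕ.m%n<n n q , ≋-trans (≋-+ (proj₂ (proj₂ (chain n/q))) (≋-reflexive {x = + (n % q * m)} refl))
        (≋-trans (≋-reflexive (trans (cong +_ regroup) (cong (ℤ._+_ (+ s)) (ℤ.pos-* n m))))
        (≋-trans (≋-+ (≋-reflexive {x = + s} refl) (proj₂ index)) (≋-reflexive (cancel (+ s) (+ toℕ a)))))

    target : ∀ a′ → X a′ → Meets f j a′ → + toℕ a′ ≋ + toℕ aₖ [ P j ]
    target a′ Xa′ h = ≋-trans h (subst (λ c → + (c + q * f j c) ≋ + toℕ aₖ [ P j ])
      (trans (chain-class k) (sym (all-classes a′ Xa′))) (≋-sym meets))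

  module Words (A : SubsetZ M) (tiling : Tiling M A B) where

    Tiles : (Fin d → Fin M → Set) → Set
    Tiles K = ∃ λ a → (A a × (∀ j → K j a)) × (∀ a′ → A a′ → (∀ j → K j a′) → a′ ≡ a)

    module Covering (x : Fin d → ℕ) where
      -- Coefficients of the Chinese remainder solution: modulo `P j` only the term `z j * Mj j`
      -- survives, and it is `x j`.
      z : Fin d → ℕ
      z j = proj₁ (invert (Mj-coprime-P j) (+ x j))

      x̂ : Fin M
      x̂ = reduce (∑ (λ j → z j * Mj j))

      digits : ∀ (e : Fin d → ℕ) j → + ∑ (λ k → e k * Mj k) ≋ + (e j * Mj j) [ P j ]
      digits e j = ∑-≋ (λ k → e k * Mj k) j (λ k k≢j → ∣n⇒∣m*n (e k) (P∣Mj k j (k≢j ∘ sym)))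

      x̂≋ : ∀ j → + toℕ x̂ ≋ + x j [ P j ]
      x̂≋ j = ≋-trans (≋-weaken (P∣M j) (reduce-≋ _)) (≋-trans (digits z j)
        (≋-trans (≋-reflexive (ℤ.pos-* (z j) (Mj j))) (proj₂ (invert (Mj-coprime-P j) (+ x j)))))

      covers : ∀ a b → B b → (+ toℕ a ℤ.+ + toℕ b) ≡ᵐ + toℕ x̂ [mod M ] → ∀ j → Covers (x j) j a
      covers a b (c , c< , b≡) a+b≡ j = c j , c< j ,
        ≋-trans (≋-+ (≋-reflexive {x = + toℕ a} refl)
          (≋-sym (≋-trans (≋-weaken (P∣M j) (≡ᵐ⇒≋ {+ toℕ b} {+ ∑ (λ k → c k * Mj k)} {M} b≡)) (digits c j))))
        (≋-trans (≋-weaken (P∣M j) (≡ᵐ⇒≋ {+ toℕ a ℤ.+ + toℕ b} {+ toℕ x̂} {M} a+b≡)) (x̂≋ j))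

      decompose : ∀ a → (∀ j → Covers (x j) j a) → ∃ λ b → B b × (+ toℕ a ℤ.+ + toℕ b) ≡ᵐ + toℕ x̂ [mod M ]
      decompose a h = b , (e , (λ j → proj₁ (proj₂ (h j))) , ≋⇒≡ᵐ {+ toℕ b} {+ ∑ (λ k → e k * Mj k)} {M} (reduce-≋ _)) ,
        ≋⇒≡ᵐ {+ toℕ a ℤ.+ + toℕ b} {+ toℕ x̂} {M} (≋-M sum≋)
        where
        e : Fin d → ℕ
        e j = proj₁ (h j)
        b : Fin M
        b = reduce (∑ (λ k → e k * Mj k))
        sum≋ : ∀ j → + toℕ a ℤ.+ + toℕ b ≋ + toℕ x̂ [ P j ]
        sum≋ j = ≋-trans (≋-+ (≋-reflexive {x = + toℕ a} refl) (≋-trans (≋-weaken (P∣M j) (reduce-≋ _)) (digits e j)))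
          (≋-trans (proj₂ (proj₂ (h j))) (≋-sym (x̂≋ j)))

      covering : Tiles (λ j → Covers (x j) j)
      covering =
        let a , b , Aa , Bb , a+b≡ = proj₁ tiling x̂
            unique : ∀ a′ → A a′ → (∀ j → Covers (x j) j a′) → a′ ≡ a
            unique a′ Aa′ h = let b′ , Bb′ , a′+b′≡ = decompose a′ h in
              proj₁ (proj₂ tiling x̂ a′ b′ a b Aa′ Bb′ Aa Bb a′+b′≡ a+b≡)
        in a , (Aa , covers a b Bb a+b≡) , unique

    open Covering using (covering)

    -- Interpolates between the tiling (`n = 0`, all directions covered) and the words (`n = d`, all
    -- directions met), so that the shift argument treats one direction at a time.
    Mixed : ℕ → (Fin d → ℕ → ℕ) → (Fin d → ℕ) → Fin d → Fin M → Set
    Mixed n f x j a = (toℕ j < n × Meets f j a) ⊎ (n ≤ toℕ j × Covers (x j) j a)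

    module Step (f : Fin d → ℕ → ℕ) (i : Fin d) (tiles : ∀ x → Tiles (Mixed (toℕ i) f x)) (x : Fin d → ℕ) where
      n = toℕ i

      replaced : ℕ → Fin d → ℕ
      replaced y j with j ≟ᶠ i
      ... | yes _ = y
      ... | no _ = x j

      replaced-here : ∀ y → replaced y i ≡ y
      replaced-here y with i ≟ᶠ i
      ... | yes _ = refl
      ... | no i≢i = ⊥-elim (i≢i refl)

      replaced-there : ∀ y j → j ≢ i → replaced y j ≡ x j
      replaced-there y j j≢i with j ≟ᶠ i
      ... | yes j≡i = ⊥-elim (j≢i j≡i)
      ... | no _ = refl

      transport : ∀ u v j a → u j ≡ v j → Mixed n f u j a → Mixed n f v j a
      transport u v j a e (inj₁ m) = inj₁ m
      transport u v j a e (inj₂ (n≤j , c)) = inj₂ (n≤j , subst (λ w → Covers w j a) e c)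

      -- The requirements in the other directions are frozen. Letting the target vary in direction
      -- `i` alone shows that this slice of `A` satisfies the one-dimensional tiling hypothesis of
      -- `line`.
      X : Fin M → Set
      X a = A a × (∀ j → j ≢ i → Mixed n f x j a)

      covers-at : ∀ y a → Mixed n f (replaced y) i a → Covers y i a
      covers-at y a (inj₁ (i<i , _)) = ⊥-elim (ℕ.<-irrefl refl i<i)
      covers-at y a (inj₂ (_ , c)) = subst (λ w → Covers w i a) (replaced-here y) c

      join : ∀ y a → (∀ j → j ≢ i → Mixed n f x j a) → Covers y i a → ∀ j → Dec (j ≡ i) → Mixed n f (replaced y) j a
      join y a h c j (yes j≡i) = subst (λ k → Mixed n f (replaced y) k a) (sym j≡i)
        (inj₂ (ℕ.≤-refl , subst (λ w → Covers w i a) (sym (replaced-here y)) c))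
      join y a h c j (no j≢i) = transport x (replaced y) j a (sym (replaced-there y j j≢i)) (h j j≢i)

      slice : ∀ y → ∃ λ a → (X a × Covers y i a) × (∀ a′ → X a′ → Covers y i a′ → a′ ≡ a)
      slice y = let a , (Aa , h) , unique = tiles (replaced y) in
        a , ((Aa , λ j j≢i → transport (replaced y) x j a (replaced-there y j j≢i) (h j)) , covers-at y a (h i)) ,
        λ a′ (Aa′ , h′) c → unique a′ Aa′ (λ j → join y a′ h′ c j (j ≟ᶠ i))

      forward : ∀ a → (∀ j → j ≢ i → Mixed n f x j a) → Meets f i a → ∀ j → Dec (j ≡ i) → Mixed (suc n) f x j a
      forward a h m j (yes j≡i) = subst (λ k → Mixed (suc n) f x k a) (sym j≡i) (inj₁ (ℕ.≤-refl , m))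
      forward a h m j (no j≢i) with h j j≢i
      ... | inj₁ (j<n , c) = inj₁ (ℕ.m<n⇒m<1+n j<n , c)
      ... | inj₂ (n≤j , c) = inj₂ (ℕ.≤∧≢⇒< n≤j (λ e → j≢i (toℕ-injective (sym e))) , c)

      backward : ∀ a → (∀ j → Mixed (suc n) f x j a) → ∀ j → j ≢ i → Mixed n f x j a
      backward a h j j≢i with h j
      ... | inj₁ (j<1+n , c) = inj₁ (ℕ.≤∧≢⇒< (ℕ.≤-pred j<1+n) (λ e → j≢i (toℕ-injective e)) , c)
      ... | inj₂ (n<j , c) = inj₂ (ℕ.<⇒≤ n<j , c)

      meets-at : ∀ a → Mixed (suc n) f x i a → Meets f i a
      meets-at a (inj₁ (_ , m)) = m
      meets-at a (inj₂ (n<n , _)) = ⊥-elim (ℕ.<-irrefl refl n<n)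

      step : Tiles (Mixed (suc n) f x)
      step = let a , ((Aa , h) , m) , unique = line X i slice f in
        a , (Aa , λ j → forward a h m j (j ≟ᶠ i)) ,
        λ a′ Aa′ h′ → unique a′ (Aa′ , backward a′ h′) (meets-at a′ (h′ i))

    mixed : ∀ n → n ≤ d → ∀ f x → Tiles (Mixed n f x)
    mixed zero _ f x = let a , (Aa , covers) , unique = covering x in
      a , (Aa , λ j → inj₂ (z≤n , covers j)) , λ a′ Aa′ h → unique a′ Aa′ λ j → uncover (h j)
      where
      uncover : ∀ {j a} → Mixed 0 f x j a → Covers (x j) j a
      uncover (inj₂ (_ , c)) = c
    mixed (suc n) n<d f x = subst (λ k → Tiles (Mixed (suc k) f x)) (toℕ-fromℕ< n<d)
      (Step.step f (fromℕ< n<d) (subst (λ k → ∀ x → Tiles (Mixed k f x)) (sym (toℕ-fromℕ< n<d)) (mixed n (ℕ.<⇒≤ n<d) f)) x)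

    abstract
      meeting : ∀ f → Tiles (Meets f)
      -- No direction is left to be covered, so the zero target is a mere placeholder.
      meeting f = let a , (Aa , h) , unique = mixed d ℕ.≤-refl f (λ _ → 0) in
        a , (Aa , λ j → meets (h j)) , λ a′ Aa′ h′ → unique a′ Aa′ (λ j → inj₁ (toℕ<n j , h′ j))
        where
        meets : ∀ {j a} → Mixed d f (λ _ → 0) j a → Meets f j a
        meets (inj₁ (_ , m)) = m
        meets {j} (inj₂ (d≤j , _)) = ⊥-elim (ℕ.<⇒≱ (toℕ<n j) d≤j)

-- Labels of directions, and the choice of a smallest prime

-- Labels start at 1 and directions at 0. Surplus labels become further names of direction 0, which
-- surjectivity permits.
label : ∀ {m} → ℕ → Fin (suc m)
label {m} k with k ∸ 1 <? suc m
... | yes k<m = fromℕ< k<m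
... | no _ = zero

vertex : ∀ {m} → m < 6 → suc m ∈ vertices
vertex {0} _ = here refl
vertex {1} _ = there (here refl)
vertex {2} _ = there (there (here refl))
vertex {3} _ = there (there (there (here refl)))
vertex {4} _ = there (there (there (there (here refl))))
vertex {5} _ = there (there (there (there (there (here refl)))))
vertex {suc (suc (suc (suc (suc (suc m)))))} (s≤s (s≤s (s≤s (s≤s (s≤s (s≤s ()))))))

label-onto : ∀ {m} → suc m ≤ 6 → ∀ (k : Fin (suc m)) → ∃ λ n → n ∈ vertices × label n ≡ k
label-onto {m} m≤5 k = suc (toℕ k) , vertex (ℕ.≤-trans (toℕ<n k) m≤5) , eq
  where
  eq : label (suc (toℕ k)) ≡ k
  eq with toℕ k <? suc m
  ... | yes k<m = fromℕ<-toℕ k k<m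
  ... | no k≮m = ⊥-elim (k≮m (toℕ<n k))

minimum : ∀ {n} (f : Fin (suc n) → ℕ) → ∃ λ i → ∀ j → f i ≤ f j
minimum {zero} f = zero , λ { zero → ℕ.≤-refl }
minimum {suc n} f with minimum (f ∘ suc)
... | i , min with ℕ.≤-total (f zero) (f (suc i))
... | inj₁ le = zero , λ { zero → ℕ.≤-refl ; (suc j) → ℕ.≤-trans le (min j) }
... | inj₂ ge = suc i , λ { zero → ge ; (suc j) → min j }

-- Columns, twins and divisors

module Conclusion {d} (p : Fin d → ℕ) (prime : ∀ j → Prime (p j)) (p-injective : ∀ {i j} → p i ≡ p j → i ≡ j)
  (A : SubsetZ (Setup.M p)) (tiling : Tiling (Setup.M p) A (Setup.B p)) where
  open Setup p
  open Moduli p prime p-injective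
  open Words A tiling

  p≰1 : ∀ j → 1 < p j
  p≰1 j = nonTrivial⇒n>1 (p j) {{prime⇒nonTrivial (prime j)}}

  instance
    M/p≢0 : ∀ {i} → NonZero (M/p i)
    M/p≢0 {i} = ℕ.m*n≢0⇒n≢0 (p i) {{subst NonZero (M≡p*M/p i) M≢0}}

  -- The gcd is a multiple of `M/p i` and divides `M`, so the quotient by `M/p i` divides the prime
  -- `p i`. The quotient `p i` itself would make the difference divisible by all of `M`, against the
  -- last hypothesis.
  twin-gcd : ∀ i (a a′ : Fin M) → (∀ j → j ≢ i → + toℕ a ≋ + toℕ a′ [ P j ]) → + toℕ a ≋ + toℕ a′ [ p i ]
    → ¬ (+ toℕ a ≋ + toℕ a′ [ P i ]) → ℤ.gcd (+ toℕ a - + toℕ a′) (+ M) ≡ + (M/p i)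
  twin-gcd i a a′ off on ¬P with gcd-greatest M/p∣n (subst (M/p i ∣_) (sym (M≡p*M/p i)) (n∣m*n (p i)))
    where
    n = ℤ.∣ + toℕ a - + toℕ a′ ∣
    divisor : ∀ {m} → + toℕ a ≋ + toℕ a′ [ m ] → m ∣ n
    divisor h = Signed.∣⇒∣ᵤ (_≋_[_].difference h)
    each : ∀ j → factor i j ∣ n
    each j with j ≟ᶠ i
    ... | yes _ = 1∣ n
    ... | no j≢i = divisor (off j j≢i)
    M/p∣n : M/p i ∣ n
    M/p∣n = coprime-*-∣ (p-coprime-Mj i) (divisor on) (∏∣ (factor i) (factor-coprime i) each)
  ... | dividesℕ q e with prime⇒irreducible (prime i) {q}
      (*-cancelʳ-∣ (M/p i) (subst₂ _∣_ e (M≡p*M/p i) (gcd[m,n]∣n ℤ.∣ + toℕ a - + toℕ a′ ∣ M)))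
  ... | inj₁ q≡1 = cong +_ (trans e (trans (cong (_* M/p i) {x = q} q≡1) (ℕ.*-identityˡ (M/p i))))
  ... | inj₂ q≡p = ⊥-elim (¬P (congruent (Signed.∣ᵤ⇒∣ (∣-trans (P∣M i)
      (subst (_∣ ℤ.∣ + toℕ a - + toℕ a′ ∣) (trans e (trans (cong (_* M/p i) {x = q} q≡p) (sym (M≡p*M/p i)))) (gcd[m,n]∣m ℤ.∣ + toℕ a - + toℕ a′ ∣ M))))))

  0∈B : B (reduce 0)
  0∈B = (λ _ → 0) , (λ j → >-nonZero⁻¹ (p j)) , ≋⇒≡ᵐ {+ toℕ (reduce 0)} {+ ∑ (λ j → 0 * Mj j)} {M}
    (≋-trans (reduce-≋ 0) (≋-sym (∣∑ (λ j → 0 * Mj j) (λ _ → M ∣0))))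

  -- The tiling decides membership: `x` has a decomposition `a + b`, and if `x` is in `A` then
  -- `x + 0` is another one, so that `x` must be `a`.
  A? : ∀ x → Dec (A x)
  A? x with proj₁ tiling x
  ... | a , b , Aa , Bb , a+b≡ with a ≟ᶠ x
  ... | yes refl = yes Aa
  ... | no a≢x = no λ Ax → a≢x (proj₁ (proj₂ tiling x a b x (reduce 0) Aa Bb Ax 0∈B a+b≡
    (≋⇒≡ᵐ {+ toℕ x ℤ.+ + toℕ (reduce 0)} {+ toℕ x} {M}
      (≋-trans (≋-+ (≋-reflexive {x = + toℕ x} refl) (reduce-≋ 0)) (≋-reflexive (ℤ.+-identityʳ (+ toℕ x)))))))

  ∈mod? : ∀ n → Dec ((+ n) ∈mod A)
  ∈mod? n = any? λ x → A? x ×-dec (M ∣? ℤ.∣ + toℕ x - + n ∣)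

  column? : ∀ u i → Dec (TranslateFiIn A u i)
  column? u i = map′ (λ h t t<p → subst (λ s → (+ (toℕ u + s * M/p i)) ∈mod A) (toℕ-fromℕ< t<p) (h (fromℕ< t<p)))
    (λ h t → h (toℕ t) (toℕ<n t)) (all? λ t → ∈mod? (toℕ u + toℕ t * M/p i))

  word : (Fin d → ℕ → ℕ) → Fin M
  word f = proj₁ (meeting f)

  word∈A : ∀ f → A (word f)
  word∈A f = proj₁ (proj₁ (proj₂ (meeting f)))

  word-meets : ∀ f j → Meets f j (word f)
  word-meets f = proj₂ (proj₁ (proj₂ (meeting f)))

  word-unique : ∀ f a → A a → (∀ j → Meets f j a) → a ≡ word f
  word-unique f = proj₂ (proj₂ (meeting f))

  Meets-cong : ∀ f g j a → f j (class j a) ≡ g j (class j a) → Meets f j a → Meets g j a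
  Meets-cong f g j a e = subst (λ v → + toℕ a ≋ + (class j a + p j * v) [ P j ]) e

  meets-at : ∀ f j a c → class j a ≡ c → Meets f j a → + toℕ a ≋ + (c + p j * f j c) [ P j ]
  meets-at f j a c refl h = h

  agree : ∀ f g j a a′ → Meets f j a → Meets g j a′ → class j a′ ≡ class j a
    → g j (class j a) ≡ f j (class j a) → + toℕ a′ ≋ + toℕ a [ P j ]
  agree f g j a a′ h h′ c e = ≋-trans (meets-at g j a′ (class j a) c h′)
    (≋-trans (≋-reflexive (cong (λ v → + (class j a + p j * v)) e)) (≋-sym h))

  shifted-off : ∀ i j t (a : ℕ) → j ≢ i → + (a + t * M/p i) ≋ + a [ P j ]
  shifted-off i j t a j≢i = ≋-trans (≋-+ (≋-reflexive {x = + a} refl)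
    (≋-0 (∣n⇒∣m*n t (∣n⇒∣m*n (p i) (P∣Mj i j j≢i))))) (≋-reflexive (ℤ.+-identityʳ (+ a)))

  no-column⇒system : (∀ u i → A u → ¬ TranslateFiIn A u i) → CoverSystem d
  no-column⇒system no-column = record
    { classes = λ f j → class j (word f)
    ; certified = λ f g h j → cong (class j) (sym (word-unique g (word f) (word∈A f)
        (λ j → Meets-cong f g j (word f) (sym (h j)) (word-meets f j))))
    ; mobile = mobile }
    where
    mobile : ∀ f i → ∃ λ v → ∃ λ j → class j (word (update f i (class i (word f)) v)) ≢ class j (word f)
    mobile f i with ¬∀⟶∃¬ (p i) (λ t → (+ (toℕ (word f) + toℕ t * M/p i)) ∈mod A) (λ t → ∈mod? (toℕ (word f) + toℕ t * M/p i))
      (λ h → no-column (word f) i (word∈A f)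
        (λ t t<p → subst (λ s → (+ (toℕ (word f) + s * M/p i)) ∈mod A) (toℕ-fromℕ< t<p) (h (fromℕ< t<p))))
    ... | t , t∉ = v , ¬∀⟶∃¬ d _ (λ j → class j a′ ≟ class j a)
        (λ same → t∉ (a′ , word∈A g , ≋⇒≡ᵐ {+ toℕ a′} {+ (toℕ a + toℕ t * M/p i)} {M} (≋-M (λ j → close same j (j ≟ᶠ i)))))
      where
      a = word f
      r = class i a
      -- The value for which `r + p i * v` is the point `a + t * M/p i` missing from `A`. If no
      -- class changed, the new word would have the residues of that point in every direction and
      -- put it into `A`.
      v = toℕ a / p i + toℕ t * Mj i
      g = update f i r v
      a′ = word g
      regroup : r + p i * v ≡ toℕ a + toℕ t * M/p i
      regroup = trans (expand r (p i) (toℕ a / p i) (toℕ t) (Mj i)) (cong (_+ toℕ t * M/p i) (sym (ℕ.m≡m%n+[m/n]*n (toℕ a) (p i))))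
        where
        expand : ∀ r p q t m → r + p * (q + t * m) ≡ r + q * p + t * (p * m)
        expand = ℕSolver.solve-∀
      close : (∀ j → class j a′ ≡ class j a) → ∀ j → Dec (j ≡ i) → + toℕ a′ ≋ + (toℕ a + toℕ t * M/p i) [ P j ]
      close same j (yes refl) = ≋-trans (meets-at g j a′ r (same j) (word-meets g j))
        (≋-reflexive (cong +_ (trans (cong (λ z → r + p i * z) (update-here f i r v)) regroup)))
      close same j (no j≢i) = ≋-trans
        (agree f g j a a′ (word-meets f j) (word-meets g j) (same j) (update-there f i r v j _ (λ i≡j → ⊥-elim (j≢i (sym i≡j)))))
        (≋-sym (shifted-off i j (toℕ t) (toℕ a) j≢i))

  column⇒Div : ∀ u i → A u → TranslateFiIn A u i → M/p i ∈Div A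
  -- The point `u + M/p i` of the column already yields the divisor.
  column⇒Div u i Au column with column 1 (p≰1 i)
  ... | x , Ax , x≡ = x , u , Ax , Au , twin-gcd i x u
      (λ j j≢i → ≋-trans (≋-weaken (P∣M j) x≋) (shifted-off i j 1 (toℕ u) j≢i))
      (≋-trans (≋-weaken (∣-trans (m∣m*n (p i)) (P∣M i)) x≋) (≋-trans (≋-+ (≋-reflexive {x = + toℕ u} refl)
        (≋-0 (∣n⇒∣m*n 1 (m∣m*n (Mj i))))) (≋-reflexive (ℤ.+-identityʳ (+ toℕ u)))))
      -- Otherwise `p i` would divide `Mj i`, to which it is coprime.
      (λ x≋u → ℕ.<⇒≢ (p≰1 i) (sym (p-coprime-Mj i (∣-refl , *-cancelˡ-∣ (p i) (subst (P i ∣_) (ℕ.*-identityˡ (M/p i))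
        (≋-0⁻¹ (≋-cancelʳ (1 * M/p i) 0 (toℕ u) (≋-trans (≋-reflexive (cong +_ (ℕ.+-comm (1 * M/p i) (toℕ u))))
          (≋-trans (≋-sym (≋-weaken (P∣M i) x≋)) x≋u)))))))))
    where
    x≋ : + toℕ x ≋ + (toℕ u + 1 * M/p i) [ M ]
    x≋ = ≡ᵐ⇒≋ {+ toℕ x} {+ (toℕ u + 1 * M/p i)} {M} x≡

  Div? : ∀ i → Dec (M/p i ∈Div A)
  Div? i = any? λ a → any? λ a′ → A? a ×-dec A? a′ ×-dec (ℤ.gcd (+ toℕ a - + toℕ a′) (+ M) ℤ.≟ + (M/p i))

  -- The contradiction alone exhibits no column; a finite search over decidable conditions does.
  column : ¬ CoverSystem d → ∃[ u ] ∃[ i ] (A u × TranslateFiIn A u i)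
  column no-system with any? (λ u → any? λ i → A? u ×-dec column? u i)
  ... | yes c = c
  ... | no ¬c = ⊥-elim (no-system (no-column⇒system (λ u i Au c → ¬c (u , i , Au , c))))

-- Dimension seven: sections and twins

module Section {d} (p : Fin (suc d) → ℕ) (prime : ∀ j → Prime (p j)) (p-injective : ∀ {i j} → p i ≡ p j → i ≡ j)
  (A : SubsetZ (Setup.M p)) (tiling : Tiling (Setup.M p) A (Setup.B p)) where
  open Setup p
  open Moduli p prime p-injective
  open Conclusion p prime p-injective A tiling

  j₀ : Fin (suc d)
  j₀ = proj₁ (minimum p)

  smaller : ∀ k → p j₀ < p (punchIn j₀ k)
  smaller k = ℕ.≤∧≢⇒< (proj₂ (minimum p) _) (λ e → punchInᵢ≢i j₀ k (sym (p-injective e)))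

  -- The value 0 is an arbitrary choice. What matters is that it is the same for all `f`: two words
  -- with equal classes in direction `j₀` are then congruent modulo `P j₀`.
  fill : Assignment d → Assignment (suc d)
  fill f j c with j₀ ≟ᶠ j
  ... | yes _ = 0
  ... | no j₀≢j = f (punchOut j₀≢j) c

  fill-j₀ : ∀ f c → fill f j₀ c ≡ 0
  fill-j₀ f c with j₀ ≟ᶠ j₀
  ... | yes _ = refl
  ... | no j₀≢j₀ = ⊥-elim (j₀≢j₀ refl)

  fill-punchIn : ∀ f k c → fill f (punchIn j₀ k) c ≡ f k c
  fill-punchIn f k c with j₀ ≟ᶠ punchIn j₀ k
  ... | yes e = ⊥-elim (punchInᵢ≢i j₀ k (sym e))
  ... | no ≢ = cong (λ l → f l c) (punchOut-punchIn j₀)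

  cases : ∀ (Q : Fin (suc d) → Set) → Q j₀ → (∀ k → Q (punchIn j₀ k)) → ∀ j → Q j
  cases Q q h j with j₀ ≟ᶠ j
  ... | yes e = subst Q e q
  ... | no ≢ = subst Q (punchIn-punchOut ≢) (h (punchOut ≢))

  -- The system forgets the class in direction `j₀`. The condition `certified` survives this because
  -- all filled assignments agree there, while `mobile` has to find a change outside `j₀` and uses
  -- the absence of twins for it.
  no-twin⇒system : (∀ i → ¬ (M/p i ∈Div A)) → CoverSystem d
  no-twin⇒system no-twin = record
    { classes = λ f k → class (punchIn j₀ k) (word (fill f))
    ; certified = λ f g h k → cong (class (punchIn j₀ k)) (sym (word-unique (fill g) (word (fill f)) (word∈A (fill f))
        (λ j → Meets-cong (fill f) (fill g) j (word (fill f)) (matches f g h j) (word-meets (fill f) j))))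
    ; mobile = mobile }
    where
    matches : ∀ f g → (∀ k → g k (class (punchIn j₀ k) (word (fill f))) ≡ f k (class (punchIn j₀ k) (word (fill f))))
      → ∀ j → fill f j (class j (word (fill f))) ≡ fill g j (class j (word (fill f)))
    matches f g h = cases _ (trans (fill-j₀ f _) (sym (fill-j₀ g _)))
      (λ k → trans (fill-punchIn f k _) (trans (sym (h k)) (sym (fill-punchIn g k _))))

    mobile : ∀ f k → ∃ λ v → ∃ λ l → class (punchIn j₀ l) (word (fill (update f k (class (punchIn j₀ k) (word (fill f))) v)))
      ≢ class (punchIn j₀ l) (word (fill f))
    mobile f k = let v , ¬same = ¬∀⟶∃¬ (p i) Same (λ v → all? λ l → classes (toℕ v) l ≟ class (punchIn j₀ l) (word (fill f))) impossible
                     l , ≢ = ¬∀⟶∃¬ d _ (λ l → classes (toℕ v) l ≟ class (punchIn j₀ l) (word (fill f))) ¬same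
                 in toℕ v , l , ≢
      where
      i = punchIn j₀ k
      r = class i (word (fill f))
      g : ℕ → Assignment d
      g v = update f k r v
      w : ℕ → Fin M
      w v = word (fill (g v))
      classes : ℕ → Fin d → ℕ
      classes v l = class (punchIn j₀ l) (w v)
      Same : Fin (p i) → Set
      Same v = ∀ l → classes (toℕ v) l ≡ class (punchIn j₀ l) (word (fill f))
      -- Only p j₀ < p i classes are available in direction j₀, so two of the p i words share theirs: a twin.
      impossible : ¬ (∀ v → Same v)
      impossible same with pigeonhole (smaller k) (λ v → fromℕ< (ℕ.m%n<n (toℕ (w (toℕ v))) (p j₀)))
      ... | v , v′ , v<v′ , e = no-twin i (w (toℕ v) , w (toℕ v′) , word∈A _ , word∈A _ ,
          twin-gcd i _ _ (cases _ (λ _ → off₀) off) on λ h → ℕ.<⇒≢ v<v′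
            (ℕ.*-cancelˡ-≡ _ _ (p i) (ℕ.+-cancelˡ-≡ r _ _ (trans (sym (ℕ.m<n⇒m%n≡m (bound v)))
              (trans (≋⇒%≡ (≋-trans (≋-sym (value v)) (≋-trans h (value v′)))) (ℕ.m<n⇒m%n≡m (bound v′)))))))
        where
        off₀ : + toℕ (w (toℕ v)) ≋ + toℕ (w (toℕ v′)) [ P j₀ ]
        off₀ = agree (fill (g (toℕ v′))) (fill (g (toℕ v))) j₀ _ _ (word-meets _ j₀) (word-meets _ j₀)
          (fromℕ<-injective _ _ _ _ e) (trans (fill-j₀ (g (toℕ v)) _) (sym (fill-j₀ (g (toℕ v′)) _)))
        off : ∀ l → punchIn j₀ l ≢ i → + toℕ (w (toℕ v)) ≋ + toℕ (w (toℕ v′)) [ P (punchIn j₀ l) ]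
        off l ≢ = agree (fill (g (toℕ v′))) (fill (g (toℕ v))) (punchIn j₀ l) _ _ (word-meets _ _) (word-meets _ _)
          (trans (same v l) (sym (same v′ l)))
          (trans (fill-punchIn (g (toℕ v)) l _) (trans (unchanged v) (trans (sym (unchanged v′)) (sym (fill-punchIn (g (toℕ v′)) l _)))))
          where
          unchanged : ∀ (v : Fin (p i)) {c} → g (toℕ v) l c ≡ f l c
          unchanged v {c} = update-there f k r (toℕ v) l c (λ k≡l → ⊥-elim (≢ (cong (punchIn j₀) (sym k≡l))))
        value : ∀ (v : Fin (p i)) → + toℕ (w (toℕ v)) ≋ + (r + p i * toℕ v) [ P i ]
        value v = ≋-trans (meets-at (fill (g (toℕ v))) i _ r (same v k) (word-meets _ i))
          (≋-reflexive (cong (λ z → + (r + p i * z)) (trans (fill-punchIn (g (toℕ v)) k r) (update-here f k r (toℕ v)))))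
        residue : ∀ (v : Fin (p i)) → + toℕ (w (toℕ v)) ≋ + r [ p i ]
        residue v = ≋-trans (≋-weaken (m∣m*n (p i)) (value v)) (≋-trans (≋-+ (≋-reflexive {x = + r} refl)
          (≋-0 (m∣m*n (toℕ v)))) (≋-reflexive (ℤ.+-identityʳ (+ r))))
        on : + toℕ (w (toℕ v)) ≋ + toℕ (w (toℕ v′)) [ p i ]
        on = ≋-trans (residue v) (≋-sym (residue v′))
        -- These numbers are their own remainders modulo `P i`, so distinct `v` give words that are
        -- not congruent modulo `P i`.
        bound : ∀ (v : Fin (p i)) → r + p i * toℕ v < P i
        bound v = ℕ.<-≤-trans (ℕ.+-monoˡ-< (p i * toℕ v) (ℕ.m%n<n (toℕ (word (fill f))) (p i)))
          (subst (_≤ P i) (ℕ.*-suc (p i) (toℕ v)) (ℕ.*-monoʳ-≤ (p i) (toℕ<n v)))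

  twin : ¬ CoverSystem d → ∃[ i ] (M/p i ∈Div A)
  twin no-system with any? Div?
  ... | yes t = t
  ... | no ¬t = ⊥-elim (no-system (no-twin⇒system (λ i h → ¬t (i , h))))

-- Nonexistence of cover systems, and both claims

-- The bound six enters only through the labels: each direction needs one of the six vertices of the
-- certificate.
no-cover-system : ∀ {n} → 1 ≤ n → n ≤ 6 → ¬ CoverSystem n
no-cover-system {suc m} _ n≤6 system = no-game⇒no-system system
  (valid-sound (realised-game system) certificate lastStep certificate-valid) label (label-onto n≤6)

twin-in-dimension-7 : ∀ {d} → d ≡ 7 → (p : Fin d → ℕ) → (∀ j → Prime (p j)) → Injective _≡_ _≡_ p
  → let open Setup p in (A : SubsetZ M) → Tiling M A B → ∃[ i ] (M/p i ∈Div A)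
twin-in-dimension-7 refl p prime p-injective A tiling =
  Section.twin p prime p-injective A tiling (no-cover-system (s≤s z≤n) ℕ.≤-refl)

theorem1p8 : (d : ℕ) → 1 ≤ d → (p : Fin d → ℕ) → (∀ j → Prime (p j)) → Injective _≡_ _≡_ p
    → let open Setup p in
    (A : SubsetZ M) → Tiling M A B
    → ((d ≤ 6) → (∃[ u ] ∃[ i ] (A u × TranslateFiIn A u i))
    × (∃[ i ] (M/p i ∈Div A ⊎ M/p i ∈Div B)))
    × ((d ≡ 7) → ∃[ i ] (M/p i ∈Div A ⊎ M/p i ∈Div B))
theorem1p8 d 1≤d p prime p-injective A tiling =
  (λ d≤6 → let u , i , Au , c = column (no-cover-system 1≤d d≤6) in (u , i , Au , c) , i , inj₁ (column⇒Div u i Au c)) ,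
  (λ d≡7 → let i , twins = twin-in-dimension-7 d≡7 p prime p-injective A tiling in i , inj₁ twins)
  where open Conclusion p prime p-injective A tiling
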